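{- There exists $\varepsilon\in(0,1/2]$ such that for every constant $C>0$ there is a function $r=r(n)$ with $r(n)\geq C(\log n/n)^{1/2}$ for all $n$ for which it is not true that, with probability tending to $1$ as $n\to\infty$, all $(1/2+\varepsilon)$-subgraphs of $T_2(n,r(n))$ are Hamiltonian.
   Context: $T_2(n,r)$ is the random geometric graph defined as follows: sample $n$ independent uniformly random points of the $2$-dimensional torus $(\mathbb{R}/\mathbb{Z})^2$ as the vertices, and add an edge between any two vertices whose Euclidean distance in the torus is at most $r$. For a real number $\beta$, a subgraph $H$ of a graph $G$ is a $\beta$-subgraph of $G$ if $d_H(v)\geq \beta\, d_G(v)$ for all $v\in V(G)$. A graph is Hamiltonian if it contains a Hamilton cycle. -}

module Defs where

open import Data.Bool using (Bool; true; false)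
open import Data.Empty using (⊥; ⊥-elim)
open import Data.Fin using (Fin; toℕ)
open import Data.Fin.Permutation using (Permutation′; _⟨$⟩ʳ_)
open import Data.Fin.Subset using (Subset) renaming (∣_∣ to card)
open import Data.Integer as ℤ using (+_; -[1+_])
import Data.Integer.Properties as ℤ
open import Data.Nat as ℕ using (ℕ; zero; suc)
import Data.Nat.Properties as ℕ
open import Data.Product using (∃; _×_; _,_; proj₁; proj₂)
open import Data.Rational as ℚ
  using (ℚ; mkℚ; 0ℚ; 1ℚ; ½; _/_; positive; nonNegative)
import Data.Rational.Properties as ℚ
open import Data.Rational.Solver using (module +-*-Solver)
open import Data.Rational.Unnormalised as ℚᵘ using (mkℚᵘ)
import Data.Rational.Unnormalised.Properties as ℚᵘ
open import Data.Sum as Sum using (_⊎_; inj₁; inj₂)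
open import Data.Vec using (tabulate)
open import Data.Vec.Functional using (foldr)
open import Function.Bundles using (_⇔_)
open import Relation.Binary.PropositionalEquality
  using (_≡_; _≢_; refl; sym; trans; cong; subst; subst₂)
open import Relation.Nullary using (Dec; yes; no; ¬_)

open +-*-Solver using (solve; _:=_; _:+_; _:*_; :-_; con)

fraction-≤ : ∀ i j a b → i ℤ.* + suc b ℤ.≤ j ℤ.* + suc a →
             i / suc a ℚ.≤ j / suc b
fraction-≤ i j a b h = ℚ.toℚᵘ-cancel-≤
  (ℚᵘ.≤-respˡ-≃ (ℚᵘ.≃-sym (ℚ.toℚᵘ-fromℚᵘ (mkℚᵘ i a)))
  (ℚᵘ.≤-respʳ-≃ (ℚᵘ.≃-sym (ℚ.toℚᵘ-fromℚᵘ (mkℚᵘ j b))) (ℚᵘ.*≤* h)))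

fraction-≤ℕ : ∀ i j a b → i ℕ.* suc b ℕ.≤ j ℕ.* suc a →
              + i / suc a ℚ.≤ + j / suc b
fraction-≤ℕ i j a b h = fraction-≤ (+ i) (+ j) a b
  (subst₂ ℤ._≤_ (ℤ.pos-* i (suc b)) (ℤ.pos-* j (suc a)) (ℤ.+≤+ h))

fraction-+ : ∀ i j a → + (i ℕ.+ j) / suc a ≡ + i / suc a ℚ.+ + j / suc a
fraction-+ i j a = ℚ.toℚᵘ-injective (begin
  ℚ.toℚᵘ (+ (i ℕ.+ j) / suc a)
    ≈⟨ ℚ.toℚᵘ-fromℚᵘ (mkℚᵘ (+ (i ℕ.+ j)) a) ⟩
  mkℚᵘ (+ (i ℕ.+ j)) a
    ≈⟨ ℚᵘ.*≡* eq ⟩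
  mkℚᵘ (+ i) a ℚᵘ.+ mkℚᵘ (+ j) a
    ≈⟨ ℚᵘ.+-cong (ℚᵘ.≃-sym (ℚ.toℚᵘ-fromℚᵘ (mkℚᵘ (+ i) a)))
                 (ℚᵘ.≃-sym (ℚ.toℚᵘ-fromℚᵘ (mkℚᵘ (+ j) a))) ⟩
  ℚ.toℚᵘ (+ i / suc a) ℚᵘ.+ ℚ.toℚᵘ (+ j / suc a)
    ≈⟨ ℚᵘ.≃-sym (ℚ.toℚᵘ-homo-+ (+ i / suc a) (+ j / suc a)) ⟩
  ℚ.toℚᵘ (+ i / suc a ℚ.+ + j / suc a) ∎)
  where
  open ℚᵘ.≃-Reasoning
  D : ℤ.ℤ
  D = + suc a
  eq : + (i ℕ.+ j) ℤ.* + (suc a ℕ.* suc a)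
       ≡ (+ i ℤ.* D ℤ.+ + j ℤ.* D) ℤ.* D
  eq = trans (cong (+ (i ℕ.+ j) ℤ.*_) (ℤ.pos-* (suc a) (suc a)))
       (trans (sym (ℤ.*-assoc (+ (i ℕ.+ j)) D D))
       (cong (ℤ._* D) (trans (cong (ℤ._* D) (ℤ.pos-+ i j))
                             (ℤ.*-distribʳ-+ D (+ i) (+ j)))))

0<1/suc : ∀ k → 0ℚ ℚ.< + 1 / suc k
0<1/suc k = ℚ.positive⁻¹ (+ 1 / suc k) {{ℚ.normalize-pos 1 (suc k)}}

0≤fraction : ∀ j k → 0ℚ ℚ.≤ + j / suc k
0≤fraction j k = ℚ.nonNegative⁻¹ (+ j / suc k) {{ℚ.normalize-nonNeg j (suc k)}}

numerator-≤ : ∀ q → q ℚ.≤ + ℤ.∣ ℚ.↥ q ∣ / 1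
numerator-≤ q = subst (ℚ._≤ + ℤ.∣ ℚ.↥ q ∣ / 1) (ℚ.↥p/↧p≡p q) (aux q)
  where
  aux : ∀ q → ℚ.↥ q / ℚ.↧ₙ q ℚ.≤ + ℤ.∣ ℚ.↥ q ∣ / 1
  aux (mkℚ (+ n) d c) = fraction-≤ℕ n n d 0 (ℕ.*-monoʳ-≤ n (ℕ.s≤s ℕ.z≤n))
  aux (mkℚ -[1+ n ] d c) =
    fraction-≤ -[1+ n ] (+ suc n) d 0 (ℤ.≤-trans ℤ.-≤+ (ℤ.+≤+ ℕ.z≤n))

archimedean : ∀ ε → 0ℚ ℚ.< ε → ∃ λ N → ∀ m → N ℕ.≤ m → + 1 / suc m ℚ.< ε
archimedean ε@(mkℚ (+ 0) d c) 0<ε =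
  ⊥-elim (ℚ.<-irrefl (sym (ℚ.↥p≡0⇒p≡0 ε refl)) 0<ε)
archimedean ε@(mkℚ -[1+ n ] d c) 0<ε =
  ⊥-elim (ℚ.<-asym 0<ε (ℚ.negative⁻¹ ε))
archimedean ε@(mkℚ (+ suc p) d c) 0<ε = suc d , λ m N≤m →
  ℚ.<-≤-trans (step m N≤m)
    (subst (+ 1 / suc d ℚ.≤_) (ℚ.↥p/↧p≡p ε)
      (fraction-≤ℕ 1 (suc p) d d (ℕ.*-monoˡ-≤ (suc d) (ℕ.s≤s (ℕ.z≤n {p})))))
  where
  step : ∀ m → suc d ℕ.≤ m → + 1 / suc m ℚ.< + 1 / suc d
  step m h = ℚ.toℚᵘ-cancel-<
    (ℚᵘ.<-respˡ-≃ (ℚᵘ.≃-sym (ℚ.toℚᵘ-fromℚᵘ (mkℚᵘ (+ 1) m)))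
    (ℚᵘ.<-respʳ-≃ (ℚᵘ.≃-sym (ℚ.toℚᵘ-fromℚᵘ (mkℚᵘ (+ 1) d)))
      (ℚᵘ.*<* (subst₂ ℤ._<_ (ℤ.pos-* 1 (suc d)) (ℤ.pos-* 1 (suc m))
        (ℤ.+<+ (ℕ.*-monoʳ-< 1 (ℕ.s≤s h)))))))

0<* : ∀ {p q} → 0ℚ ℚ.< p → 0ℚ ℚ.< q → 0ℚ ℚ.< p ℚ.* q
0<* {p} {q} 0<p 0<q = ℚ.positive⁻¹ (p ℚ.* q)
  {{ℚ.pos*pos⇒pos p {{positive 0<p}} q {{positive 0<q}}}}

0≤* : ∀ {p q} → 0ℚ ℚ.≤ p → 0ℚ ℚ.≤ q → 0ℚ ℚ.≤ p ℚ.* q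
0≤* {p} {q} 0≤p 0≤q = ℚ.nonNegative⁻¹ (p ℚ.* q)
  {{ℚ.nonNeg*nonNeg⇒nonNeg p {{nonNegative 0≤p}} q {{nonNegative 0≤q}}}}

*-mono : ∀ {p q r s} → 0ℚ ℚ.≤ p → 0ℚ ℚ.≤ s → p ℚ.≤ q → r ℚ.≤ s →
         p ℚ.* r ℚ.≤ q ℚ.* s
*-mono {p} {q} {r} {s} 0≤p 0≤s p≤q r≤s = ℚ.≤-trans
  (ℚ.*-monoˡ-≤-nonNeg p {{nonNegative 0≤p}} r≤s)
  (ℚ.*-monoʳ-≤-nonNeg s {{nonNegative 0≤s}} p≤q)

0<½* : ∀ {ε} → 0ℚ ℚ.< ε → 0ℚ ℚ.< ½ ℚ.* ε
0<½* = 0<* (0<1/suc 1)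

½+½ : ∀ ε → ½ ℚ.* ε ℚ.+ ½ ℚ.* ε ≡ ε
½+½ = solve 1 (λ e → con ½ :* e :+ con ½ :* e := e) refl

∣-∣-sym : ∀ p q → ℚ.∣ p ℚ.- q ∣ ≡ ℚ.∣ q ℚ.- p ∣
∣-∣-sym p q = trans (sym (ℚ.∣-p∣≡∣p∣ (p ℚ.- q)))
  (cong ℚ.∣_∣ (solve 2 (λ a b → :- (a :+ :- b) := b :+ :- a) refl p q))

p≤∣p∣ : ∀ p → p ℚ.≤ ℚ.∣ p ∣
p≤∣p∣ p with ℚ.≤-total 0ℚ p
... | inj₁ 0≤p = ℚ.≤-reflexive (sym (ℚ.0≤p⇒∣p∣≡p 0≤p))
... | inj₂ p≤0 = ℚ.≤-trans p≤0 (ℚ.0≤∣p∣ p)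

∣∣-< : ∀ {p e} → p ℚ.< e → ℚ.- p ℚ.< e → ℚ.∣ p ∣ ℚ.< e
∣∣-< {p} {e} h₁ h₂ with ℚ.∣p∣≡p∨∣p∣≡-p p
... | inj₁ eq = subst (ℚ._< e) (sym eq) h₁
... | inj₂ eq = subst (ℚ._< e) (sym eq) h₂

∣∣-≤ : ∀ {p e} → p ℚ.≤ e → ℚ.- p ℚ.≤ e → ℚ.∣ p ∣ ℚ.≤ e
∣∣-≤ {p} {e} h₁ h₂ with ℚ.∣p∣≡p∨∣p∣≡-p p
... | inj₁ eq = subst (ℚ._≤ e) (sym eq) h₁
... | inj₂ eq = subst (ℚ._≤ e) (sym eq) h₂

∣∣-shift : ∀ a b → ℚ.∣ a ∣ ℚ.≤ ℚ.∣ b ∣ ℚ.+ ℚ.∣ a ℚ.- b ∣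
∣∣-shift a b = subst (ℚ._≤ ℚ.∣ b ∣ ℚ.+ ℚ.∣ a ℚ.- b ∣)
  (cong ℚ.∣_∣ (solve 2 (λ a b → b :+ (a :+ :- b) := a) refl a b))
  (ℚ.∣p+q∣≤∣p∣+∣q∣ b (a ℚ.- b))

p≤q+r⇒p-q≤r : ∀ {p q r} → p ℚ.≤ q ℚ.+ r → p ℚ.- q ℚ.≤ r
p≤q+r⇒p-q≤r {p} {q} {r} h = subst (p ℚ.- q ℚ.≤_)
  (solve 2 (λ q r → (q :+ r) :+ :- q := r) refl q r)
  (ℚ.+-monoˡ-≤ (ℚ.- q) h)

reverse-triangle : ∀ a b → ℚ.∣ ℚ.∣ a ∣ ℚ.- ℚ.∣ b ∣ ∣ ℚ.≤ ℚ.∣ a ℚ.- b ∣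
reverse-triangle a b = ∣∣-≤ (p≤q+r⇒p-q≤r (∣∣-shift a b))
  (subst₂ ℚ._≤_
    (solve 2 (λ x y → y :+ :- x := :- (x :+ :- y)) refl ℚ.∣ a ∣ ℚ.∣ b ∣)
    (∣-∣-sym b a)
    (p≤q+r⇒p-q≤r (∣∣-shift b a)))

Cauchy : (ℕ → ℚ) → Set
Cauchy s = ∀ ε → 0ℚ ℚ.< ε →
  ∃ λ N → ∀ m n → N ℕ.≤ m → N ℕ.≤ n → ℚ.∣ s m ℚ.- s n ∣ ℚ.< ε

record ℝ : Set where
  constructor mkℝ
  field
    seq    : ℕ → ℚ
    cauchy : Cauchy seq
open ℝ public

infix 4 _≤_ _<_ _≥_ _>_

_≤_ _<_ _≥_ _>_ : ℝ → ℝ → Set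
x ≤ y = ∀ ε → 0ℚ ℚ.< ε →
  ∃ λ N → ∀ n → N ℕ.≤ n → seq x n ℚ.≤ seq y n ℚ.+ ε
x < y = ∃ λ δ → 0ℚ ℚ.< δ ×
  ∃ λ N → ∀ n → N ℕ.≤ n → seq x n ℚ.+ δ ℚ.≤ seq y n
x ≥ y = y ≤ x
x > y = y < x

fromℚ : ℚ → ℝ
fromℚ q = mkℝ (λ _ → q) λ ε 0<ε → 0 , λ _ _ _ _ →
  subst (ℚ._< ε) (cong ℚ.∣_∣ (sym (ℚ.+-inverseʳ q))) 0<ε

fromℕ : ℕ → ℝ
fromℕ n = fromℚ (+ n / 1)

0ℝ 1ℝ ½ℝ : ℝ
0ℝ = fromℚ 0ℚ
1ℝ = fromℚ 1ℚ
½ℝ = fromℚ ½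

infix  8 -_
infixl 7 _*_
infixl 6 _+_ _-_

_+_ : ℝ → ℝ → ℝ
x + y = mkℝ (λ n → seq x n ℚ.+ seq y n) cauchy-+
  where
  cauchy-+ : Cauchy (λ n → seq x n ℚ.+ seq y n)
  cauchy-+ ε 0<ε with cauchy x (½ ℚ.* ε) (0<½* 0<ε) | cauchy y (½ ℚ.* ε) (0<½* 0<ε)
  ... | M , hx | N , hy = M ℕ.⊔ N , λ m n hm hn →
    let a = seq x m ; b = seq y m ; c = seq x n ; d = seq y n in
    ℚ.≤-<-trans
      (subst (ℚ._≤ ℚ.∣ a ℚ.- c ∣ ℚ.+ ℚ.∣ b ℚ.- d ∣)
        (cong ℚ.∣_∣ (solve 4 (λ a b c d →
          (a :+ :- c) :+ (b :+ :- d) := (a :+ b) :+ :- (c :+ d)) refl a b c d))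
        (ℚ.∣p+q∣≤∣p∣+∣q∣ (a ℚ.- c) (b ℚ.- d)))
      (subst (ℚ.∣ a ℚ.- c ∣ ℚ.+ ℚ.∣ b ℚ.- d ∣ ℚ.<_) (½+½ ε)
        (ℚ.+-mono-< (hx m n (ℕ.m⊔n≤o⇒m≤o M N hm) (ℕ.m⊔n≤o⇒m≤o M N hn))
                    (hy m n (ℕ.m⊔n≤o⇒n≤o M N hm) (ℕ.m⊔n≤o⇒n≤o M N hn))))

-_ : ℝ → ℝ
- x = mkℝ (λ n → ℚ.- seq x n) λ ε 0<ε → let (N , h) = cauchy x ε 0<ε in
  N , λ m n hm hn → subst (ℚ._< ε)
    (trans (sym (ℚ.∣-p∣≡∣p∣ (seq x m ℚ.- seq x n)))
      (cong ℚ.∣_∣ (solve 2 (λ a b → :- (a :+ :- b) := :- a :+ :- (:- b)) refl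
        (seq x m) (seq x n))))
    (h m n hm hn)

_-_ : ℝ → ℝ → ℝ
x - y = x + (- y)

∣_∣ : ℝ → ℝ
∣ x ∣ = mkℝ (λ n → ℚ.∣ seq x n ∣) λ ε 0<ε → let (N , h) = cauchy x ε 0<ε in
  N , λ m n hm hn →
    ℚ.≤-<-trans (reverse-triangle (seq x m) (seq x n)) (h m n hm hn)

eventually-bounded : ∀ {s} → Cauchy s →
  ∃ λ K → 0ℚ ℚ.< K × ∃ λ N → ∀ n → N ℕ.≤ n → ℚ.∣ s n ∣ ℚ.≤ K
eventually-bounded {s} cs with cs 1ℚ (0<1/suc 0)
... | N , h = ℚ.∣ s N ∣ ℚ.+ 1ℚ
  , ℚ.+-mono-≤-< (ℚ.0≤∣p∣ (s N)) (0<1/suc 0)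
  , N
  , λ n hn → ℚ.≤-trans (∣∣-shift (s n) (s N))
      (ℚ.+-monoʳ-≤ ℚ.∣ s N ∣ (ℚ.<⇒≤ (h n N hn ℕ.≤-refl)))

product-diff : ∀ a b c d {K L δ} → 0ℚ ℚ.< K → 0ℚ ℚ.< L →
  ℚ.∣ a ∣ ℚ.≤ K → ℚ.∣ d ∣ ℚ.≤ L → ℚ.∣ a ℚ.- c ∣ ℚ.< δ → ℚ.∣ b ℚ.- d ∣ ℚ.< δ →
  ℚ.∣ a ℚ.* b ℚ.- c ℚ.* d ∣ ℚ.< K ℚ.* δ ℚ.+ L ℚ.* δ
product-diff a b c d {K} {L} {δ} 0<K 0<L a≤K d≤L ac bd = ℚ.≤-<-trans
  (subst (ℚ._≤ ℚ.∣ a ℚ.* (b ℚ.- d) ∣ ℚ.+ ℚ.∣ d ℚ.* (a ℚ.- c) ∣)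
    (cong ℚ.∣_∣ (solve 4 (λ a b c d →
      a :* (b :+ :- d) :+ d :* (a :+ :- c) := a :* b :+ :- (c :* d))
      refl a b c d))
    (ℚ.∣p+q∣≤∣p∣+∣q∣ (a ℚ.* (b ℚ.- d)) (d ℚ.* (a ℚ.- c))))
  (ℚ.+-mono-< (part a (b ℚ.- d) 0<K a≤K bd) (part d (a ℚ.- c) 0<L d≤L ac))
  where
  part : ∀ p q {B} → 0ℚ ℚ.< B → ℚ.∣ p ∣ ℚ.≤ B → ℚ.∣ q ∣ ℚ.< δ →
         ℚ.∣ p ℚ.* q ∣ ℚ.< B ℚ.* δ
  part p q {B} 0<B hp hq = subst (ℚ._< B ℚ.* δ) (sym (ℚ.∣p*q∣≡∣p∣*∣q∣ p q))
    (ℚ.≤-<-trans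
      (ℚ.*-monoʳ-≤-nonNeg ℚ.∣ q ∣ {{ℚ.∣-∣-nonNeg q}} hp)
      (ℚ.*-monoʳ-<-pos B {{positive 0<B}} hq))

split : ∀ K L ε → 0ℚ ℚ.< K → 0ℚ ℚ.< L → 0ℚ ℚ.< ε →
  ∃ λ δ → 0ℚ ℚ.< δ × K ℚ.* δ ℚ.+ L ℚ.* δ ≡ ε
split K L ε 0<K 0<L 0<ε = ε ℚ.* i , 0<* 0<ε 0<i , eq
  where
  pos : ℚ.Positive (K ℚ.+ L)
  pos = positive (ℚ.+-mono-< 0<K 0<L)
  nz : ℚ.NonZero (K ℚ.+ L)
  nz = ℚ.pos⇒nonZero (K ℚ.+ L) {{pos}}
  i : ℚ
  i = (ℚ.1/ (K ℚ.+ L)) {{nz}}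
  0<i : 0ℚ ℚ.< i
  0<i = ℚ.positive⁻¹ i {{ℚ.1/pos⇒pos (K ℚ.+ L) {{pos}}}}
  rearrange : ∀ K L ε i →
    K ℚ.* (ε ℚ.* i) ℚ.+ L ℚ.* (ε ℚ.* i) ≡ ε ℚ.* (i ℚ.* (K ℚ.+ L))
  rearrange = solve 4 (λ k l e i →
    k :* (e :* i) :+ l :* (e :* i) := e :* (i :* (k :+ l))) refl
  eq : K ℚ.* (ε ℚ.* i) ℚ.+ L ℚ.* (ε ℚ.* i) ≡ ε
  eq = trans (rearrange K L ε i)
    (trans (cong (ε ℚ.*_) (ℚ.*-inverseˡ (K ℚ.+ L) {{nz}})) (ℚ.*-identityʳ ε))

cauchy-* : ∀ {s t} → Cauchy s → Cauchy t → Cauchy (λ n → s n ℚ.* t n)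
cauchy-* {s} {t} cs ct ε 0<ε = combine (eventually-bounded {s} cs) (eventually-bounded {t} ct)
  where
  Goal : Set
  Goal = ∃ λ N → ∀ m n → N ℕ.≤ m → N ℕ.≤ n →
    ℚ.∣ s m ℚ.* t m ℚ.- s n ℚ.* t n ∣ ℚ.< ε
  combine : (∃ λ K → 0ℚ ℚ.< K × ∃ λ N → ∀ n → N ℕ.≤ n → ℚ.∣ s n ∣ ℚ.≤ K) →
            (∃ λ L → 0ℚ ℚ.< L × ∃ λ N → ∀ n → N ℕ.≤ n → ℚ.∣ t n ∣ ℚ.≤ L) → Goal
  combine (K , 0<K , M₁ , bs) (L , 0<L , M₂ , bt) = finish (split K L ε 0<K 0<L 0<ε)
    where
    finish : (∃ λ δ → 0ℚ ℚ.< δ × K ℚ.* δ ℚ.+ L ℚ.* δ ≡ ε) → Goal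
    finish (δ , 0<δ , eq) = close (cs δ 0<δ) (ct δ 0<δ)
      where
      close : (∃ λ N → ∀ m n → N ℕ.≤ m → N ℕ.≤ n → ℚ.∣ s m ℚ.- s n ∣ ℚ.< δ) →
              (∃ λ N → ∀ m n → N ℕ.≤ m → N ℕ.≤ n → ℚ.∣ t m ℚ.- t n ∣ ℚ.< δ) → Goal
      close (M₃ , hs) (M₄ , ht) = (M₁ ℕ.⊔ M₂) ℕ.⊔ (M₃ ℕ.⊔ M₄) , λ m n hm hn →
        subst (ℚ.∣ s m ℚ.* t m ℚ.- s n ℚ.* t n ∣ ℚ.<_) eq
          (product-diff (s m) (t m) (s n) (t n) 0<K 0<L
            (bs m (ℕ.m⊔n≤o⇒m≤o M₁ M₂ (left hm)))
            (bt n (ℕ.m⊔n≤o⇒n≤o M₁ M₂ (left hn)))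
            (hs m n (ℕ.m⊔n≤o⇒m≤o M₃ M₄ (right hm)) (ℕ.m⊔n≤o⇒m≤o M₃ M₄ (right hn)))
            (ht m n (ℕ.m⊔n≤o⇒n≤o M₃ M₄ (right hm)) (ℕ.m⊔n≤o⇒n≤o M₃ M₄ (right hn))))
        where
        left : ∀ {k} → (M₁ ℕ.⊔ M₂) ℕ.⊔ (M₃ ℕ.⊔ M₄) ℕ.≤ k → M₁ ℕ.⊔ M₂ ℕ.≤ k
        left = ℕ.m⊔n≤o⇒m≤o (M₁ ℕ.⊔ M₂) (M₃ ℕ.⊔ M₄)
        right : ∀ {k} → (M₁ ℕ.⊔ M₂) ℕ.⊔ (M₃ ℕ.⊔ M₄) ℕ.≤ k → M₃ ℕ.⊔ M₄ ℕ.≤ k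
        right = ℕ.m⊔n≤o⇒n≤o (M₁ ℕ.⊔ M₂) (M₃ ℕ.⊔ M₄)

_*_ : ℝ → ℝ → ℝ
x * y = mkℝ (λ n → seq x n ℚ.* seq y n) (cauchy-* {seq x} {seq y} (cauchy x) (cauchy y))

min : ℝ → ℝ → ℝ
min x y = ½ℝ * ((x + y) - ∣ x - y ∣)

largest : {P : ℕ → Set} → (∀ j → Dec (P j)) → ℕ → ℕ
largest P? zero = 0
largest P? (suc J) with P? (suc J)
... | yes _ = suc J
... | no  _ = largest P? J

largest-lower : ∀ {P : ℕ → Set} (P? : ∀ j → Dec (P j)) J →
  largest P? J ≡ 0 ⊎ P (largest P? J)
largest-lower P? zero = inj₁ refl
largest-lower P? (suc J) with P? (suc J)
... | yes h = inj₂ h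
... | no  _ = largest-lower P? J

largest-upper : ∀ {P : ℕ → Set} (P? : ∀ j → Dec (P j)) J →
  ¬ P (suc J) → ¬ P (suc (largest P? J))
largest-upper P? zero h = h
largest-upper P? (suc J) h with P? (suc J)
... | yes _  = h
... | no  ¬p = largest-upper P? J ¬p

rootBound : ℕ → ℚ → ℕ
rootBound k q = suc ℤ.∣ ℚ.↥ q ∣ ℕ.* suc k

Root≤ : ℕ → ℚ → ℕ → Set
Root≤ k q j = (+ j / suc k) ℚ.* (+ j / suc k) ℚ.≤ q

root≤? : ∀ k q j → Dec (Root≤ k q j)
root≤? k q j = (+ j / suc k) ℚ.* (+ j / suc k) ℚ.≤? q

maxRoot : ℕ → ℚ → ℕ
maxRoot k q = largest (root≤? k q) (rootBound k q)

-- The square root of max(q, 0) rounded down to a multiple of 1 / (k + 1).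
sqrtℚ : ℕ → ℚ → ℚ
sqrtℚ k q = + maxRoot k q / suc k

rootBound-correct : ∀ k q → let u = + suc (rootBound k q) / suc k in q ℚ.< u ℚ.* u
rootBound-correct k q = ℚ.≤-<-trans (numerator-≤ q)
  (ℚ.<-≤-trans c<1+c (ℚ.≤-trans 1+c≤u u≤u²))
  where
  c : ℕ
  c = ℤ.∣ ℚ.↥ q ∣
  u : ℚ
  u = + suc (rootBound k q) / suc k
  1+c≤u : + suc c / 1 ℚ.≤ u
  1+c≤u = fraction-≤ℕ (suc c) (suc (rootBound k q)) 0 k
    (ℕ.≤-trans (ℕ.n≤1+n (rootBound k q))
      (ℕ.≤-reflexive (sym (ℕ.*-identityʳ (suc (rootBound k q))))))
  c<1+c : + c / 1 ℚ.< + suc c / 1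
  c<1+c = subst₂ ℚ._<_ (ℚ.+-identityˡ (+ c / 1)) (sym (fraction-+ 1 c 0))
    (ℚ.+-monoˡ-< (+ c / 1) (0<1/suc 0))
  1≤u : 1ℚ ℚ.≤ u
  1≤u = ℚ.≤-trans (fraction-≤ℕ 1 (suc c) 0 0 (ℕ.s≤s ℕ.z≤n)) 1+c≤u
  0≤u : 0ℚ ℚ.≤ u
  0≤u = ℚ.≤-trans (ℚ.<⇒≤ (0<1/suc 0)) 1≤u
  u≤u² : u ℚ.≤ u ℚ.* u
  u≤u² = subst (ℚ._≤ u ℚ.* u) (ℚ.*-identityʳ u)
    (ℚ.*-monoˡ-≤-nonNeg u {{nonNegative 0≤u}} 1≤u)

Root≤-maxRoot : ∀ k q → maxRoot k q ≡ 0 ⊎ Root≤ k q (maxRoot k q)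
Root≤-maxRoot k q = largest-lower (root≤? k q) (rootBound k q)

rootBound-¬Root≤ : ∀ k q → ¬ Root≤ k q (suc (rootBound k q))
rootBound-¬Root≤ k q h = ℚ.<-irrefl refl (ℚ.<-≤-trans (rootBound-correct k q) h)

¬Root≤-maxRoot : ∀ k q → ¬ Root≤ k q (suc (maxRoot k q))
¬Root≤-maxRoot k q =
  largest-upper (root≤? k q) (rootBound k q) (rootBound-¬Root≤ k q)

sqrt-gap : ∀ ε s t w p q → 0ℚ ℚ.< ε → 0ℚ ℚ.≤ t → 0ℚ ℚ.≤ w → w ℚ.≤ ½ ℚ.* ε →
  s ≡ 0ℚ ⊎ s ℚ.* s ℚ.≤ p →
  q ℚ.< (w ℚ.+ t) ℚ.* (w ℚ.+ t) →
  ℚ.∣ p ℚ.- q ∣ ℚ.< (½ ℚ.* ε) ℚ.* (½ ℚ.* ε) →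
  s ℚ.- t ℚ.< ε
sqrt-gap ε s t w p q 0<ε 0≤t 0≤w w≤½ε lower upper close = ℚ.≰⇒> refute
  where
  core : ∀ h → 0ℚ ℚ.< h → w ℚ.≤ h → h ℚ.+ h ℚ.≤ s ℚ.- t →
    ℚ.∣ p ℚ.- q ∣ ℚ.< h ℚ.* h → ⊥
  core h 0<h w≤h gap pq = absurd lower
    where
    u : ℚ
    u = h ℚ.+ t
    0<u : 0ℚ ℚ.< u
    0<u = ℚ.+-mono-<-≤ 0<h 0≤t
    0<u+h : 0ℚ ℚ.< u ℚ.+ h
    0<u+h = ℚ.+-mono-< 0<u 0<h
    u+h≤s : u ℚ.+ h ℚ.≤ s
    u+h≤s = subst₂ ℚ._≤_
      (solve 2 (λ t h → t :+ (h :+ h) := (h :+ t) :+ h) refl t h)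
      (solve 2 (λ s t → t :+ (s :+ :- t) := s) refl s t)
      (ℚ.+-monoʳ-≤ t gap)
    0<s : 0ℚ ℚ.< s
    0<s = ℚ.<-≤-trans 0<u+h u+h≤s
    w+t≤u : w ℚ.+ t ℚ.≤ u
    w+t≤u = ℚ.+-monoˡ-≤ t w≤h
    q<u² : q ℚ.< u ℚ.* u
    q<u² = ℚ.<-≤-trans upper
      (*-mono (ℚ.+-mono-≤ 0≤w 0≤t) (ℚ.<⇒≤ 0<u) w+t≤u w+t≤u)
    cross : ℚ
    cross = u ℚ.* h ℚ.+ u ℚ.* h
    0≤cross : 0ℚ ℚ.≤ cross
    0≤cross = ℚ.<⇒≤ (ℚ.+-mono-< (0<* 0<u 0<h) (0<* 0<u 0<h))
    square : ∀ u h → (u ℚ.* u ℚ.+ h ℚ.* h) ℚ.+ (u ℚ.* h ℚ.+ u ℚ.* h)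
                     ≡ (u ℚ.+ h) ℚ.* (u ℚ.+ h)
    square = solve 2 (λ u h → (u :* u :+ h :* h) :+ (u :* h :+ u :* h)
                              := (u :+ h) :* (u :+ h)) refl
    u²+h²≤s² : u ℚ.* u ℚ.+ h ℚ.* h ℚ.≤ s ℚ.* s
    u²+h²≤s² = ℚ.≤-trans
      (subst₂ ℚ._≤_ (ℚ.+-identityʳ (u ℚ.* u ℚ.+ h ℚ.* h)) (square u h)
        (ℚ.+-monoʳ-≤ (u ℚ.* u ℚ.+ h ℚ.* h) 0≤cross))
      (*-mono (ℚ.<⇒≤ 0<u+h) (ℚ.<⇒≤ 0<s) u+h≤s u+h≤s)
    p<q+h² : p ℚ.< q ℚ.+ h ℚ.* h
    p<q+h² = subst (ℚ._< q ℚ.+ h ℚ.* h)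
      (solve 2 (λ a b → b :+ (a :+ :- b) := a) refl p q)
      (ℚ.+-monoʳ-< q (ℚ.≤-<-trans (p≤∣p∣ (p ℚ.- q)) pq))
    absurd : s ≡ 0ℚ ⊎ s ℚ.* s ℚ.≤ p → ⊥
    absurd (inj₁ s≡0) = ℚ.<-irrefl (sym s≡0) 0<s
    absurd (inj₂ s²≤p) = ℚ.<-irrefl refl
      (ℚ.<-≤-trans
        (ℚ.<-trans p<q+h² (ℚ.+-monoˡ-< (h ℚ.* h) q<u²))
        (ℚ.≤-trans u²+h²≤s² s²≤p))
  refute : ¬ (ε ℚ.≤ s ℚ.- t)
  refute ε≤ = core (½ ℚ.* ε) (0<½* 0<ε) w≤½ε
    (subst (ℚ._≤ s ℚ.- t) (sym (½+½ ε)) ε≤) close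

grid-zero : ∀ m {i} → i ≡ 0 → + i / suc m ≡ 0ℚ
grid-zero m refl = ℚ.0/n≡0 (suc m)

grid-upper : ∀ n q j → ¬ Root≤ n q (suc j) →
  q ℚ.< (+ 1 / suc n ℚ.+ + j / suc n) ℚ.* (+ 1 / suc n ℚ.+ + j / suc n)
grid-upper n q j h =
  subst (λ u → q ℚ.< u ℚ.* u) (fraction-+ 1 j n) (ℚ.≰⇒> h)

grid-gap : ∀ ε m n i j p q → 0ℚ ℚ.< ε → + 1 / suc n ℚ.≤ ½ ℚ.* ε →
  i ≡ 0 ⊎ Root≤ m p i → ¬ Root≤ n q (suc j) →
  ℚ.∣ p ℚ.- q ∣ ℚ.< (½ ℚ.* ε) ℚ.* (½ ℚ.* ε) →
  + i / suc m ℚ.- + j / suc n ℚ.< ε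
grid-gap ε m n i j p q 0<ε small lower upper close =
  sqrt-gap ε (+ i / suc m) (+ j / suc n) (+ 1 / suc n) p q 0<ε
    (0≤fraction j n) (ℚ.<⇒≤ (0<1/suc n)) small
    (Sum.map₁ (grid-zero m) lower) (grid-upper n q j upper) close

grid-close : ∀ ε m n i j p q → 0ℚ ℚ.< ε →
  + 1 / suc m ℚ.≤ ½ ℚ.* ε → + 1 / suc n ℚ.≤ ½ ℚ.* ε →
  i ≡ 0 ⊎ Root≤ m p i → ¬ Root≤ m p (suc i) →
  j ≡ 0 ⊎ Root≤ n q j → ¬ Root≤ n q (suc j) →
  ℚ.∣ p ℚ.- q ∣ ℚ.< (½ ℚ.* ε) ℚ.* (½ ℚ.* ε) →
  ℚ.∣ + i / suc m ℚ.- + j / suc n ∣ ℚ.< ε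
grid-close ε m n i j p q 0<ε small-m small-n li ui lj uj close = ∣∣-<
  (grid-gap ε m n i j p q 0<ε small-n li uj close)
  (subst (ℚ._< ε) (flip (+ i / suc m) (+ j / suc n))
    (grid-gap ε n m j i q p 0<ε small-m lj ui
      (subst (ℚ._< (½ ℚ.* ε) ℚ.* (½ ℚ.* ε)) (∣-∣-sym p q) close)))
  where
  flip : ∀ a b → b ℚ.- a ≡ ℚ.- (a ℚ.- b)
  flip = solve 2 (λ a b → b :+ :- a := :- (a :+ :- b)) refl

cauchy-√ : ∀ {s} → Cauchy s → Cauchy (λ k → sqrtℚ k (s k))
cauchy-√ {s} cs ε 0<ε =
  combine (archimedean (½ ℚ.* ε) (0<½* 0<ε)) (cs η (0<* (0<½* 0<ε) (0<½* 0<ε)))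
  where
  η : ℚ
  η = (½ ℚ.* ε) ℚ.* (½ ℚ.* ε)
  combine : (∃ λ N → ∀ m → N ℕ.≤ m → + 1 / suc m ℚ.< ½ ℚ.* ε) →
            (∃ λ N → ∀ m n → N ℕ.≤ m → N ℕ.≤ n → ℚ.∣ s m ℚ.- s n ∣ ℚ.< η) →
            ∃ λ N → ∀ m n → N ℕ.≤ m → N ℕ.≤ n →
              ℚ.∣ sqrtℚ m (s m) ℚ.- sqrtℚ n (s n) ∣ ℚ.< ε
  combine (M₁ , small) (M₂ , close) = M₁ ℕ.⊔ M₂ , λ m n hm hn →
    grid-close ε m n (maxRoot m (s m)) (maxRoot n (s n)) (s m) (s n) 0<ε
      (ℚ.<⇒≤ (small m (ℕ.m⊔n≤o⇒m≤o M₁ M₂ hm)))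
      (ℚ.<⇒≤ (small n (ℕ.m⊔n≤o⇒m≤o M₁ M₂ hn)))
      (Root≤-maxRoot m (s m)) (¬Root≤-maxRoot m (s m))
      (Root≤-maxRoot n (s n)) (¬Root≤-maxRoot n (s n))
      (close m n (ℕ.m⊔n≤o⇒n≤o M₁ M₂ hm) (ℕ.m⊔n≤o⇒n≤o M₁ M₂ hn))

-- √ x = 0 for x < 0.
√ : ℝ → ℝ
√ x = mkℝ (λ k → sqrtℚ k (seq x k)) (cauchy-√ {seq x} (cauchy x))

harmonic : ℕ → ℚ
harmonic zero    = 0ℚ
harmonic (suc n) = harmonic n ℚ.+ + 1 / suc n

harmonic-lower : ∀ K M j → j ℕ.+ M ℕ.≤ suc K →
  harmonic M ℚ.+ + j / suc K ℚ.≤ harmonic (j ℕ.+ M)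
harmonic-lower K M zero h = ℚ.≤-reflexive
  (trans (cong (harmonic M ℚ.+_) (ℚ.0/n≡0 (suc K))) (ℚ.+-identityʳ (harmonic M)))
harmonic-lower K M (suc j) h = step (harmonic M) (harmonic (j ℕ.+ M))
  (+ suc j / suc K) (+ j / suc K) (+ 1 / suc K) (+ 1 / suc (j ℕ.+ M))
  (fraction-+ 1 j K) (harmonic-lower K M j (ℕ.<⇒≤ h))
  (fraction-≤ℕ 1 1 K (j ℕ.+ M) (ℕ.*-monoʳ-≤ 1 h))
  where
  step : ∀ x y r s t u → r ≡ t ℚ.+ s → x ℚ.+ s ℚ.≤ y → t ℚ.≤ u → x ℚ.+ r ℚ.≤ y ℚ.+ u
  step x y r s t u refl h₁ h₂ = subst (ℚ._≤ y ℚ.+ u)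
    (solve 3 (λ x s t → (x :+ s) :+ t := x :+ (t :+ s)) refl x s t)
    (ℚ.+-mono-≤ h₁ h₂)

harmonic-upper : ∀ K M j → K ℕ.≤ M →
  harmonic (j ℕ.+ M) ℚ.≤ harmonic M ℚ.+ + j / suc K
harmonic-upper K M zero h = ℚ.≤-reflexive
  (sym (trans (cong (harmonic M ℚ.+_) (ℚ.0/n≡0 (suc K))) (ℚ.+-identityʳ (harmonic M))))
harmonic-upper K M (suc j) h = step (harmonic M) (harmonic (j ℕ.+ M))
  (+ suc j / suc K) (+ j / suc K) (+ 1 / suc K) (+ 1 / suc (j ℕ.+ M))
  (fraction-+ 1 j K) (harmonic-upper K M j h)
  (fraction-≤ℕ 1 1 (j ℕ.+ M) K
    (ℕ.*-monoʳ-≤ 1 (ℕ.s≤s (ℕ.≤-trans h (ℕ.m≤n+m M j)))))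
  where
  step : ∀ x y r s t u → r ≡ t ℚ.+ s → y ℚ.≤ x ℚ.+ s → u ℚ.≤ t → y ℚ.+ u ℚ.≤ x ℚ.+ r
  step x y r s t u refl h₁ h₂ = subst (y ℚ.+ u ℚ.≤_)
    (solve 3 (λ x s t → (x :+ s) :+ t := x :+ (t :+ s)) refl x s t)
    (ℚ.+-mono-≤ h₁ h₂)

block-lower : ∀ N b →
  harmonic (N ℕ.* suc b) ℚ.+ + 1 / suc N ℚ.≤ harmonic (suc N ℕ.* suc b)
block-lower N b = ℚ.≤-trans
  (ℚ.+-monoʳ-≤ (harmonic (N ℕ.* suc b))
    (fraction-≤ℕ 1 (suc b) N (b ℕ.+ N ℕ.* suc b)
      (ℕ.≤-reflexive (trans (ℕ.*-identityˡ (suc N ℕ.* suc b)) (ℕ.*-comm (suc N) (suc b))))))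
  (harmonic-lower (b ℕ.+ N ℕ.* suc b) (N ℕ.* suc b) (suc b) ℕ.≤-refl)

block-upper : ∀ N b →
  harmonic (suc (suc N) ℕ.* suc b) ℚ.≤ harmonic (suc N ℕ.* suc b) ℚ.+ + 1 / suc N
block-upper N b = ℚ.≤-trans
  (harmonic-upper (b ℕ.+ N ℕ.* suc b) (suc N ℕ.* suc b) (suc b) (ℕ.n≤1+n _))
  (ℚ.+-monoʳ-≤ (harmonic (suc N ℕ.* suc b))
    (fraction-≤ℕ (suc b) 1 (b ℕ.+ N ℕ.* suc b) N
      (ℕ.≤-reflexive (trans (ℕ.*-comm (suc b) (suc N))
        (sym (ℕ.*-identityˡ (suc N ℕ.* suc b)))))))

refine-lower : ∀ a b k →
  harmonic (a ℕ.* suc b) ℚ.+ harmonic (k ℕ.+ a) ℚ.≤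
  harmonic ((k ℕ.+ a) ℕ.* suc b) ℚ.+ harmonic a
refine-lower a b zero = ℚ.≤-refl
refine-lower a b (suc k) = step
  (harmonic (a ℕ.* suc b)) (harmonic (k ℕ.+ a)) (harmonic ((k ℕ.+ a) ℕ.* suc b))
  (harmonic a) (+ 1 / suc (k ℕ.+ a)) (harmonic (suc (k ℕ.+ a) ℕ.* suc b))
  (refine-lower a b k) (block-lower (k ℕ.+ a) b)
  where
  step : ∀ p q r s t u → p ℚ.+ q ℚ.≤ r ℚ.+ s → r ℚ.+ t ℚ.≤ u →
         p ℚ.+ (q ℚ.+ t) ℚ.≤ u ℚ.+ s
  step p q r s t u h₁ h₂ = ℚ.≤-trans
    (subst₂ ℚ._≤_
      (ℚ.+-assoc p q t)
      (solve 3 (λ r s t → (r :+ s) :+ t := (r :+ t) :+ s) refl r s t)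
      (ℚ.+-monoˡ-≤ t h₁))
    (ℚ.+-monoˡ-≤ s h₂)

refine-upper : ∀ a b k →
  (harmonic (suc (k ℕ.+ a) ℕ.* suc b) ℚ.+ harmonic (suc a)) ℚ.+ + 1 / suc (k ℕ.+ a) ℚ.≤
  (harmonic (suc a ℕ.* suc b) ℚ.+ harmonic (suc (k ℕ.+ a))) ℚ.+ + 1 / suc a
refine-upper a b zero = ℚ.≤-refl
refine-upper a b (suc k) = step
  (harmonic (suc (k ℕ.+ a) ℕ.* suc b)) (harmonic (suc a)) (+ 1 / suc (k ℕ.+ a))
  (harmonic (suc a ℕ.* suc b)) (harmonic (suc (k ℕ.+ a))) (+ 1 / suc a)
  (+ 1 / suc (suc (k ℕ.+ a))) (harmonic (suc (suc (k ℕ.+ a)) ℕ.* suc b))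
  (refine-upper a b k) (block-upper (k ℕ.+ a) b)
  where
  step : ∀ p q r s t u v w → (p ℚ.+ q) ℚ.+ r ℚ.≤ (s ℚ.+ t) ℚ.+ u → w ℚ.≤ p ℚ.+ r →
         (w ℚ.+ q) ℚ.+ v ℚ.≤ (s ℚ.+ (t ℚ.+ v)) ℚ.+ u
  step p q r s t u v w h₁ h₂ = ℚ.≤-trans
    (ℚ.+-monoˡ-≤ v (ℚ.+-monoˡ-≤ q h₂))
    (subst₂ ℚ._≤_
      (solve 4 (λ p q r v → ((p :+ q) :+ r) :+ v := ((p :+ r) :+ q) :+ v) refl p q r v)
      (solve 4 (λ s t u v → ((s :+ t) :+ u) :+ v := (s :+ (t :+ v)) :+ u) refl s t u v)
      (ℚ.+-monoˡ-≤ v h₁))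

-- The Riemann sum Σ_{i=1}^{(n-1)a} (1/a) · 1/(1 + i/a) of ∫₁ⁿ dt/t with mesh 1/a.
riemann : ℕ → ℕ → ℚ
riemann n a = harmonic (n ℕ.* a) ℚ.- harmonic a

riemann-refine : ∀ n a b →
  ℚ.∣ riemann (suc n) (suc a) ℚ.- riemann (suc n) (suc a ℕ.* suc b) ∣ ℚ.≤ + 1 / suc a
riemann-refine n a b =
  subst (λ z → ℚ.∣ riemann (suc n) (suc a) ℚ.- (harmonic z ℚ.- harmonic (suc a ℕ.* suc b)) ∣
               ℚ.≤ + 1 / suc a)
    (ℕ.*-assoc (suc n) (suc a) (suc b))
    (subst (λ z → ℚ.∣ (harmonic z ℚ.- harmonic (suc a))
                      ℚ.- (harmonic (z ℕ.* suc b) ℚ.- harmonic (suc a ℕ.* suc b)) ∣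
                  ℚ.≤ + 1 / suc a)
      (cong suc (ℕ.+-comm k a))
      (combine (harmonic (suc (k ℕ.+ a))) (harmonic (suc a))
        (harmonic (suc (k ℕ.+ a) ℕ.* suc b)) (harmonic (suc a ℕ.* suc b))
        (+ 1 / suc a) (+ 1 / suc (k ℕ.+ a))
        (subst (λ z → harmonic (suc a ℕ.* suc b) ℚ.+ harmonic z ℚ.≤
                      harmonic (z ℕ.* suc b) ℚ.+ harmonic (suc a))
          (ℕ.+-suc k a) (refine-lower (suc a) b k))
        (refine-upper a b k)
        (ℚ.<⇒≤ (0<1/suc (k ℕ.+ a)))
        (ℚ.<⇒≤ (0<1/suc a))))
  where
  k : ℕ
  k = n ℕ.* suc a
  combine : ∀ x y z w v e → w ℚ.+ x ℚ.≤ z ℚ.+ y → (z ℚ.+ y) ℚ.+ e ℚ.≤ (w ℚ.+ x) ℚ.+ v →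
    0ℚ ℚ.≤ e → 0ℚ ℚ.≤ v → ℚ.∣ (x ℚ.- y) ℚ.- (z ℚ.- w) ∣ ℚ.≤ v
  combine x y z w v e lower upper 0≤e 0≤v = ∣∣-≤
    (ℚ.≤-trans
      (subst (ℚ._≤ 0ℚ)
        (solve 4 (λ x y z w → (w :+ x) :+ :- (z :+ y) := (x :+ :- y) :+ :- (z :+ :- w))
          refl x y z w)
        (p≤q+r⇒p-q≤r (subst (w ℚ.+ x ℚ.≤_) (sym (ℚ.+-identityʳ (z ℚ.+ y))) lower)))
      0≤v)
    (subst (ℚ._≤ v)
      (solve 4 (λ x y z w → (z :+ y) :+ :- (w :+ x) := :- ((x :+ :- y) :+ :- (z :+ :- w)))
        refl x y z w)
      (p≤q+r⇒p-q≤r (ℚ.≤-trans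
        (subst (ℚ._≤ (z ℚ.+ y) ℚ.+ e) (ℚ.+-identityʳ (z ℚ.+ y)) (ℚ.+-monoʳ-≤ (z ℚ.+ y) 0≤e))
        upper)))

riemann-close : ∀ n a b →
  ℚ.∣ riemann (suc n) (suc a) ℚ.- riemann (suc n) (suc b) ∣ ℚ.≤ + 1 / suc a ℚ.+ + 1 / suc b
riemann-close n a b = triangle
  (riemann (suc n) (suc a)) (riemann (suc n) (suc b))
  (riemann (suc n) (suc a ℕ.* suc b)) (+ 1 / suc a) (+ 1 / suc b)
  (riemann-refine n a b)
  (subst (λ z → ℚ.∣ riemann (suc n) (suc b) ℚ.- riemann (suc n) z ∣ ℚ.≤ + 1 / suc b)
    (ℕ.*-comm (suc b) (suc a)) (riemann-refine n b a))
  where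
  triangle : ∀ x y z v w → ℚ.∣ x ℚ.- z ∣ ℚ.≤ v → ℚ.∣ y ℚ.- z ∣ ℚ.≤ w →
    ℚ.∣ x ℚ.- y ∣ ℚ.≤ v ℚ.+ w
  triangle x y z v w h₁ h₂ = subst (λ d → ℚ.∣ d ∣ ℚ.≤ v ℚ.+ w)
    (solve 3 (λ x y z → (x :+ :- z) :+ :- (y :+ :- z) := x :+ :- y) refl x y z)
    (ℚ.≤-trans (ℚ.∣p-q∣≤∣p∣+∣q∣ (x ℚ.- z) (y ℚ.- z)) (ℚ.+-mono-≤ h₁ h₂))

cauchy-riemann : ∀ n → Cauchy (λ m → riemann (suc n) (suc m))
cauchy-riemann n ε 0<ε = finish (archimedean (½ ℚ.* ε) (0<½* 0<ε))
  where
  finish : (∃ λ N → ∀ m → N ℕ.≤ m → + 1 / suc m ℚ.< ½ ℚ.* ε) →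
    ∃ λ N → ∀ m k → N ℕ.≤ m → N ℕ.≤ k →
      ℚ.∣ riemann (suc n) (suc m) ℚ.- riemann (suc n) (suc k) ∣ ℚ.< ε
  finish (N , small) = N , λ m k hm hk → ℚ.≤-<-trans (riemann-close n m k)
    (subst (+ 1 / suc m ℚ.+ + 1 / suc k ℚ.<_) (½+½ ε)
      (ℚ.+-mono-< (small m hm) (small k hk)))

-- log n = ∫₁ⁿ dt/t
log : (n : ℕ) → .{{ℕ.NonZero n}} → ℝ
log (suc n) = mkℝ (λ m → riemann (suc n) (suc m)) (cauchy-riemann n)

-- A point of ℝ/ℤ is given by its representative in [0, 1).
record Circle : Set where
  field
    rep   : ℝ
    0≤rep : 0ℝ ≤ rep
    rep<1 : rep < 1ℝ
open Circle public

Torus : Set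
Torus = Circle × Circle

-- The minimum of ∣ x - y + k ∣ over k ∈ ℤ, which for representatives in [0, 1)
-- is attained at k = 0 or k = ±1.
circleDist : Circle → Circle → ℝ
circleDist x y = min ∣ rep x - rep y ∣ (1ℝ - ∣ rep x - rep y ∣)

torusDist : Torus → Torus → ℝ
torusDist (x₁ , x₂) (y₁ , y₂) =
  √ (circleDist x₁ y₁ * circleDist x₁ y₁ + circleDist x₂ y₂ * circleDist x₂ y₂)

Sample : ℕ → Set
Sample n = Fin n → Torus

Event : ℕ → Set₁
Event n = Sample n → Set

record Interval : Set where
  field
    lo hi : ℚ
    lo≤hi : lo ℚ.≤ hi
open Interval public

length : Interval → ℚ
length I = hi I ℚ.- lo I

_∈ᴵ_ : Circle → Interval → Set
x ∈ᴵ I = fromℚ (lo I) ≤ rep x × rep x ≤ fromℚ (hi I)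

-- Boxes in ℝ²ⁿ, with the coordinates grouped in pairs as in Sample n.
Box : ℕ → Set
Box n = Fin n → Interval × Interval

_∈ᴮ_ : ∀ {n} → Sample n → Box n → Set
ω ∈ᴮ B = ∀ i → proj₁ (ω i) ∈ᴵ proj₁ (B i) × proj₂ (ω i) ∈ᴵ proj₂ (B i)

volume : ∀ {n} → Box n → ℚ
volume B = foldr ℚ._*_ 1ℚ (λ i → length (proj₁ (B i)) ℚ.* length (proj₂ (B i)))

Covers : ∀ {n} → (ℕ → Box n) → Event n → Set
Covers B E = ∀ ω → E ω → ∃ λ k → ω ∈ᴮ B k

partialVolume : ∀ {n} → (ℕ → Box n) → ℕ → ℚ
partialVolume B zero    = 0ℚ
partialVolume B (suc N) = partialVolume B N ℚ.+ volume (B N)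

-- n independent uniform points of the torus are distributed according to
-- Lebesgue measure on [0, 1)²ⁿ, and the Lebesgue measure of a measurable set is
-- its outer measure: the infimum of the total volumes of its countable covers by
-- boxes. So Pr E ≥ p means that every such cover has total volume at least p.
ProbAtLeast : ∀ {n} → Event n → ℚ → Set
ProbAtLeast {n} E p = (B : ℕ → Box n) → Covers B E →
  ∀ v → (∀ N → partialVolume B N ℚ.≤ v) → p ℚ.≤ v

-- Pr (E n) → 1 as n → ∞; Pr (E n) ≤ 1 holds for every event.
WithHighProbability : (∀ n → Event n) → Set
WithHighProbability E = ∀ δ → 0ℚ ℚ.< δ →
  ∃ λ N → ∀ n → N ℕ.≤ n → ProbAtLeast (E n) (1ℚ ℚ.- δ)

record Graph (n : ℕ) : Set where
  field
    adj    : Fin n → Fin n → Bool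
    symm   : ∀ u v → adj u v ≡ true → adj v u ≡ true
    irrefl : ∀ v → adj v v ≡ false

  Adj : Fin n → Fin n → Set
  Adj u v = adj u v ≡ true

  neighbours : Fin n → Subset n
  neighbours v = tabulate (adj v)

  degree : Fin n → ℕ
  degree v = card (neighbours v)
open Graph public using (Adj; degree)

-- d_H(v) is compared with d_G(v) for every v ∈ V(G), so H is a spanning subgraph.
record IsβSubgraph {n} (β : ℝ) (H G : Graph n) : Set where
  field
    edges   : ∀ u v → Adj H u v → Adj G u v
    degrees : ∀ v → fromℕ (degree H v) ≥ β * fromℕ (degree G v)

CyclicSuc : ∀ {n} → Fin n → Fin n → Set
CyclicSuc {n} i j = toℕ j ≡ suc (toℕ i) ⊎ (suc (toℕ i) ≡ n × toℕ j ≡ 0)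

record IsHamiltonian {n} (G : Graph n) : Set where
  field
    3≤n   : 3 ℕ.≤ n
    order : Permutation′ n
    cycle : ∀ i j → CyclicSuc i j → Adj G (order ⟨$⟩ʳ i) (order ⟨$⟩ʳ j)

-- G is the random geometric graph T₂(n, r) at the outcome ω. This is a predicate
-- on G because the comparison of reals, hence adjacency, is not decidable.
IsT₂ : ∀ {n} → ℝ → Sample n → Graph n → Set
IsT₂ r ω G = ∀ u v → Adj G u v ⇔ (u ≢ v × torusDist (ω u) (ω v) ≤ r)

AllSubgraphsHamiltonian : ∀ n → ℝ → ℝ → Event n
AllSubgraphsHamiltonian n β r ω =
  ∀ G → IsT₂ r ω G → ∀ H → IsβSubgraph β H G → IsHamiltonian H

{-# OPTIONS --safe #-}
module Submission where

-- Delete all edges of the random geometric graph inside a set S of vertices.  If S has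
-- more than half of the vertices, no Hamilton cycle is left; and if every vertex of S sees
-- noticeably more vertices outside S than inside it, a (1/2 + ε)-subgraph remains.
-- Such an S exists at a constant radius r, which is at least C (log n / n)^(1/2) for large
-- n: the Fourier transform of a disc has a negative lobe, so for r about 0.7 times the
-- period of a nearly hexagonal lattice, the complement of suitable ellipses around the
-- lattice points occupies more than half of the torus while the ball around each of its
-- points has more than half of its area in the ellipses.  This is checked by computation
-- on a 160 × 160 grid, with a margin that absorbs the position of the points within their
-- cells.  By Chebyshev's inequality the numbers of points in the cells are all close to
-- their mean, with probability at least 3/4; the exceptional outcomes are covered by boxes,
-- slightly inflated so that the cell of a real point can be found by approximation.

open import Data.Bool using (Bool; true; false; _∧_; _∨_; not; if_then_else_; T)
import Data.Bool.Properties as Bool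
open import Data.Empty using (⊥; ⊥-elim)
open import Data.Nat as ℕ using (ℕ; zero; suc; NonZero; z≤n; s≤s; _∸_; ∣_-_∣)
import Data.Nat.Properties as ℕ
open import Data.Product using (Σ; ∃; _×_; _,_; proj₁; proj₂)
open import Data.Sum as Sum using (_⊎_; inj₁; inj₂)
open import Data.Unit using (tt)
open import Relation.Binary.PropositionalEquality
open import Relation.Nullary using (Dec; yes; no; ¬_; does; contradiction)

-- Let `f` be 1 on S and -1 off S. If S is more than half and more than half of the edges at each
-- vertex of S leave S, then the quadratic form pairing `f` with its averages over balls is negative
-- at `f`. So averaging over a ball must have a negative eigenvalue; the negative lobe supplies it,
-- at the frequencies dual to the lattice. The margins are integers: 2|S| exceeds the number m =
-- 25600 of cells by at least 2, and a cell of S has at least one more surely adjacent cell off S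
-- than possibly adjacent cells in S. Cell counts within n/(8m²) of n/m preserve both and give ε =
-- 1/(4m). Refuting a limit takes only arbitrarily large n, so n = 8mh with h ≥ 32m³. Reals are
-- Cauchy sequences, so neither adjacency nor the cell of a point is decidable. For adjacency a
-- double negation is enough, as the aim is a contradiction. But a cover must name the box of each
-- outcome, so there a cell has to be found; hence the inflation. It at most doubles the volume
-- bound 1/4 of the exceptional boxes, to 1/2, still below the refuted 3/4.

module Sums where

  -- Finite sums, cyclic distance, and the combinatorial data of the construction

  open import Data.Nat
  open import Data.Nat.DivMod using (_%_; [m+n]%n≡m%n; m<n⇒m%n≡m)
  open import Data.Nat.Properties
  open import Algebra.Properties.CommutativeSemigroup +-commutativeSemigroup using (interchange)

  𝟙 : Bool → ℕ
  𝟙 true  = 1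
  𝟙 false = 0

  𝟙≤1 : ∀ b → 𝟙 b ≤ 1
  𝟙≤1 true  = ≤-refl
  𝟙≤1 false = z≤n

  𝟙-∧-not : ∀ b c → 𝟙 (b ∧ c) + 𝟙 (b ∧ not c) ≡ 𝟙 b
  𝟙-∧-not true  true  = refl
  𝟙-∧-not true  false = refl
  𝟙-∧-not false c     = refl

  Σ< : ℕ → (ℕ → ℕ) → ℕ
  Σ< zero    f = 0
  Σ< (suc n) f = f 0 + Σ< n (λ i → f (suc i))

  all< : ℕ → (ℕ → Bool) → Bool
  all< zero    p = true
  all< (suc n) p = p 0 ∧ all< n (λ i → p (suc i))

  ∧-true : ∀ {b c} → b ∧ c ≡ true → b ≡ true × c ≡ true
  ∧-true {true} {true} _ = refl , refl

  all<-sound : ∀ n p → all< n p ≡ true → ∀ i → i < n → p i ≡ true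
  all<-sound (suc n) p h zero    _         = proj₁ (∧-true h)
  all<-sound (suc n) p h (suc i) (s≤s i<n) =
    all<-sound n (λ k → p (suc k)) (proj₂ (∧-true {p 0} h)) i i<n

  Σ<-cong : ∀ n {f g} → (∀ i → i < n → f i ≡ g i) → Σ< n f ≡ Σ< n g
  Σ<-cong zero    h = refl
  Σ<-cong (suc n) h = cong₂ _+_ (h 0 z<s) (Σ<-cong n λ i i<n → h (suc i) (s≤s i<n))

  Σ<-mono : ∀ n {f g} → (∀ i → i < n → f i ≤ g i) → Σ< n f ≤ Σ< n g
  Σ<-mono zero    h = z≤n
  Σ<-mono (suc n) h = +-mono-≤ (h 0 z<s) (Σ<-mono n λ i i<n → h (suc i) (s≤s i<n))

  Σ<-+ : ∀ n f g → Σ< n (λ i → f i + g i) ≡ Σ< n f + Σ< n g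
  Σ<-+ zero    f g = refl
  Σ<-+ (suc n) f g = trans
    (cong (f 0 + g 0 +_) (Σ<-+ n (λ i → f (suc i)) (λ i → g (suc i))))
    (interchange (f 0) (g 0) _ _)

  Σ<-const : ∀ n c → Σ< n (λ _ → c) ≡ n * c
  Σ<-const zero    c = refl
  Σ<-const (suc n) c = cong (c +_) (Σ<-const n c)

  Σ<-split : ∀ m n f → Σ< (m + n) f ≡ Σ< m f + Σ< n (λ i → f (m + i))
  Σ<-split zero    n f = refl
  Σ<-split (suc m) n f = trans (cong (f 0 +_) (Σ<-split m n (λ i → f (suc i))))
    (sym (+-assoc (f 0) _ _))

  Σ<-suc : ∀ n f → Σ< (suc n) f ≡ Σ< n f + f n
  Σ<-suc n f = begin
    Σ< (suc n) f                      ≡⟨ cong (λ k → Σ< k f) (+-comm 1 n) ⟩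
    Σ< (n + 1) f                      ≡⟨ Σ<-split n 1 f ⟩
    Σ< n f + (f (n + 0) + 0)          ≡⟨ cong (Σ< n f +_) (trans (+-identityʳ _) (cong f (+-identityʳ n))) ⟩
    Σ< n f + f n                      ∎
    where open ≡-Reasoning

  Σ<-rotate : ∀ M f → (∀ t → f (M + t) ≡ f t) → ∀ j → Σ< M (λ u → f (j + u)) ≡ Σ< M f
  Σ<-rotate M f periodic zero    = refl
  Σ<-rotate M f periodic (suc j) = trans
    (+-cancelˡ-≡ (f (j + 0)) _ _ (begin
      f (j + 0) + Σ< M (λ u → f (suc (j + u)))
        ≡⟨ cong (f (j + 0) +_) (Σ<-cong M λ u _ → cong f (sym (+-suc j u))) ⟩
      Σ< (suc M) (λ u → f (j + u))
        ≡⟨ Σ<-suc M (λ u → f (j + u)) ⟩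
      Σ< M (λ u → f (j + u)) + f (j + M)
        ≡⟨ +-comm _ (f (j + M)) ⟩
      f (j + M) + Σ< M (λ u → f (j + u))
        ≡⟨ cong (_+ Σ< M (λ u → f (j + u)))
             (trans (cong f (+-comm j M)) (trans (periodic j) (cong f (sym (+-identityʳ j))))) ⟩
      f (j + 0) + Σ< M (λ u → f (j + u)) ∎))
    (Σ<-rotate M f periodic j)
    where open ≡-Reasoning

  -- `u ∸ (u ∸ x)` is the minimum of `u` and `x`. So for `u ≤ M` this is the distance of `u` from 0
  -- in ℤ/M.
  cyc : ℕ → ℕ → ℕ
  cyc M u = u ∸ (u ∸ (M ∸ u))

  cycDist : ℕ → ℕ → ℕ → ℕ
  cycDist M i j = cyc M ∣ i - j ∣

  cyc-cases : ∀ M u → (cyc M u ≡ u × u ≤ M ∸ u) ⊎ (cyc M u ≡ M ∸ u × M ∸ u ≤ u)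
  cyc-cases M u with ≤-total u (M ∸ u)
  ... | inj₁ u≤ = inj₁ (cong (u ∸_) (m≤n⇒m∸n≡0 u≤) , u≤)
  ... | inj₂ ≤u = inj₂ (m∸[m∸n]≡n ≤u , ≤u)

  cyc≤ : ∀ M u → cyc M u ≤ u
  cyc≤ M u = m∸n≤m u (u ∸ (M ∸ u))

  cyc≤∸ : ∀ M u → cyc M u ≤ M ∸ u
  cyc≤∸ M u = m≤n+o⇒m∸n≤o u (u ∸ (M ∸ u))
    (subst (u ≤_) (+-comm (M ∸ u) _) (m≤n+m∸n u (M ∸ u)))

  cyc-reflect : ∀ M u → u ≤ M → cyc M (M ∸ u) ≡ cyc M u
  cyc-reflect M u u≤M = trans (cong (λ v → M ∸ u ∸ (M ∸ u ∸ v)) (m∸[m∸n]≡n u≤M)) aux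
    where
    aux : M ∸ u ∸ (M ∸ u ∸ u) ≡ cyc M u
    aux with ≤-total u (M ∸ u)
    ... | inj₁ u≤ = trans (m∸[m∸n]≡n u≤) (sym (cong (u ∸_) (m≤n⇒m∸n≡0 u≤)))
    ... | inj₂ ≤u = trans (cong (M ∸ u ∸_) (m≤n⇒m∸n≡0 ≤u)) (sym (m∸[m∸n]≡n ≤u))

  module _ (M : ℕ) .{{_ : NonZero M}} where

    cycDist-+ : ∀ {i u} → i < M → u < M → cycDist M i ((i + u) % M) ≡ cyc M u
    cycDist-+ {i} {u} i<M u<M with i + u <? M
    ... | yes i+u<M = cong (cyc M) (begin
      ∣ i - (i + u) % M ∣ ≡⟨ cong (∣ i -_∣) (m<n⇒m%n≡m i+u<M) ⟩
      ∣ i - i + u ∣       ≡⟨ m≤n⇒∣m-n∣≡n∸m (m≤m+n i u) ⟩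
      i + u ∸ i           ≡⟨ m+n∸m≡n i u ⟩
      u                   ∎)
      where open ≡-Reasoning
    ... | no ¬< = trans (cong (cyc M) eq) (cyc-reflect M u (<⇒≤ u<M))
      where
      open ≡-Reasoning
      v : ℕ
      v = i + u ∸ M
      v+M : v + M ≡ i + u
      v+M = m∸n+n≡m (≮⇒≥ ¬<)
      v<M : v < M
      v<M = +-cancelʳ-< M v M (subst (_< M + M) (sym v+M) (+-mono-< i<M u<M))
      i≡ : i ≡ v + (M ∸ u)
      i≡ = +-cancelʳ-≡ u i (v + (M ∸ u)) (begin
        i + u             ≡⟨ sym v+M ⟩
        v + M             ≡⟨ cong (v +_) (sym (m∸n+n≡m (<⇒≤ u<M))) ⟩
        v + (M ∸ u + u)   ≡⟨ sym (+-assoc v (M ∸ u) u) ⟩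
        v + (M ∸ u) + u   ∎)
      eq : ∣ i - (i + u) % M ∣ ≡ M ∸ u
      eq = begin
        ∣ i - (i + u) % M ∣     ≡⟨ cong (λ k → ∣ i - k % M ∣) (sym v+M) ⟩
        ∣ i - (v + M) % M ∣     ≡⟨ cong (∣ i -_∣) (trans ([m+n]%n≡m%n v M) (m<n⇒m%n≡m v<M)) ⟩
        ∣ i - v ∣               ≡⟨ cong (∣_- v ∣) i≡ ⟩
        ∣ v + (M ∸ u) - v ∣     ≡⟨ trans (∣-∣-comm (v + (M ∸ u)) v) (m≤n⇒∣m-n∣≡n∸m (m≤m+n v (M ∸ u))) ⟩
        v + (M ∸ u) ∸ v         ≡⟨ m+n∸m≡n v (M ∸ u) ⟩
        M ∸ u                   ∎

    -- Substitutes `k = i + u` modulo `M`: the distance then depends on `u` alone, so one table of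
    -- widths serves all centres `i`.
    Σ<-recentre : ∀ (F : ℕ → ℕ → ℕ) {i} → i < M →
      Σ< M (λ k → F k (cycDist M i k)) ≡ Σ< M (λ u → F ((i + u) % M) (cyc M u))
    Σ<-recentre F {i} i<M = begin
      Σ< M (λ k → F k (cycDist M i k))
        ≡⟨ Σ<-cong M (λ k k<M → cong₂ F (sym (m<n⇒m%n≡m k<M)) (cong (cycDist M i) (sym (m<n⇒m%n≡m k<M)))) ⟩
      Σ< M g
        ≡⟨ sym (Σ<-rotate M g periodic i) ⟩
      Σ< M (λ u → g (i + u))
        ≡⟨ Σ<-cong M (λ u u<M → cong (F ((i + u) % M)) (cycDist-+ i<M u<M)) ⟩
      Σ< M (λ u → F ((i + u) % M) (cyc M u)) ∎
      where
      open ≡-Reasoning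
      g : ℕ → ℕ
      g t = F (t % M) (cycDist M i (t % M))
      periodic : ∀ t → g (M + t) ≡ g t
      periodic t = cong (λ k → F k (cycDist M i k))
        (trans (cong (_% M) (+-comm M t)) ([m+n]%n≡m%n t M))

  Cell : Set
  Cell = ℕ × ℕ

  Σ□ : ℕ → (Cell → ℕ) → ℕ
  Σ□ M f = Σ< M λ i → Σ< M λ j → f (i , j)

  -- The torus is divided into M × M cells of side L, and ρ is the radius.  At cyclic cell
  -- offset (d , e) all points lie within ρ (closeᵇ), respectively some may do (reachᵇ); each
  -- coordinate of each point may be off by 1/2, whence suc L in place of L.
  closeᵇ reachᵇ : ℕ → ℕ → ℕ → ℕ → Bool
  closeᵇ L ρ d e = (L * d + suc L) * (L * d + suc L) + (L * e + suc L) * (L * e + suc L) ≤ᵇ ρ * ρ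
  reachᵇ L ρ d e = (L * d ∸ suc L) * (L * d ∸ suc L) + (L * e ∸ suc L) * (L * e ∸ suc L) <ᵇ suc ρ * suc ρ

  offset : ℕ → (ℕ → ℕ → Bool) → Cell → Cell → Bool
  offset M φ (i , j) (k , l) = φ (cycDist M i k) (cycDist M j l)

  record Geometry : Set where
    field
      M L ρ          : ℕ
      0<M            : 0 < M
      0<L            : 0 < L
      0<ρ            : 0 < ρ
      blob           : Cell → Bool
      more-than-half : M * M + 2 ≤ 2 * Σ□ M (λ y → 𝟙 (not (blob y)))
      -- Sure neighbours off S are compared with possible neighbours in S, so the inequality
      -- survives any position of the points inside their cells.
      majority       : ∀ i j → i < M → j < M → blob (i , j) ≡ false →
        Σ□ M (λ y → 𝟙 (offset M (reachᵇ L ρ) (i , j) y ∧ not (blob y))) <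
        Σ□ M (λ y → 𝟙 (offset M (closeᵇ L ρ) (i , j) y ∧ blob y))

-- Certified counting of blob cells in discrete discs

module Windows where

  open import Data.Nat.Solver using (module +-*-Solver)
  open +-*-Solver using (solve; _:=_; _:+_; _:*_)

  open Sums
  open import Data.List using (List; []; _∷_)
  open import Data.Nat
  open import Data.Nat.DivMod using (_/_; _%_; [m+kn]%n≡m%n; m≡m%n+[m/n]*n; m%n%n≡m%n; %-distribˡ-+; m%n<n)
  open import Data.Nat.Properties

  -- The blob cells t of a grid row: start ≤ (t + phase) % H < start + width.
  record Row : Set where
    constructor mkRow
    field phase start width : ℕ
  open Row

  record Line : Set where
    constructor mkLine
    field
      blob         : Row
      inner outer  : ℕ

  lines : ℕ → (ℕ → Line) → List Line
  lines zero    f = []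
  lines (suc n) f = f 0 ∷ lines n (λ i → f (suc i))

  module Pattern (H : ℕ) .{{_ : NonZero H}} where

    M : ℕ
    M = H + H

    inBlob : Row → ℕ → Bool
    inBlob (mkRow o a c) t = (a ≤ᵇ (t + o) % H) ∧ ((t + o) % H <ᵇ a + c)

    -- Closed form for the number of blob cells in [-o , t): each full period contributes `c`, the
    -- last one the minimum of `c` and the length beyond `a`. A window count thus takes a constant
    -- number of operations, which keeps the check of all cells feasible. That the formula counts
    -- correctly is itself checked, by `stepsᵇ`.
    prefix : Row → ℕ → ℕ
    prefix (mkRow o a c) t = (t + o) / H * c + (c ∸ (c ∸ ((t + o) % H ∸ a)))

    -- The number of blob cells at cyclic distance < w from j, that is, in [j , j + w) and
    -- (j + M - w , j + M).
    window : Row → ℕ → ℕ → ℕ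
    window r j zero    = 0
    window r j (suc w) = (prefix r (j + suc w) + (width r + width r)) ∸ prefix r (j + (M ∸ w))

    total : ℕ → List Line → ℕ
    total j []                  = 0
    total j (mkLine r v w ∷ rs) = (window r j v + window r j w) + total j rs

    stepsᵇ : Row → ℕ → Bool
    stepsᵇ r t = prefix r (suc t) ≡ᵇ prefix r t + 𝟙 (inBlob r t)

    wrapsᵇ : Row → ℕ → Bool
    wrapsᵇ r t = prefix r (t + M) ≡ᵇ prefix r t + (width r + width r)

    -- Says that the two arcs of a window, of lengths `suc w` and `w`, do not overlap.
    fitsᵇ : ℕ → Bool
    fitsᵇ zero    = true
    fitsᵇ (suc w) = suc w + w ≤ᵇ M

    infix 4 _⇒ᵇ_
    _⇒ᵇ_ : Bool → Bool → Bool
    b ⇒ᵇ c = not b ∨ c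

    -- `total` bounds from below the close blob cells plus the reachable blob cells. If it exceeds
    -- the number `R` of all reachable cells, then cancelling the reachable blob cells shows that
    -- the close blob cells outnumber the reachable cells off the blob. Columns below `H` represent
    -- all, since every row has period `H`.
    checkRow : ℕ → Row → List Line → Bool
    checkRow R r rs = all< H (λ j → inBlob r j ∨ (R <ᵇ total j rs))

    Steps Wraps : Row → Set
    Steps r = ∀ t → t < M + M → prefix r (suc t) ≡ prefix r t + 𝟙 (inBlob r t)
    Wraps r = ∀ t → t < M → prefix r (t + M) ≡ prefix r t + (width r + width r)

    prefix-+ : ∀ r → Steps r → ∀ n t → t + n ≤ M + M →
      prefix r (t + n) ≡ prefix r t + Σ< n (λ k → 𝟙 (inBlob r (t + k)))
    prefix-+ r steps zero    t h = trans (cong (prefix r) (+-identityʳ t)) (sym (+-identityʳ _))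
    prefix-+ r steps (suc n) t h = begin
      prefix r (t + suc n)
        ≡⟨ cong (prefix r) (+-suc t n) ⟩
      prefix r (suc (t + n))
        ≡⟨ steps (t + n) t+n< ⟩
      prefix r (t + n) + 𝟙 (inBlob r (t + n))
        ≡⟨ cong (_+ 𝟙 (inBlob r (t + n))) (prefix-+ r steps n t (<⇒≤ t+n<)) ⟩
      prefix r t + Σ< n f + f n
        ≡⟨ +-assoc (prefix r t) _ _ ⟩
      prefix r t + (Σ< n f + f n)
        ≡⟨ cong (prefix r t +_) (sym (Σ<-suc n f)) ⟩
      prefix r t + Σ< (suc n) f ∎
      where
      open ≡-Reasoning
      f : ℕ → ℕ
      f k = 𝟙 (inBlob r (t + k))
      t+n< : t + n < M + M
      t+n< = subst (_≤ M + M) (+-suc t n) h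

    -- `wraps` cancels `prefix r j`, which leaves the sums over the two arcs. They are disjoint by
    -- `fitsᵇ` and every offset in them satisfies `φ`; `φ` may hold elsewhere too, whence the
    -- inequality.
    window≤ : ∀ r → Steps r → Wraps r → ∀ j → j < M → ∀ w → fitsᵇ w ≡ true →
      (φ : ℕ → Bool) → (∀ t → t < M → cyc M t < w → φ t ≡ true) →
      window r j w ≤ Σ< M (λ t → 𝟙 (φ t ∧ inBlob r (j + t)))
    window≤ r steps wraps j j<M zero    fits φ hφ = z≤n
    window≤ r steps wraps j j<M (suc w) fits φ hφ = begin
      prefix r (j + suc w) + (width r + width r) ∸ prefix r (j + (M ∸ w))
        ≡⟨ cong (_∸ prefix r (j + (M ∸ w))) split ⟩
      (Σ< (suc w) b + Σ< w (λ k → b (M ∸ w + k))) + prefix r (j + (M ∸ w)) ∸ prefix r (j + (M ∸ w))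
        ≡⟨ m+n∸n≡m (Σ< (suc w) b + Σ< w (λ k → b (M ∸ w + k))) (prefix r (j + (M ∸ w))) ⟩
      Σ< (suc w) b + Σ< w (λ k → b (M ∸ w + k))
        ≤⟨ +-mono-≤ (Σ<-mono (suc w) left) (Σ<-mono w right) ⟩
      Σ< (suc w) g + Σ< w (λ k → g (M ∸ w + k))
        ≤⟨ +-monoˡ-≤ _ (m≤m+n (Σ< (suc w) g) _) ⟩
      (Σ< (suc w) g + Σ< (M ∸ w ∸ suc w) (λ k → g (suc w + k))) + Σ< w (λ k → g (M ∸ w + k))
        ≡⟨ cong (_+ Σ< w (λ k → g (M ∸ w + k)))
             (trans (sym (Σ<-split (suc w) (M ∸ w ∸ suc w) g)) (cong (λ k → Σ< k g) (m+[n∸m]≡n w<M∸w))) ⟩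
      Σ< (M ∸ w) g + Σ< w (λ k → g (M ∸ w + k))
        ≡⟨ trans (sym (Σ<-split (M ∸ w) w g)) (cong (λ k → Σ< k g) (m∸n+n≡m w≤M)) ⟩
      Σ< M g ∎
      where
      open ≤-Reasoning
      b g : ℕ → ℕ
      b t = 𝟙 (inBlob r (j + t))
      g t = 𝟙 (φ t ∧ inBlob r (j + t))
      2w<M : suc w + w ≤ M
      2w<M = ≤ᵇ⇒≤ (suc w + w) M (subst T (sym fits) tt)
      w≤M : w ≤ M
      w≤M = ≤-trans (m≤n+m w (suc w)) 2w<M
      w<M∸w : suc w ≤ M ∸ w
      w<M∸w = m+n≤o⇒m≤o∸n (suc w) 2w<M
      j+ : ∀ {k} → k ≤ M → j + k ≤ M + M
      j+ = +-mono-≤ (<⇒≤ j<M)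
      in-window : ∀ t → t < M → cyc M t < suc w → b t ≤ g t
      in-window t t<M h rewrite hφ t t<M h = ≤-refl
      left : ∀ t → t < suc w → b t ≤ g t
      left t t<w = in-window t (<-≤-trans t<w (≤-trans w<M∸w (m∸n≤m M w))) (≤-<-trans (cyc≤ M t) t<w)
      right : ∀ k → k < w → b (M ∸ w + k) ≤ g (M ∸ w + k)
      right k k<w = in-window (M ∸ w + k)
        (subst (M ∸ w + k <_) (m∸n+n≡m w≤M) (+-monoʳ-< (M ∸ w) k<w))
        (s≤s (≤-trans (cyc≤∸ M (M ∸ w + k))
          (m≤n+o⇒m∸n≤o M (M ∸ w + k)
            (subst (_≤ M ∸ w + k + w) (m∸n+n≡m w≤M) (+-monoˡ-≤ w (m≤m+n (M ∸ w) k))))))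
      split : prefix r (j + suc w) + (width r + width r) ≡
              (Σ< (suc w) b + Σ< w (λ k → b (M ∸ w + k))) + prefix r (j + (M ∸ w))
      split = begin-equality
        prefix r (j + suc w) + (width r + width r)
          ≡⟨ cong (_+ (width r + width r)) (prefix-+ r steps (suc w) j (j+ (≤-trans w<M∸w (m∸n≤m M w)))) ⟩
        prefix r j + Σ< (suc w) b + (width r + width r)
          ≡⟨ cong (_+ (width r + width r)) (+-comm (prefix r j) _) ⟩
        Σ< (suc w) b + prefix r j + (width r + width r)
          ≡⟨ +-assoc (Σ< (suc w) b) _ _ ⟩
        Σ< (suc w) b + (prefix r j + (width r + width r))
          ≡⟨ cong (Σ< (suc w) b +_) (sym (wraps j j<M)) ⟩
        Σ< (suc w) b + prefix r (j + M)
          ≡⟨ cong (λ k → Σ< (suc w) b + prefix r k)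
               (trans (cong (j +_) (sym (m∸n+n≡m w≤M))) (sym (+-assoc j (M ∸ w) w))) ⟩
        Σ< (suc w) b + prefix r (j + (M ∸ w) + w)
          ≡⟨ cong (Σ< (suc w) b +_) (prefix-+ r steps w (j + (M ∸ w))
               (subst (_≤ M + M) (trans (cong (j +_) (sym (m∸n+n≡m w≤M))) (sym (+-assoc j (M ∸ w) w))) (j+ ≤-refl))) ⟩
        Σ< (suc w) b + (prefix r (j + (M ∸ w)) + Σ< w (λ k → 𝟙 (inBlob r (j + (M ∸ w) + k))))
          ≡⟨ cong (λ z → Σ< (suc w) b + (prefix r (j + (M ∸ w)) + z))
               (Σ<-cong w λ k _ → cong (λ z → 𝟙 (inBlob r z)) (+-assoc j (M ∸ w) k)) ⟩
        Σ< (suc w) b + (prefix r (j + (M ∸ w)) + Σ< w (λ k → b (M ∸ w + k)))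
          ≡⟨ cong (Σ< (suc w) b +_) (+-comm (prefix r (j + (M ∸ w))) _) ⟩
        Σ< (suc w) b + (Σ< w (λ k → b (M ∸ w + k)) + prefix r (j + (M ∸ w)))
          ≡⟨ sym (+-assoc (Σ< (suc w) b) _ _) ⟩
        (Σ< (suc w) b + Σ< w (λ k → b (M ∸ w + k))) + prefix r (j + (M ∸ w)) ∎

    instance
      M-nonZero : NonZero M
      M-nonZero = >-nonZero (≤-trans (>-nonZero⁻¹ H) (m≤m+n H H))

    inBlob-%H : ∀ r j t → inBlob r (j + t) ≡ inBlob r (j % H + t)
    inBlob-%H (mkRow o a c) j t = cong (λ k → (a ≤ᵇ k) ∧ (k <ᵇ a + c)) (begin
      (j + t + o) % H                 ≡⟨ cong (_% H) (+-assoc j t o) ⟩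
      (j + (t + o)) % H               ≡⟨ %-distribˡ-+ j (t + o) H ⟩
      (j % H + (t + o) % H) % H       ≡⟨ cong (λ k → (k + (t + o) % H) % H) (sym (m%n%n≡m%n j H)) ⟩
      (j % H % H + (t + o) % H) % H   ≡⟨ sym (%-distribˡ-+ (j % H) (t + o) H) ⟩
      (j % H + (t + o)) % H           ≡⟨ cong (_% H) (sym (+-assoc (j % H) t o)) ⟩
      (j % H + t + o) % H             ∎)
      where open ≡-Reasoning

    inBlob-%M : ∀ r t → inBlob r (t % M) ≡ inBlob r t
    inBlob-%M (mkRow o a c) t = cong (λ k → (a ≤ᵇ k) ∧ (k <ᵇ a + c)) (sym (begin
      (t + o) % H                       ≡⟨ cong (λ k → (k + o) % H) (m≡m%n+[m/n]*n t M) ⟩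
      (t % M + t / M * (H + H) + o) % H ≡⟨ cong (_% H) (rearrange (t % M) (t / M) o) ⟩
      (t % M + o + (t / M + t / M) * H) % H ≡⟨ [m+kn]%n≡m%n (t % M + o) (t / M + t / M) H ⟩
      (t % M + o) % H                   ∎))
      where
      open ≡-Reasoning
      rearrange : ∀ x q o → x + q * (H + H) + o ≡ x + o + (q + q) * H
      rearrange x q o = solve 4 (λ x q o h → x :+ q :* (h :+ h) :+ o := x :+ o :+ (q :+ q) :* h) refl x q o H

    module Checked
      (row : ℕ → Row) (inner outer : ℕ → ℕ) (L ρ R : ℕ) where

      close reach : ℕ → ℕ → Bool
      close = closeᵇ L ρ
      reach = reachᵇ L ρ

      blob : Cell → Bool
      blob (i , j) = inBlob (row i) j

      line : ℕ → ℕ → Line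
      line i u = mkLine (row ((i + u) % M)) (inner (cyc M u)) (outer (cyc M u))

      check : ℕ → Bool
      check i = checkRow R (row i) (lines M (line i))

      rowsᵇ : ℕ → Bool
      rowsᵇ i = all< (M + M) (stepsᵇ (row i)) ∧ all< M (wrapsᵇ (row i))

      widthsᵇ : (ℕ → ℕ → Bool) → (ℕ → ℕ) → ℕ → Bool
      widthsᵇ φ w u = fitsᵇ (w (cyc M u)) ∧ all< M (λ t → (cyc M t <ᵇ w (cyc M u)) ⇒ᵇ φ (cyc M u) (cyc M t))

      reachable : ℕ
      reachable = Σ< M λ u → Σ< M λ t → 𝟙 (reach (cyc M u) (cyc M t))

      record Certificate : Set where
        field
          rows-ok  : all< M rowsᵇ ≡ true
          inner-ok : all< M (widthsᵇ close inner) ≡ true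
          outer-ok : all< M (widthsᵇ reach outer) ≡ true
          reach-ok : (reachable ≡ᵇ R) ≡ true
          half-ok  : (M * M + 2 ≤ᵇ 2 * Σ□ M (λ y → 𝟙 (not (blob y)))) ≡ true
          check-ok : all< M check ≡ true

      module Certified (certificate : Certificate) where

        open Certificate certificate

        ≡ᵇ-true : ∀ {m n} → (m ≡ᵇ n) ≡ true → m ≡ n
        ≡ᵇ-true {m} {n} h = ≡ᵇ⇒≡ m n (subst T (sym h) tt)

        steps : ∀ i → i < M → Steps (row i)
        steps i i<M t t< = ≡ᵇ-true (all<-sound (M + M) (stepsᵇ (row i))
          (proj₁ (∧-true (all<-sound M rowsᵇ rows-ok i i<M))) t t<)

        wraps : ∀ i → i < M → Wraps (row i)
        wraps i i<M t t< = ≡ᵇ-true (all<-sound M (wrapsᵇ (row i))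
          (proj₂ (∧-true {all< (M + M) (stepsᵇ (row i))} (all<-sound M rowsᵇ rows-ok i i<M))) t t<)

        ⇒ᵇ-true : ∀ {b c} → (b ⇒ᵇ c) ≡ true → b ≡ true → c ≡ true
        ⇒ᵇ-true {true} h refl = h

        <ᵇ-true : ∀ {m n} → m < n → (m <ᵇ n) ≡ true
        <ᵇ-true {m} {n} h with m <ᵇ n | <⇒<ᵇ h
        ... | true | _ = refl

        windowAt≤ : ∀ φ w → all< M (widthsᵇ φ w) ≡ true → ∀ r → Steps r → Wraps r →
          ∀ j → j < M → ∀ u → u < M →
          window r j (w (cyc M u)) ≤ Σ< M (λ t → 𝟙 (φ (cyc M u) (cyc M t) ∧ inBlob r (j + t)))
        windowAt≤ φ w ok r st wr j j<M u u<M = window≤ r st wr j j<M (w (cyc M u))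
          (proj₁ (∧-true h)) (λ t → φ (cyc M u) (cyc M t))
          (λ t t<M t< → ⇒ᵇ-true (all<-sound M _ (proj₂ (∧-true {fitsᵇ (w (cyc M u))} h)) t t<M) (<ᵇ-true t<))
          where
          h : widthsᵇ φ w u ≡ true
          h = all<-sound M (widthsᵇ φ w) ok u u<M

        recentre : ∀ φ i j → i < M → j < M →
          Σ□ M (λ y → 𝟙 (offset M φ (i , j) y ∧ blob y)) ≡
          Σ< M λ u → Σ< M λ t → 𝟙 (φ (cyc M u) (cyc M t) ∧ inBlob (row ((i + u) % M)) (j % H + t))
        recentre φ i j i<M j<M = trans
          (Σ<-recentre M (λ k d → Σ< M λ l → 𝟙 (φ d (cycDist M j l) ∧ inBlob (row k) l)) i<M)
          (Σ<-cong M λ u _ → trans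
            (Σ<-recentre M (λ l d → 𝟙 (φ (cyc M u) d ∧ inBlob (row ((i + u) % M)) l)) j<M)
            (Σ<-cong M λ t _ → cong (λ b → 𝟙 (φ (cyc M u) (cyc M t) ∧ b))
              (trans (inBlob-%M (row ((i + u) % M)) (j + t)) (inBlob-%H (row ((i + u) % M)) j t))))

        total-lines : ∀ j n f → total j (lines n f) ≡
          Σ< n (λ u → window (Line.blob (f u)) j (Line.inner (f u)) + window (Line.blob (f u)) j (Line.outer (f u)))
        total-lines j zero    f = refl
        total-lines j (suc n) f = cong (_ +_) (total-lines j n (λ u → f (suc u)))

        blob-total : ∀ i j → i < M → j < M →
          total (j % H) (lines M (line i)) ≤
          Σ□ M (λ y → 𝟙 (offset M close (i , j) y ∧ blob y)) + Σ□ M (λ y → 𝟙 (offset M reach (i , j) y ∧ blob y))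
        blob-total i j i<M j<M = begin
          total (j % H) (lines M (line i))
            ≡⟨ total-lines (j % H) M (line i) ⟩
          Σ< M (λ u → window (r u) (j % H) (inner (cyc M u)) + window (r u) (j % H) (outer (cyc M u)))
            ≡⟨ Σ<-+ M _ _ ⟩
          Σ< M (λ u → window (r u) (j % H) (inner (cyc M u))) + Σ< M (λ u → window (r u) (j % H) (outer (cyc M u)))
            ≤⟨ +-mono-≤ (Σ<-mono M (part close inner inner-ok)) (Σ<-mono M (part reach outer outer-ok)) ⟩
          _ ≡⟨ sym (cong₂ _+_ (recentre close i j i<M j<M) (recentre reach i j i<M j<M)) ⟩
          _ ∎
          where
          open ≤-Reasoning
          r : ℕ → Row
          r u = row ((i + u) % M)
          part : ∀ φ w → all< M (widthsᵇ φ w) ≡ true → ∀ u → u < M →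
            window (r u) (j % H) (w (cyc M u)) ≤
            Σ< M (λ t → 𝟙 (φ (cyc M u) (cyc M t) ∧ inBlob (r u) (j % H + t)))
          part φ w ok u u<M = windowAt≤ φ w ok (r u)
            (steps _ (m%n<n (i + u) M)) (wraps _ (m%n<n (i + u) M))
            (j % H) (<-≤-trans (m%n<n j H) (m≤m+n H H)) u u<M

        reach-total : ∀ i j → i < M → j < M → Σ□ M (λ y → 𝟙 (offset M reach (i , j) y)) ≡ R
        reach-total i j i<M j<M = trans
          (Σ<-recentre M (λ k d → Σ< M λ l → 𝟙 (reach d (cycDist M j l))) i<M)
          (trans (Σ<-cong M λ u _ → Σ<-recentre M (λ l d → 𝟙 (reach (cyc M u) d)) j<M) (≡ᵇ-true reach-ok))

        majority : ∀ i j → i < M → j < M → blob (i , j) ≡ false →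
          Σ□ M (λ y → 𝟙 (offset M reach (i , j) y ∧ not (blob y))) < Σ□ M (λ y → 𝟙 (offset M close (i , j) y ∧ blob y))
        majority i j i<M j<M outside = +-cancelʳ-< (Σ□ M (λ y → 𝟙 (near y ∧ blob y))) _ _ (begin-strict
          Σ□ M (λ y → 𝟙 (near y ∧ not (blob y))) + Σ□ M (λ y → 𝟙 (near y ∧ blob y))
            ≡⟨ trans (sym (Σ□-+ _ _)) (Σ□-cong λ y → trans (+-comm _ (𝟙 (near y ∧ blob y))) (𝟙-∧-not (near y) (blob y))) ⟩
          Σ□ M (λ y → 𝟙 (near y))
            ≡⟨ reach-total i j i<M j<M ⟩
          R
            <⟨ <ᵇ⇒< R _ (subst T (sym beats) tt) ⟩
          total (j % H) (lines M (line i))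
            ≤⟨ blob-total i j i<M j<M ⟩
          Σ□ M (λ y → 𝟙 (offset M close (i , j) y ∧ blob y)) + Σ□ M (λ y → 𝟙 (near y ∧ blob y)) ∎)
          where
          open ≤-Reasoning
          near : Cell → Bool
          near = offset M reach (i , j)
          Σ□-+ : ∀ f g → Σ□ M (λ y → f y + g y) ≡ Σ□ M f + Σ□ M g
          Σ□-+ f g = trans (Σ<-cong M λ k _ → Σ<-+ M (λ l → f (k , l)) (λ l → g (k , l))) (Σ<-+ M _ _)
          Σ□-cong : ∀ {f g} → (∀ y → f y ≡ g y) → Σ□ M f ≡ Σ□ M g
          Σ□-cong h = Σ<-cong M λ k _ → Σ<-cong M λ l _ → h (k , l)
          outside′ : inBlob (row i) (j % H) ≡ false
          outside′ = trans (trans (cong (inBlob (row i)) (sym (+-identityʳ (j % H))))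
            (trans (sym (inBlob-%H (row i) j 0)) (cong (inBlob (row i)) (+-identityʳ j)))) outside
          beats : (R <ᵇ total (j % H) (lines M (line i))) ≡ true
          beats = trans (cong (_∨ (R <ᵇ total (j % H) (lines M (line i)))) (sym outside′))
            (all<-sound H _ (all<-sound M check check-ok i i<M) (j % H) (m%n<n j H))

        more-than-half : M * M + 2 ≤ 2 * Σ□ M (λ y → 𝟙 (not (blob y)))
        more-than-half = ≤ᵇ⇒≤ (M * M + 2) _ (subst T (sym half-ok) tt)

        geometry : 0 < L → 0 < ρ → Geometry
        geometry 0<L 0<ρ = record
          { 0<M = >-nonZero⁻¹ M ; 0<L = 0<L ; 0<ρ = 0<ρ
          ; more-than-half = more-than-half ; majority = majority }

-- The explicit pattern of ellipses

module BlobPattern where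

  open Sums
  open Windows
  open import Data.List using (List; []; _∷_)
  open import Data.Nat
  open import Data.Nat.DivMod using (_/_)

  open Pattern 80

  nth : List ℕ → ℕ → ℕ
  nth []       _       = 0
  nth (x ∷ xs) zero    = x
  nth (x ∷ xs) (suc k) = nth xs k

  -- For odd `c` the interval is centred at 40 in the shifted coordinate: at the multiples of 80 for
  -- phase 40, at the odd multiples of 40 for phase 0.
  blobRow : ℕ → ℕ → Row
  blobRow o c = mkRow o (40 ∸ c / 2) c

  -- The ellipses 13 d² + 14 e² ≤ 13677 around the lattice points (80 a , 40 a + 80 b);
  -- widths lists the number of such e for d = 0, 1, ….
  row : ℕ → Row
  -- The lattice points lie in rows 0 and 80 modulo 160, and the ellipses reach only 32 rows away,
  -- so each row meets the ellipses of the nearer lattice row only.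
  row i = if cyc 160 i ≤ᵇ 40 then blobRow 40 (nth widths (cyc 160 i)) else blobRow 0 (nth widths (80 ∸ cyc 160 i))
    where
    -- An ellipse has 3199 cells, the four ellipses on the torus 12796, so 12804 of the 25600 cells
    -- remain: barely more than half.
    widths : List ℕ
    widths =
      63 ∷ 63 ∷ 63 ∷ 63 ∷ 63 ∷ 61 ∷ 61 ∷ 61 ∷ 61 ∷ 61 ∷ 59 ∷ 59 ∷ 59 ∷ 57 ∷ 57 ∷ 55 ∷
      55 ∷ 53 ∷ 53 ∷ 51 ∷ 49 ∷ 47 ∷ 45 ∷ 45 ∷ 43 ∷ 39 ∷ 37 ∷ 35 ∷ 31 ∷ 29 ∷ 23 ∷ 19 ∷ 11 ∷ []

  -- For each d, the number of e with closeᵇ, respectively reachᵇ.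
  inner outer : ℕ → ℕ
  inner = nth (
    61 ∷ 61 ∷ 61 ∷ 61 ∷ 61 ∷ 61 ∷ 61 ∷ 60 ∷ 60 ∷ 60 ∷ 60 ∷ 60 ∷ 60 ∷ 59 ∷ 59 ∷ 59 ∷
    59 ∷ 58 ∷ 58 ∷ 58 ∷ 57 ∷ 57 ∷ 56 ∷ 56 ∷ 56 ∷ 55 ∷ 55 ∷ 54 ∷ 54 ∷ 53 ∷ 53 ∷ 52 ∷
    51 ∷ 51 ∷ 50 ∷ 49 ∷ 49 ∷ 48 ∷ 47 ∷ 46 ∷ 45 ∷ 44 ∷ 43 ∷ 42 ∷ 41 ∷ 40 ∷ 39 ∷ 38 ∷
    37 ∷ 35 ∷ 34 ∷ 32 ∷ 31 ∷ 29 ∷ 27 ∷ 25 ∷ 22 ∷ 20 ∷ 17 ∷ 13 ∷ 7 ∷ [])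
  outer = nth (
    63 ∷ 63 ∷ 63 ∷ 63 ∷ 63 ∷ 63 ∷ 63 ∷ 63 ∷ 63 ∷ 62 ∷ 62 ∷ 62 ∷ 62 ∷ 62 ∷ 62 ∷ 61 ∷
    61 ∷ 61 ∷ 61 ∷ 60 ∷ 60 ∷ 60 ∷ 59 ∷ 59 ∷ 58 ∷ 58 ∷ 58 ∷ 57 ∷ 57 ∷ 56 ∷ 56 ∷ 55 ∷
    55 ∷ 54 ∷ 53 ∷ 53 ∷ 52 ∷ 51 ∷ 51 ∷ 50 ∷ 49 ∷ 48 ∷ 47 ∷ 46 ∷ 45 ∷ 44 ∷ 43 ∷ 42 ∷
    41 ∷ 40 ∷ 39 ∷ 37 ∷ 36 ∷ 34 ∷ 33 ∷ 31 ∷ 29 ∷ 27 ∷ 24 ∷ 22 ∷ 19 ∷ 15 ∷ 9 ∷ [])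

  -- Cells have side 1000, so the torus has side 160000 and the radius is 61404/160000 = 0.383775;
  -- the uncertainty of half a unit is 1/2000 of a cell. There are 12369 reachable offsets.
  open Checked row inner outer 1000 61404 12369

  certificate : Certificate
  certificate = record
    { rows-ok  = refl
    ; inner-ok = refl
    ; outer-ok = refl
    ; reach-ok = refl
    ; half-ok  = refl
    ; check-ok = refl
    }

  geometry : Geometry
  geometry = Certified.geometry certificate z<s z<s

-- Chebyshev's inequality by counting words

module WordCounts where

  open import Data.List using (List; []; _∷_; _++_; map; length; cartesianProductWith; filter)
  open import Data.List.Membership.Propositional using (_∈_)
  open import Data.List.Membership.Propositional.Properties using (∈-cartesianProductWith⁺; ∈-cartesianProductWith⁻)
  open import Data.List.Relation.Unary.All as All using (All; []; _∷_)
  open import Data.List.Relation.Unary.Any using (here; there)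
  open import Data.List.Relation.Unary.Unique.Propositional using (Unique)
  open import Data.List.Relation.Unary.AllPairs using ([]; _∷_)
  open import Data.Nat
  open import Data.Nat.Properties
  open import Data.Nat.Tactic.RingSolver using (solve-∀)
  open import Data.Vec as Vec using (Vec; []; _∷_)
  import Data.Vec.Relation.Unary.All as Vec
  open import Algebra.Properties.CommutativeSemigroup +-commutativeSemigroup using (interchange)
  open import Relation.Binary.Definitions using (DecidableEquality)
  open import Level using (0ℓ)
  open import Relation.Unary using (Pred; Decidable)

  module _ {A : Set} where

    Σᴸ : List A → (A → ℕ) → ℕ
    Σᴸ []       f = 0
    Σᴸ (x ∷ xs) f = f x + Σᴸ xs f

    Σᴸ-cong : ∀ xs {f g} → (∀ {x} → x ∈ xs → f x ≡ g x) → Σᴸ xs f ≡ Σᴸ xs g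
    Σᴸ-cong []       h = refl
    Σᴸ-cong (x ∷ xs) h = cong₂ _+_ (h (here refl)) (Σᴸ-cong xs λ m → h (there m))

    Σᴸ-mono : ∀ xs {f g} → (∀ {x} → x ∈ xs → f x ≤ g x) → Σᴸ xs f ≤ Σᴸ xs g
    Σᴸ-mono []       h = z≤n
    Σᴸ-mono (x ∷ xs) h = +-mono-≤ (h (here refl)) (Σᴸ-mono xs λ m → h (there m))

    Σᴸ-+ : ∀ xs f g → Σᴸ xs (λ x → f x + g x) ≡ Σᴸ xs f + Σᴸ xs g
    Σᴸ-+ []       f g = refl
    Σᴸ-+ (x ∷ xs) f g = trans (cong (f x + g x +_) (Σᴸ-+ xs f g)) (interchange (f x) (g x) _ _)

    Σᴸ-* : ∀ xs c f → Σᴸ xs (λ x → c * f x) ≡ c * Σᴸ xs f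
    Σᴸ-* []       c f = sym (*-zeroʳ c)
    Σᴸ-* (x ∷ xs) c f = trans (cong (c * f x +_) (Σᴸ-* xs c f)) (sym (*-distribˡ-+ c (f x) _))

    Σᴸ-const : ∀ xs c → Σᴸ xs (λ _ → c) ≡ length xs * c
    Σᴸ-const []       c = refl
    Σᴸ-const (x ∷ xs) c = cong (c +_) (Σᴸ-const xs c)

    Σᴸ-++ : ∀ xs ys f → Σᴸ (xs ++ ys) f ≡ Σᴸ xs f + Σᴸ ys f
    Σᴸ-++ []       ys f = refl
    Σᴸ-++ (x ∷ xs) ys f = trans (cong (f x +_) (Σᴸ-++ xs ys f)) (sym (+-assoc (f x) _ _))

    Σᴸ-∈ : ∀ {xs x} → x ∈ xs → ∀ f → f x ≤ Σᴸ xs f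
    Σᴸ-∈ (here refl)     f = m≤m+n _ _
    Σᴸ-∈ (there {y} x∈)  f = ≤-trans (Σᴸ-∈ x∈ f) (m≤n+m _ (f y))

    markov : ∀ {P : Pred A 0ℓ} (P? : Decidable P) D f xs → (∀ {x} → P x → D ≤ f x) →
      length (filter P? xs) * D ≤ Σᴸ xs f
    markov P? D f []       h = z≤n
    markov P? D f (x ∷ xs) h with P? x
    ... | yes px = +-mono-≤ (h px) (markov P? D f xs h)
    ... | no  _  = ≤-trans (markov P? D f xs h) (m≤n+m _ (f x))

  Σᴸ-map : ∀ {A B : Set} (f : A → B) xs g → Σᴸ (map f xs) g ≡ Σᴸ xs (λ x → g (f x))
  Σᴸ-map f []       g = refl
  Σᴸ-map f (x ∷ xs) g = cong (g (f x) +_) (Σᴸ-map f xs g)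

  Σᴸ-swap : ∀ {A B : Set} (xs : List A) (ys : List B) (f : A → B → ℕ) →
    Σᴸ xs (λ x → Σᴸ ys (f x)) ≡ Σᴸ ys (λ y → Σᴸ xs (λ x → f x y))
  Σᴸ-swap []       ys f = sym (trans (Σᴸ-const ys 0) (*-zeroʳ (length ys)))
  Σᴸ-swap (x ∷ xs) ys f = trans (cong (Σᴸ ys (f x) +_) (Σᴸ-swap xs ys f))
    (sym (Σᴸ-+ ys (f x) (λ y → Σᴸ xs (λ x → f x y))))

  Σᴸ-product : ∀ {A B C : Set} (_∙_ : A → B → C) xs ys g →
    Σᴸ (cartesianProductWith _∙_ xs ys) g ≡ Σᴸ xs (λ x → Σᴸ ys (λ y → g (x ∙ y)))
  Σᴸ-product _∙_ []       ys g = refl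
  Σᴸ-product _∙_ (x ∷ xs) ys g = trans (Σᴸ-++ (map (x ∙_) ys) _ g)
    (cong₂ _+_ (Σᴸ-map (x ∙_) ys g) (Σᴸ-product _∙_ xs ys g))

  module Words {A : Set} (_≟_ : DecidableEquality A) (as : List A) (unique : Unique as) where

    m : ℕ
    m = length as

    δ : A → A → ℕ
    δ a b with a ≟ b
    ... | yes _ = 1
    ... | no  _ = 0

    δ-refl : ∀ a → δ a a ≡ 1
    δ-refl a with a ≟ a
    ... | yes _   = refl
    ... | no a≢a = contradiction refl a≢a

    δ-≢ : ∀ {a b} → a ≢ b → δ a b ≡ 0
    δ-≢ {a} {b} a≢b with a ≟ b
    ... | yes a≡b = contradiction a≡b a≢b
    ... | no  _   = refl

    δ-square : ∀ a b → δ a b * δ a b ≡ δ a b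
    δ-square a b with a ≟ b
    ... | yes _ = refl
    ... | no  _ = refl

    Σ-δ : ∀ {b} → b ∈ as → (φ : A → ℕ) → Σᴸ as (λ a → φ a * δ a b) ≡ φ b
    Σ-δ = go unique
      where
      absent : ∀ {xs b} → All (b ≢_) xs → (φ : A → ℕ) → Σᴸ xs (λ a → φ a * δ a b) ≡ 0
      absent []              φ = refl
      absent {x ∷ _} (b≢x ∷ h) φ = cong₂ _+_
        (trans (cong (φ x *_) (δ-≢ (λ x≡b → b≢x (sym x≡b)))) (*-zeroʳ (φ x))) (absent h φ)
      go : ∀ {xs b} → Unique xs → b ∈ xs → (φ : A → ℕ) → Σᴸ xs (λ a → φ a * δ a b) ≡ φ b
      go {b ∷ xs} (h ∷ _) (here refl) φ = trans
        (cong₂ _+_ (trans (cong (φ b *_) (δ-refl b)) (*-identityʳ (φ b))) (absent h φ))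
        (+-identityʳ (φ b))
      go {x ∷ xs} {b} (h ∷ u) (there b∈) φ = cong₂ _+_
        (trans (cong (φ x *_) (δ-≢ (All.lookup h b∈))) (*-zeroʳ (φ x))) (go u b∈ φ)

    weight : ∀ {n} → (A → ℕ) → Vec A n → ℕ
    weight φ []      = 0
    weight φ (a ∷ v) = φ a + weight φ v

    count : ∀ {n} → A → Vec A n → ℕ
    count a = weight (δ a)

    Word : ∀ {n} → Vec A n → Set
    Word = Vec.All (_∈ as)

    weight-count : ∀ {n} {v : Vec A n} → Word v → ∀ φ → weight φ v ≡ Σᴸ as (λ a → φ a * count a v)
    weight-count {v = []}    Vec.[]          φ = sym (trans
      (Σᴸ-cong as λ {a} _ → *-zeroʳ (φ a)) (trans (Σᴸ-const as 0) (*-zeroʳ m)))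
    weight-count {v = b ∷ v} (b∈ Vec.∷ w) φ = begin
      φ b + weight φ v
        ≡⟨ cong₂ _+_ (sym (Σ-δ b∈ φ)) (weight-count w φ) ⟩
      Σᴸ as (λ a → φ a * δ a b) + Σᴸ as (λ a → φ a * count a v)
        ≡⟨ sym (Σᴸ-+ as _ _) ⟩
      Σᴸ as (λ a → φ a * δ a b + φ a * count a v)
        ≡⟨ Σᴸ-cong as (λ {a} _ → sym (*-distribˡ-+ (φ a) (δ a b) (count a v))) ⟩
      Σᴸ as (λ a → φ a * (δ a b + count a v)) ∎
      where open ≡-Reasoning

    weight-1 : ∀ {n} (v : Vec A n) → weight (λ _ → 1) v ≡ n
    weight-1 []      = refl
    weight-1 (_ ∷ v) = cong suc (weight-1 v)

    Σ-count : ∀ {n} {v : Vec A n} → Word v → Σᴸ as (λ a → count a v) ≡ n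
    Σ-count {v = v} w = trans (Σᴸ-cong as λ {a} _ → sym (*-identityˡ (count a v)))
      (trans (sym (weight-count w (λ _ → 1))) (weight-1 v))

    words : ∀ n → List (Vec A n)
    words zero    = [] ∷ []
    words (suc n) = cartesianProductWith _∷_ as (words n)

    ∈-words : ∀ {n} {v : Vec A n} → Word v → v ∈ words n
    ∈-words {v = []}    Vec.[]        = here refl
    ∈-words {v = a ∷ v} (a∈ Vec.∷ w) = ∈-cartesianProductWith⁺ _∷_ a∈ (∈-words w)

    Σ-words : ∀ n (g : Vec A (suc n) → ℕ) →
      Σᴸ (words (suc n)) g ≡ Σᴸ as (λ a → Σᴸ (words n) (λ v → g (a ∷ v)))
    Σ-words n g = Σᴸ-product _∷_ as (words n) g

    length-words : ∀ n → Σᴸ (words n) (λ _ → 1) ≡ m ^ n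
    length-words zero    = refl
    length-words (suc n) = trans (Σ-words n _) (trans (Σᴸ-const as _) (cong (m *_) (length-words n)))

    Σ-words-const : ∀ n c → Σᴸ (words n) (λ _ → c) ≡ c * m ^ n
    Σ-words-const n c = trans (Σᴸ-cong (words n) λ _ → sym (*-identityʳ c))
      (trans (Σᴸ-* (words n) c (λ _ → 1)) (cong (c *_) (length-words n)))

    words-Word : ∀ n {v : Vec A n} → v ∈ words n → Word v
    words-Word zero    {[]} _ = Vec.[]
    words-Word (suc n) v∈ with ∈-cartesianProductWith⁻ _∷_ as (words n) v∈
    ... | a , v , a∈ , v∈′ , refl = a∈ Vec.∷ words-Word n v∈′

    squares : ∀ {n} → Vec A n → ℕ
    squares v = Σᴸ as λ a → count a v * count a v

    squares-∷ : ∀ {n} {v : Vec A n} {b} → b ∈ as → squares (b ∷ v) ≡ 1 + 2 * count b v + squares v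
    squares-∷ {v = v} {b} b∈ = begin
      Σᴸ as (λ a → (δ a b + count a v) * (δ a b + count a v))
        ≡⟨ Σᴸ-cong as (λ {a} _ → trans (expand (δ a b) (count a v))
             (cong (λ z → z + 2 * count a v * δ a b + count a v * count a v)
               (trans (δ-square a b) (sym (*-identityˡ (δ a b)))))) ⟩
      Σᴸ as (λ a → 1 * δ a b + 2 * count a v * δ a b + count a v * count a v)
        ≡⟨ trans (Σᴸ-+ as _ _) (cong (_+ squares v) (Σᴸ-+ as _ _)) ⟩
      Σᴸ as (λ a → 1 * δ a b) + Σᴸ as (λ a → 2 * count a v * δ a b) + squares v
        ≡⟨ cong₂ (λ x y → x + y + squares v) (Σ-δ b∈ (λ _ → 1)) (Σ-δ b∈ (λ a → 2 * count a v)) ⟩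
      1 + 2 * count b v + squares v ∎
      where
      open ≡-Reasoning
      expand : ∀ d x → (d + x) * (d + x) ≡ d * d + 2 * x * d + x * x
      expand = solve-∀

    -- The second moment: for a uniform word the expected sum of the squared counts is n + n(n -
    -- 1)/m, here freed of subtraction and division. The induction closes because the linear term of
    -- `squares-∷` sums to `2 * n` for every word.
    Σ-squares : ∀ n → m * Σᴸ (words n) squares + n * m ^ n ≡ m ^ n * (n * n + m * n)
    Σ-squares zero = trans (cong (λ z → m * (z + 0) + 0) (trans (Σᴸ-const as 0) (*-zeroʳ m)))
      (trans (+-identityʳ (m * 0)) (trans (*-zeroʳ m) (sym (trans (+-identityʳ _) (*-zeroʳ m)))))
    Σ-squares (suc n) = begin
      m * Σᴸ (words (suc n)) squares + suc n * m ^ suc n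
        ≡⟨ cong (λ z → m * z + suc n * m ^ suc n) recurrence ⟩
      m * ((m + 2 * n) * m ^ n + m * Σᴸ (words n) squares) + suc n * (m * m ^ n)
        ≡⟨ collect m n (m ^ n) (Σᴸ (words n) squares) ⟩
      m * ((m + 2 * n) * m ^ n + m ^ n) + m * (m * Σᴸ (words n) squares + n * m ^ n)
        ≡⟨ cong (λ z → m * ((m + 2 * n) * m ^ n + m ^ n) + m * z) (Σ-squares n) ⟩
      m * ((m + 2 * n) * m ^ n + m ^ n) + m * (m ^ n * (n * n + m * n))
        ≡⟨ finish m n (m ^ n) ⟩
      m ^ suc n * (suc n * suc n + m * suc n) ∎
      where
      open ≡-Reasoning
      collect : ∀ m n p t → m * ((m + 2 * n) * p + m * t) + suc n * (m * p) ≡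
                            m * ((m + 2 * n) * p + p) + m * (m * t + n * p)
      collect = solve-∀
      finish : ∀ m n p → m * ((m + 2 * n) * p + p) + m * (p * (n * n + m * n)) ≡
                         m * p * (suc n * suc n + m * suc n)
      finish = solve-∀
      per-word : ∀ {v} → v ∈ words n → Σᴸ as (λ b → squares (b ∷ v)) ≡ (m + 2 * n) + m * squares v
      per-word {v} v∈ = begin
        Σᴸ as (λ b → squares (b ∷ v))
          ≡⟨ Σᴸ-cong as (squares-∷ {v = v}) ⟩
        Σᴸ as (λ b → 1 + 2 * count b v + squares v)
          ≡⟨ trans (Σᴸ-+ as _ _) (cong₂ _+_ (Σᴸ-+ as _ _) (Σᴸ-const as (squares v))) ⟩
        Σᴸ as (λ _ → 1) + Σᴸ as (λ b → 2 * count b v) + m * squares v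
          ≡⟨ cong₂ (λ x y → x + y + m * squares v) (trans (Σᴸ-const as 1) (*-identityʳ m))
               (trans (Σᴸ-* as 2 (λ b → count b v)) (cong (2 *_) (Σ-count (words-Word n v∈)))) ⟩
        (m + 2 * n) + m * squares v ∎
      recurrence : Σᴸ (words (suc n)) squares ≡ (m + 2 * n) * m ^ n + m * Σᴸ (words n) squares
      recurrence = begin
        Σᴸ (words (suc n)) squares
          ≡⟨ Σ-words n squares ⟩
        Σᴸ as (λ b → Σᴸ (words n) (λ v → squares (b ∷ v)))
          ≡⟨ Σᴸ-swap as (words n) (λ b v → squares (b ∷ v)) ⟩
        Σᴸ (words n) (λ v → Σᴸ as (λ b → squares (b ∷ v)))
          ≡⟨ Σᴸ-cong (words n) per-word ⟩
        Σᴸ (words n) (λ v → (m + 2 * n) + m * squares v)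
          ≡⟨ trans (Σᴸ-+ (words n) _ _) (cong₂ _+_ (Σ-words-const n (m + 2 * n)) (Σᴸ-* (words n) m squares)) ⟩
        (m + 2 * n) * m ^ n + m * Σᴸ (words n) squares ∎

    -- The squared deviations of the counts from their mean n/m, scaled by m² to stay integral.
    -- Their sum bounds each of them, so a single application of Markov's inequality controls all
    -- cells at once.
    deviation : ∀ {n} → Vec A n → ℕ
    deviation {n} v = Σᴸ as λ a → ∣ m * count a v - n ∣ * ∣ m * count a v - n ∣

    ∣-∣-square : ∀ x y → ∣ x - y ∣ * ∣ x - y ∣ + 2 * (x * y) ≡ x * x + y * y
    ∣-∣-square x y with ≤-total x y
    ... | inj₁ x≤y = subst (λ y → ∣ x - y ∣ * ∣ x - y ∣ + 2 * (x * y) ≡ x * x + y * y) (m+[n∸m]≡n x≤y)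
      (trans (cong (λ z → z * z + 2 * (x * (x + (y ∸ x)))) (trans (m≤n⇒∣m-n∣≡n∸m (m≤m+n x (y ∸ x))) (m+n∸m≡n x (y ∸ x))))
        (ring x (y ∸ x)))
      where
      ring : ∀ x d → d * d + 2 * (x * (x + d)) ≡ x * x + (x + d) * (x + d)
      ring = solve-∀
    ... | inj₂ y≤x = subst (λ x → ∣ x - y ∣ * ∣ x - y ∣ + 2 * (x * y) ≡ x * x + y * y) (m+[n∸m]≡n y≤x)
      (trans (cong (λ z → z * z + 2 * ((y + (x ∸ y)) * y)) (trans (∣-∣-comm (y + (x ∸ y)) y) (trans (m≤n⇒∣m-n∣≡n∸m (m≤m+n y (x ∸ y))) (m+n∸m≡n y (x ∸ y)))))
        (ring y (x ∸ y)))
      where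
      ring : ∀ y d → d * d + 2 * ((y + d) * y) ≡ (y + d) * (y + d) + y * y
      ring = solve-∀

    -- The counts add up to `n`, so the cross terms are the same for every word.
    deviation-squares : ∀ {n} {v : Vec A n} → Word v → deviation v + m * (n * n) ≡ m * m * squares v
    deviation-squares {n} {v} w = +-cancelʳ-≡ (m * (n * n)) _ _ (begin
      deviation v + m * (n * n) + m * (n * n)
        ≡⟨ regroup (deviation v) m n ⟩
      deviation v + 2 * m * n * n
        ≡⟨ cong (λ z → deviation v + 2 * m * n * z) (sym (Σ-count w)) ⟩
      deviation v + 2 * m * n * Σᴸ as (λ a → count a v)
        ≡⟨ cong (deviation v +_) (sym (Σᴸ-* as (2 * m * n) (λ a → count a v))) ⟩
      deviation v + Σᴸ as (λ a → 2 * m * n * count a v)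
        ≡⟨ sym (Σᴸ-+ as _ _) ⟩
      Σᴸ as (λ a → ∣ m * count a v - n ∣ * ∣ m * count a v - n ∣ + 2 * m * n * count a v)
        ≡⟨ Σᴸ-cong as (λ {a} _ → trans (cong (∣ m * count a v - n ∣ * ∣ m * count a v - n ∣ +_) (shuffle m n (count a v)))
             (trans (∣-∣-square (m * count a v) n) (cong (_+ n * n) (sq m (count a v))))) ⟩
      Σᴸ as (λ a → m * m * (count a v * count a v) + n * n)
        ≡⟨ trans (Σᴸ-+ as _ _) (cong₂ _+_ (Σᴸ-* as (m * m) _) (Σᴸ-const as (n * n))) ⟩
      m * m * squares v + m * (n * n) ∎)
      where
      open ≡-Reasoning
      regroup : ∀ d m n → d + m * (n * n) + m * (n * n) ≡ d + 2 * m * n * n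
      regroup = solve-∀
      shuffle : ∀ m n x → 2 * m * n * x ≡ 2 * (m * x * n)
      shuffle = solve-∀
      sq : ∀ m x → m * x * (m * x) ≡ m * m * (x * x)
      sq = solve-∀

    -- The mean of `deviation` is exactly m²n - mn; the negative term is dropped.
    Σ-deviation : ∀ n → Σᴸ (words n) deviation ≤ m ^ n * (m * m * n)
    Σ-deviation n = +-cancelʳ-≤ (m * (n * n) * m ^ n) _ _ (begin
      Σᴸ (words n) deviation + m * (n * n) * m ^ n
        ≡⟨ cong (Σᴸ (words n) deviation +_) (sym (Σ-words-const n (m * (n * n)))) ⟩
      Σᴸ (words n) deviation + Σᴸ (words n) (λ _ → m * (n * n))
        ≡⟨ sym (Σᴸ-+ (words n) _ _) ⟩
      Σᴸ (words n) (λ v → deviation v + m * (n * n))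
        ≡⟨ Σᴸ-cong (words n) (λ v∈ → deviation-squares (words-Word n v∈)) ⟩
      Σᴸ (words n) (λ v → m * m * squares v)
        ≡⟨ Σᴸ-* (words n) (m * m) squares ⟩
      m * m * Σᴸ (words n) squares
        ≤⟨ m≤m+n _ (m * (n * m ^ n)) ⟩
      m * m * Σᴸ (words n) squares + m * (n * m ^ n)
        ≡⟨ factor m (Σᴸ (words n) squares) (n * m ^ n) ⟩
      m * (m * Σᴸ (words n) squares + n * m ^ n)
        ≡⟨ cong (m *_) (Σ-squares n) ⟩
      m * (m ^ n * (n * n + m * n))
        ≡⟨ finish m (m ^ n) n ⟩
      m ^ n * (m * m * n) + m * (n * n) * m ^ n ∎)
      where
      open ≤-Reasoning
      factor : ∀ m t p → m * m * t + m * p ≡ m * (m * t + p)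
      factor = solve-∀
      finish : ∀ m p n → m * (p * (n * n + m * n)) ≡ p * (m * m * n) + m * (n * n) * p
      finish = solve-∀

    Typical : ∀ {n} → ℕ → Vec A n → Set
    Typical h v = deviation v ≤ h * h

    Typical-count : ∀ {n h} {v : Vec A n} → Typical h v → ∀ {a} → a ∈ as → ∣ m * count a v - n ∣ ≤ h
    Typical-count {n} {h} {v} typical {a} a∈ = ≮⇒≥ λ h<d → <⇒≱ (*-mono-< h<d h<d)
      (≤-trans (Σᴸ-∈ a∈ (λ a → ∣ m * count a v - n ∣ * ∣ m * count a v - n ∣)) typical)

    atypical : ∀ n → ℕ → List (Vec A n)
    atypical n h = filter (λ v → h * h <? deviation v) (words n)

    chebyshev : ∀ n h → 4 * (m * m * n) ≤ h * h → 0 < m * m * n → length (atypical n h) * 4 ≤ m ^ n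
    chebyshev n h large pos = *-cancelʳ-≤ _ _ (m * m * n) {{>-nonZero pos}} (begin
      length (atypical n h) * 4 * (m * m * n)
        ≡⟨ *-assoc (length (atypical n h)) 4 (m * m * n) ⟩
      length (atypical n h) * (4 * (m * m * n))
        ≤⟨ *-monoʳ-≤ (length (atypical n h)) large ⟩
      length (atypical n h) * (h * h)
        ≤⟨ markov (λ v → h * h <? deviation v) (h * h) deviation (words n) <⇒≤ ⟩
      Σᴸ (words n) deviation
        ≤⟨ Σ-deviation n ⟩
      m ^ n * (m * m * n) ∎)
      where open ≤-Reasoning

    module _ {n h : ℕ} {v : Vec A n} (w : Word v) (typical : Typical h v) (φ : A → ℕ) where

      *-weight : m * weight φ v ≡ Σᴸ as (λ a → φ a * (m * count a v))
      *-weight = trans (cong (m *_) (weight-count w φ)) (trans (sym (Σᴸ-* as m _))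
        (Σᴸ-cong as λ {a} _ → swap m (φ a) (count a v)))
        where
        swap : ∀ m x y → m * (x * y) ≡ x * (m * y)
        swap = solve-∀

      Σᴸ-*ʳ : ∀ c → Σᴸ as (λ a → φ a * c) ≡ Σᴸ as φ * c
      Σᴸ-*ʳ c = trans (Σᴸ-cong as λ {a} _ → *-comm (φ a) c) (trans (Σᴸ-* as c φ) (*-comm c _))

      typical-upper : m * weight φ v ≤ Σᴸ as φ * (n + h)
      typical-upper = begin
        m * weight φ v                        ≡⟨ *-weight ⟩
        Σᴸ as (λ a → φ a * (m * count a v))   ≤⟨ Σᴸ-mono as (λ {a} a∈ → *-monoʳ-≤ (φ a)
          (≤-trans (m≤n+∣m-n∣ (m * count a v) n) (+-monoʳ-≤ n (Typical-count {v = v} typical a∈)))) ⟩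
        Σᴸ as (λ a → φ a * (n + h))           ≡⟨ Σᴸ-*ʳ (n + h) ⟩
        Σᴸ as φ * (n + h)                     ∎
        where open ≤-Reasoning

      typical-lower : Σᴸ as φ * n ≤ m * weight φ v + Σᴸ as φ * h
      typical-lower = begin
        Σᴸ as φ * n                                 ≡⟨ sym (Σᴸ-*ʳ n) ⟩
        Σᴸ as (λ a → φ a * n)                       ≤⟨ Σᴸ-mono as (λ {a} a∈ → *-monoʳ-≤ (φ a)
          (≤-trans (m≤n+∣n-m∣ n (m * count a v)) (+-monoʳ-≤ (m * count a v) (Typical-count {v = v} typical a∈)))) ⟩
        Σᴸ as (λ a → φ a * (m * count a v + h))     ≡⟨ Σᴸ-cong as (λ {a} _ → *-distribˡ-+ (φ a) _ h) ⟩
        Σᴸ as (λ a → φ a * (m * count a v) + φ a * h) ≡⟨ Σᴸ-+ as _ _ ⟩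
        _                                           ≡⟨ cong₂ _+_ (sym *-weight) (Σᴸ-*ʳ h) ⟩
        m * weight φ v + Σᴸ as φ * h                ∎
        where open ≤-Reasoning

open import Data.Integer using (+_)
open import Data.Rational as ℚ using (ℚ; 0ℚ; 1ℚ; ½; _/_; nonNegative)
import Data.Rational.Properties as ℚ
open import Data.Rational.Solver using (module +-*-Solver)
open +-*-Solver using (solve; _:=_; _:+_; _:*_; :-_; con)

-- Rational inequalities and rounded square roots

module Rationals where

  open Sums
  open import Defs

  1+x·y : ∀ x y → y ℚ.+ x ℚ.* y ≡ (1ℚ ℚ.+ x) ℚ.* y
  1+x·y = solve 2 (λ x y → y :+ x :* y := (con 1ℚ :+ x) :* y) refl

  abstract

    -- Opaque, so that `ι k` is an atom for the ring solver and its normalised fraction is never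
    -- unfolded.
    ι : ℕ → ℚ
    ι k = + k / 1

    ι-def : ∀ k → ι k ≡ + k / 1
    ι-def k = refl

    ι-0 : ι 0 ≡ 0ℚ
    ι-0 = refl

    ι-1 : ι 1 ≡ 1ℚ
    ι-1 = refl

    ι-+ : ∀ a b → ι (a ℕ.+ b) ≡ ι a ℚ.+ ι b
    ι-+ a b = fraction-+ a b 0

    ι-* : ∀ a b → ι (a ℕ.* b) ≡ ι a ℚ.* ι b
    ι-* zero    b = sym (ℚ.*-zeroˡ (ι b))
    ι-* (suc a) b = begin
      ι (b ℕ.+ a ℕ.* b)          ≡⟨ ι-+ b (a ℕ.* b) ⟩
      ι b ℚ.+ ι (a ℕ.* b)        ≡⟨ cong (ι b ℚ.+_) (ι-* a b) ⟩
      ι b ℚ.+ ι a ℚ.* ι b        ≡⟨ 1+x·y (ι a) (ι b) ⟩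
      (1ℚ ℚ.+ ι a) ℚ.* ι b       ≡⟨ cong (ℚ._* ι b) (sym (ι-+ 1 a)) ⟩
      ι (suc a) ℚ.* ι b          ∎
      where open ≡-Reasoning

    ι-mono : ∀ {a b} → a ℕ.≤ b → ι a ℚ.≤ ι b
    ι-mono {a} {b} h = fraction-≤ℕ a b 0 0 (ℕ.*-monoˡ-≤ 1 h)

    0≤ι : ∀ a → 0ℚ ℚ.≤ ι a
    0≤ι a = 0≤fraction a 0

    fraction-ι : ∀ j k → + j / suc k ≡ ι j ℚ.* (+ 1 / suc k)
    fraction-ι zero    k = trans (ℚ.0/n≡0 (suc k)) (sym (ℚ.*-zeroˡ (+ 1 / suc k)))
    fraction-ι (suc j) k = begin
      + suc j / suc k                          ≡⟨ fraction-+ 1 j k ⟩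
      + 1 / suc k ℚ.+ + j / suc k              ≡⟨ cong (+ 1 / suc k ℚ.+_) (fraction-ι j k) ⟩
      + 1 / suc k ℚ.+ ι j ℚ.* (+ 1 / suc k)    ≡⟨ 1+x·y (ι j) (+ 1 / suc k) ⟩
      (1ℚ ℚ.+ ι j) ℚ.* (+ 1 / suc k)           ≡⟨ cong (ℚ._* (+ 1 / suc k)) (sym (ι-+ 1 j)) ⟩
      ι (suc j) ℚ.* (+ 1 / suc k)              ∎
      where open ≡-Reasoning

    ι-inverse : ∀ k → ι (suc k) ℚ.* (+ 1 / suc k) ≡ 1ℚ
    ι-inverse k = trans (sym (fraction-ι (suc k) k)) (ℚ.≤-antisym
      (fraction-≤ℕ (suc k) 1 k 0 (ℕ.≤-reflexive (trans (ℕ.*-identityʳ (suc k)) (sym (ℕ.*-identityˡ (suc k))))))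
      (fraction-≤ℕ 1 (suc k) 0 k (ℕ.≤-reflexive (trans (ℕ.*-identityˡ (suc k)) (sym (ℕ.*-identityʳ (suc k)))))))

  0≤⇒≤ : ∀ {p q} → 0ℚ ℚ.≤ q ℚ.- p → p ℚ.≤ q
  0≤⇒≤ {p} {q} h = subst₂ ℚ._≤_ (ℚ.+-identityˡ p)
    (solve 2 (λ p q → (q :+ :- p) :+ p := q) refl p q) (ℚ.+-monoˡ-≤ p h)

  ≤⇒0≤ : ∀ {p q} → p ℚ.≤ q → 0ℚ ℚ.≤ q ℚ.- p
  ≤⇒0≤ {p} {q} h = subst (ℚ._≤ q ℚ.- p) (ℚ.+-inverseʳ p) (ℚ.+-monoˡ-≤ (ℚ.- p) h)

  0≤+ : ∀ {p q} → 0ℚ ℚ.≤ p → 0ℚ ℚ.≤ q → 0ℚ ℚ.≤ p ℚ.+ q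
  0≤+ = ℚ.+-mono-≤

  -- Reduces an inequality to a ring identity that writes the difference of its sides as a visibly
  -- nonnegative `e`.
  by : ∀ {p q e} → 0ℚ ℚ.≤ e → e ≡ q ℚ.- p → p ℚ.≤ q
  by h eq = 0≤⇒≤ (subst (0ℚ ℚ.≤_) eq h)

  square≤ : ∀ {p q} → p ℚ.≤ q → ℚ.- p ℚ.≤ q → p ℚ.* p ℚ.≤ q ℚ.* q
  square≤ {p} {q} h₁ h₂ = by (0≤* (≤⇒0≤ h₁) (≤⇒0≤ h₂))
    (solve 2 (λ p q → (q :+ :- p) :* (q :+ :- :- p) := q :* q :+ :- (p :* p)) refl p q)

  square-mono : ∀ {p q} → 0ℚ ℚ.≤ p → p ℚ.≤ q → p ℚ.* p ℚ.≤ q ℚ.* q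
  square-mono {p} {q} 0≤p h = *-mono 0≤p (ℚ.≤-trans 0≤p h) h h

  0≤square : ∀ p → 0ℚ ℚ.≤ p ℚ.* p
  0≤square p with ℚ.≤-total 0ℚ p
  ... | inj₁ 0≤p = 0≤* 0≤p 0≤p
  ... | inj₂ p≤0 = subst (0ℚ ℚ.≤_)
    (solve 1 (λ p → (con 0ℚ :+ :- p) :* (con 0ℚ :+ :- p) := p :* p) refl p)
    (0≤* (≤⇒0≤ p≤0) (≤⇒0≤ p≤0))

  root-≤ : ∀ {s q t} → 0ℚ ℚ.≤ t → q ℚ.≤ t ℚ.* t → s ≡ 0ℚ ⊎ s ℚ.* s ℚ.≤ q → s ℚ.≤ t
  root-≤ 0≤t q≤t² (inj₁ refl) = 0≤t
  root-≤ {s} {q} {t} 0≤t q≤t² (inj₂ s²≤q) = ℚ.≮⇒≥ λ t<s → ℚ.<-irrefl refl (ℚ.<-≤-trans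
    (ℚ.≤-<-trans (ℚ.*-monoˡ-≤-nonNeg t {{nonNegative 0≤t}} (ℚ.<⇒≤ t<s))
      (ℚ.*-monoˡ-<-pos s {{ℚ.positive (ℚ.≤-<-trans 0≤t t<s)}} t<s))
    (ℚ.≤-trans s²≤q q≤t²))

  sqrt-≤ : ∀ n {q t} → 0ℚ ℚ.≤ t → q ℚ.≤ t ℚ.* t → sqrtℚ n q ℚ.≤ t
  sqrt-≤ n {q} 0≤t q≤t² = root-≤ 0≤t q≤t² (Sum.map₁ (grid-zero n) (Root≤-maxRoot n q))

  <-sqrt : ∀ n {q t} → t ℚ.* t ℚ.≤ q → t ℚ.< + 1 / suc n ℚ.+ sqrtℚ n q
  <-sqrt n {q} {t} t²≤q = ℚ.≰⇒> λ h → ℚ.<-irrefl refl (ℚ.<-≤-trans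
    (grid-upper n q (maxRoot n q) (¬Root≤-maxRoot n q))
    (ℚ.≤-trans (square-mono (ℚ.+-mono-≤ (ℚ.<⇒≤ (0<1/suc n)) (0≤fraction (maxRoot n q) n)) h) t²≤q))

-- Distances between rational points near given cells

module GridDistance where

  open Sums using (cyc; cycDist; cyc≤; cyc≤∸; cyc-cases; closeᵇ; reachᵇ; offset; Cell)
  open Rationals
  open import Defs hiding (∣_∣)

  -- Copies the terms of the real `min`, so that `cdist` of the approximations is definitionally a
  -- term of `circleDist`.
  minℚ : ℚ → ℚ → ℚ
  minℚ p q = ½ ℚ.* ((p ℚ.+ q) ℚ.- ℚ.∣ p ℚ.- q ∣)

  minℚ-cases : ∀ p q → (minℚ p q ≡ p × p ℚ.≤ q) ⊎ (minℚ p q ≡ q × q ℚ.≤ p)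
  minℚ-cases p q with ℚ.≤-total p q
  ... | inj₁ p≤q = inj₁ (trans
    (cong (λ z → ½ ℚ.* ((p ℚ.+ q) ℚ.- z)) (trans (∣-∣-sym p q) (ℚ.0≤p⇒∣p∣≡p (≤⇒0≤ p≤q))))
    (solve 2 (λ p q → con ½ :* ((p :+ q) :+ :- (q :+ :- p)) := p) refl p q) , p≤q)
  ... | inj₂ q≤p = inj₂ (trans
    (cong (λ z → ½ ℚ.* ((p ℚ.+ q) ℚ.- z)) (ℚ.0≤p⇒∣p∣≡p (≤⇒0≤ q≤p)))
    (solve 2 (λ p q → con ½ :* ((p :+ q) :+ :- (p :+ :- q)) := q) refl p q) , q≤p)

  cdist : ℚ → ℚ → ℚ
  cdist x y = minℚ ℚ.∣ x ℚ.- y ∣ (1ℚ ℚ.- ℚ.∣ x ℚ.- y ∣)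

  cdist-sym : ∀ x y → cdist x y ≡ cdist y x
  cdist-sym x y = cong (λ d → minℚ d (1ℚ ℚ.- d)) (∣-∣-sym x y)

  ¼ : ℚ
  ¼ = ½ ℚ.* ½

  module Grid (M L ρ : ℕ) (u : ℚ) (0<u : 0ℚ ℚ.< u) (LMu : ι (L ℕ.* M) ℚ.* u ≡ 1ℚ) where

    0≤u : 0ℚ ℚ.≤ u
    0≤u = ℚ.<⇒≤ 0<u

    0≤ι*u : ∀ k → 0ℚ ℚ.≤ ι k ℚ.* u
    0≤ι*u k = 0≤* (0≤ι k) 0≤u

    ι*u-mono : ∀ {a b} → a ℕ.≤ b → ι a ℚ.* u ℚ.≤ ι b ℚ.* u
    ι*u-mono h = ℚ.*-monoʳ-≤-nonNeg u {{nonNegative 0≤u}} (ι-mono h)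

    -- The tolerance of half a unit leaves room for the inflation of the boxes and for the error of
    -- a rational approximation.
    Near : ℕ → ℚ → Set
    Near i x = ι (L ℕ.* i) ℚ.* u ℚ.≤ x ℚ.+ ½ ℚ.* u × x ℚ.≤ ι (L ℕ.* suc i) ℚ.* u ℚ.+ ½ ℚ.* u

    Apart : ℕ → ℚ → Set
    Apart k d = d ℚ.≤ ι (L ℕ.* k ℕ.+ suc L) ℚ.* u × ι (L ℕ.* k) ℚ.* u ℚ.≤ d ℚ.+ ι (suc L) ℚ.* u

    apart-+ : ∀ i k {x y} → Near i x → Near (i ℕ.+ k) y → Apart k ℚ.∣ x ℚ.- y ∣
    apart-+ i k {x} {y} (x₁ , x₂) (y₁ , y₂) =
        subst (λ z → ℚ.∣ x ℚ.- y ∣ ℚ.≤ z ℚ.* u) (sym eK)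
          (∣∣-≤ (upper₁ A K l u x y 0≤Ku x₂′ y₁′) (upper₂ A K l u x y x₁ y₂′))
      , subst (λ z → K ℚ.* u ℚ.≤ ℚ.∣ x ℚ.- y ∣ ℚ.+ z ℚ.* u) (sym eL)
          (ℚ.≤-trans (lower A K l u x y x₂′ y₁′)
            (ℚ.+-monoˡ-≤ ((1ℚ ℚ.+ l) ℚ.* u)
              (ℚ.≤-trans (p≤∣p∣ (y ℚ.- x)) (ℚ.≤-reflexive (∣-∣-sym y x)))))
      where
      A K l : ℚ
      A = ι (L ℕ.* i)
      K = ι (L ℕ.* k)
      l = ι L
      eL : ι (suc L) ≡ 1ℚ ℚ.+ l
      eL = trans (ι-+ 1 L) (cong (ℚ._+ l) ι-1)
      eK : ι (L ℕ.* k ℕ.+ suc L) ≡ K ℚ.+ (1ℚ ℚ.+ l)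
      eK = trans (ι-+ (L ℕ.* k) (suc L)) (cong (K ℚ.+_) eL)
      eS : ∀ i → ι (L ℕ.* suc i) ≡ l ℚ.+ ι (L ℕ.* i)
      eS i = trans (cong ι (ℕ.*-suc L i)) (ι-+ L (L ℕ.* i))
      eA : ι (L ℕ.* (i ℕ.+ k)) ≡ A ℚ.+ K
      eA = trans (cong ι (ℕ.*-distribˡ-+ L i k)) (ι-+ (L ℕ.* i) (L ℕ.* k))
      0≤Ku : 0ℚ ℚ.≤ K ℚ.* u
      0≤Ku = 0≤ι*u (L ℕ.* k)
      x₂′ : x ℚ.≤ (l ℚ.+ A) ℚ.* u ℚ.+ ½ ℚ.* u
      x₂′ = subst (λ z → x ℚ.≤ z ℚ.* u ℚ.+ ½ ℚ.* u) (eS i) x₂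
      y₁′ : (A ℚ.+ K) ℚ.* u ℚ.≤ y ℚ.+ ½ ℚ.* u
      y₁′ = subst (λ z → z ℚ.* u ℚ.≤ y ℚ.+ ½ ℚ.* u) eA y₁
      y₂′ : y ℚ.≤ (l ℚ.+ (A ℚ.+ K)) ℚ.* u ℚ.+ ½ ℚ.* u
      y₂′ = subst (λ z → y ℚ.≤ z ℚ.* u ℚ.+ ½ ℚ.* u) (trans (eS (i ℕ.+ k)) (cong (l ℚ.+_) eA)) y₂
      upper₁ : ∀ A K l u x y → 0ℚ ℚ.≤ K ℚ.* u → x ℚ.≤ (l ℚ.+ A) ℚ.* u ℚ.+ ½ ℚ.* u →
        (A ℚ.+ K) ℚ.* u ℚ.≤ y ℚ.+ ½ ℚ.* u → x ℚ.- y ℚ.≤ (K ℚ.+ (1ℚ ℚ.+ l)) ℚ.* u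
      upper₁ A K l u x y h₀ h₁ h₂ = by (0≤+ (0≤+ h₀ h₀) (0≤+ (≤⇒0≤ h₁) (≤⇒0≤ h₂)))
        (solve 6 (λ A K l u x y →
          (K :* u :+ K :* u) :+ ((((l :+ A) :* u :+ con ½ :* u) :+ :- x) :+ ((y :+ con ½ :* u) :+ :- ((A :+ K) :* u)))
          := (K :+ (con 1ℚ :+ l)) :* u :+ :- (x :+ :- y)) refl A K l u x y)
      upper₂ : ∀ A K l u x y → A ℚ.* u ℚ.≤ x ℚ.+ ½ ℚ.* u →
        y ℚ.≤ (l ℚ.+ (A ℚ.+ K)) ℚ.* u ℚ.+ ½ ℚ.* u → ℚ.- (x ℚ.- y) ℚ.≤ (K ℚ.+ (1ℚ ℚ.+ l)) ℚ.* u
      upper₂ A K l u x y h₁ h₂ = by (0≤+ (≤⇒0≤ h₁) (≤⇒0≤ h₂))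
        (solve 6 (λ A K l u x y →
          ((x :+ con ½ :* u) :+ :- (A :* u)) :+ (((l :+ (A :+ K)) :* u :+ con ½ :* u) :+ :- y)
          := (K :+ (con 1ℚ :+ l)) :* u :+ :- (:- (x :+ :- y))) refl A K l u x y)
      lower : ∀ A K l u x y → x ℚ.≤ (l ℚ.+ A) ℚ.* u ℚ.+ ½ ℚ.* u →
        (A ℚ.+ K) ℚ.* u ℚ.≤ y ℚ.+ ½ ℚ.* u → K ℚ.* u ℚ.≤ (y ℚ.- x) ℚ.+ (1ℚ ℚ.+ l) ℚ.* u
      lower A K l u x y h₁ h₂ = by (0≤+ (≤⇒0≤ h₁) (≤⇒0≤ h₂))
        (solve 6 (λ A K l u x y →
          (((l :+ A) :* u :+ con ½ :* u) :+ :- x) :+ ((y :+ con ½ :* u) :+ :- ((A :+ K) :* u))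
          := ((y :+ :- x) :+ (con 1ℚ :+ l) :* u) :+ :- (K :* u)) refl A K l u x y)

    apart : ∀ i j {x y} → Near i x → Near j y → Apart ∣ i - j ∣ ℚ.∣ x ℚ.- y ∣
    apart i j {x} {y} hx hy with ℕ.≤-total i j
    ... | inj₁ i≤j = subst (λ k → Apart k ℚ.∣ x ℚ.- y ∣) (sym (ℕ.m≤n⇒∣m-n∣≡n∸m i≤j))
      (apart-+ i (j ∸ i) hx (subst (λ k → Near k y) (sym (ℕ.m+[n∸m]≡n i≤j)) hy))
    ... | inj₂ j≤i = subst₂ Apart (sym (trans (ℕ.∣-∣-comm i j) (ℕ.m≤n⇒∣m-n∣≡n∸m j≤i))) (∣-∣-sym y x)
      (apart-+ j (i ∸ j) hy (subst (λ k → Near k x) (sym (ℕ.m+[n∸m]≡n j≤i)) hx))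

    complement : ∀ {k} → k ℕ.≤ M → ι (L ℕ.* k) ℚ.* u ℚ.+ ι (L ℕ.* (M ∸ k)) ℚ.* u ≡ 1ℚ
    complement {k} k≤M = trans (sym (ℚ.*-distribʳ-+ u (ι (L ℕ.* k)) (ι (L ℕ.* (M ∸ k)))))
      (trans (cong (ℚ._* u) (trans (sym (ι-+ (L ℕ.* k) (L ℕ.* (M ∸ k))))
        (cong ι (trans (sym (ℕ.*-distribˡ-+ L k (M ∸ k))) (cong (L ℕ.*_) (ℕ.m+[n∸m]≡n k≤M))))))
      LMu)

    -- As `M` cells have total length 1, the reflection exchanges the two bounds. It reduces the
    -- distance around the circle to the direct one.
    apart-1- : ∀ {k d} → k ℕ.≤ M → Apart k d → Apart (M ∸ k) (1ℚ ℚ.- d)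
    apart-1- {k} {d} k≤M (h₁ , h₂) =
        subst (λ z → 1ℚ ℚ.- d ℚ.≤ z ℚ.* u) (sym (ι-+ (L ℕ.* (M ∸ k)) (suc L)))
          (flip-upper (ι (L ℕ.* k)) (ι (L ℕ.* (M ∸ k))) (ι (suc L)) u d 1ℚ (complement k≤M) h₂)
      , flip-lower (ι (L ℕ.* k)) (ι (L ℕ.* (M ∸ k))) (ι (suc L)) u d 1ℚ (complement k≤M)
          (subst (λ z → d ℚ.≤ z ℚ.* u) (ι-+ (L ℕ.* k) (suc L)) h₁)
      where
      flip-upper : ∀ K E l u d o → K ℚ.* u ℚ.+ E ℚ.* u ≡ o → K ℚ.* u ℚ.≤ d ℚ.+ l ℚ.* u →
        o ℚ.- d ℚ.≤ (E ℚ.+ l) ℚ.* u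
      flip-upper K E l u d _ refl h = by (≤⇒0≤ h)
        (solve 5 (λ K E l u d → (d :+ l :* u) :+ :- (K :* u)
          := (E :+ l) :* u :+ :- ((K :* u :+ E :* u) :+ :- d)) refl K E l u d)
      flip-lower : ∀ K E l u d o → K ℚ.* u ℚ.+ E ℚ.* u ≡ o → d ℚ.≤ (K ℚ.+ l) ℚ.* u →
        E ℚ.* u ℚ.≤ (o ℚ.- d) ℚ.+ l ℚ.* u
      flip-lower K E l u d _ refl h = by (≤⇒0≤ h)
        (solve 5 (λ K E l u d → (K :+ l) :* u :+ :- d
          := (((K :* u :+ E :* u) :+ :- d) :+ l :* u) :+ :- (E :* u)) refl K E l u d)

    -- Approximations of points of [0 , 1) may leave that interval, so `cdist` can be slightly
    -- negative; bounding its square takes bounds on both signs.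
    cdist-upper : ∀ {k} x y → k ℕ.≤ M → Apart k ℚ.∣ x ℚ.- y ∣ →
      cdist x y ℚ.≤ ι (L ℕ.* cyc M k ℕ.+ suc L) ℚ.* u × ℚ.- cdist x y ℚ.≤ ι (L ℕ.* cyc M k ℕ.+ suc L) ℚ.* u
    cdist-upper {k} x y k≤M h = upper , lower
      where
      d : ℚ
      d = ℚ.∣ x ℚ.- y ∣
      h′ : Apart (M ∸ k) (1ℚ ℚ.- d)
      h′ = apart-1- k≤M h
      ≤d : cdist x y ℚ.≤ d
      ≤d with minℚ-cases d (1ℚ ℚ.- d)
      ... | inj₁ (eq , _) = ℚ.≤-reflexive eq
      ... | inj₂ (eq , le) = ℚ.≤-trans (ℚ.≤-reflexive eq) le
      ≤1-d : cdist x y ℚ.≤ 1ℚ ℚ.- d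
      ≤1-d with minℚ-cases d (1ℚ ℚ.- d)
      ... | inj₁ (eq , le) = ℚ.≤-trans (ℚ.≤-reflexive eq) le
      ... | inj₂ (eq , _) = ℚ.≤-reflexive eq
      upper : cdist x y ℚ.≤ ι (L ℕ.* cyc M k ℕ.+ suc L) ℚ.* u
      upper with cyc-cases M k
      ... | inj₁ (eq , _) rewrite eq = ℚ.≤-trans ≤d (proj₁ h)
      ... | inj₂ (eq , _) rewrite eq = ℚ.≤-trans ≤1-d (proj₁ h′)
      small : ι (suc L) ℚ.* u ℚ.≤ ι (L ℕ.* cyc M k ℕ.+ suc L) ℚ.* u
      small = ι*u-mono (ℕ.m≤n+m (suc L) (L ℕ.* cyc M k))
      neg : ∀ {p q} → 0ℚ ℚ.≤ p ℚ.+ q → ℚ.- p ℚ.≤ q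
      neg {p} {q} h = by h (solve 2 (λ p q → p :+ q := q :+ :- :- p) refl p q)
      lower : ℚ.- cdist x y ℚ.≤ ι (L ℕ.* cyc M k ℕ.+ suc L) ℚ.* u
      lower with minℚ-cases d (1ℚ ℚ.- d)
      ... | inj₁ (eq , _) = subst (λ z → ℚ.- z ℚ.≤ _) (sym eq)
        (ℚ.≤-trans (neg (ℚ.≤-trans (0≤ι*u (L ℕ.* k)) (proj₂ h))) small)
      ... | inj₂ (eq , _) = subst (λ z → ℚ.- z ℚ.≤ _) (sym eq)
        (ℚ.≤-trans (neg (ℚ.≤-trans (0≤ι*u (L ℕ.* (M ∸ k))) (proj₂ h′))) small)

    cdist-lower : ∀ {k} x y → k ℕ.≤ M → Apart k ℚ.∣ x ℚ.- y ∣ →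
      ι (L ℕ.* cyc M k) ℚ.* u ℚ.≤ cdist x y ℚ.+ ι (suc L) ℚ.* u
    cdist-lower {k} x y k≤M h with minℚ-cases ℚ.∣ x ℚ.- y ∣ (1ℚ ℚ.- ℚ.∣ x ℚ.- y ∣)
    ... | inj₁ (eq , _) = subst (λ z → _ ℚ.≤ z ℚ.+ ι (suc L) ℚ.* u) (sym eq)
      (ℚ.≤-trans (ι*u-mono (ℕ.*-monoʳ-≤ L (cyc≤ M k))) (proj₂ h))
    ... | inj₂ (eq , _) = subst (λ z → _ ℚ.≤ z ℚ.+ ι (suc L) ℚ.* u) (sym eq)
      (ℚ.≤-trans (ι*u-mono (ℕ.*-monoʳ-≤ L (cyc≤∸ M k))) (proj₂ (apart-1- k≤M h)))

    ι²u² : ∀ a → ι a ℚ.* u ℚ.* (ι a ℚ.* u) ≡ ι (a ℕ.* a) ℚ.* (u ℚ.* u)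
    ι²u² a = trans (solve 2 (λ a u → a :* u :* (a :* u) := a :* a :* (u :* u)) refl (ι a) u)
      (cong (ℚ._* (u ℚ.* u)) (sym (ι-* a a)))

    sum-squares : ∀ a b → ι (a ℕ.* a ℕ.+ b ℕ.* b) ℚ.* (u ℚ.* u) ≡
      ι a ℚ.* u ℚ.* (ι a ℚ.* u) ℚ.+ ι b ℚ.* u ℚ.* (ι b ℚ.* u)
    sum-squares a b = trans (cong (ℚ._* (u ℚ.* u)) (ι-+ (a ℕ.* a) (b ℕ.* b)))
      (trans (ℚ.*-distribʳ-+ (u ℚ.* u) (ι (a ℕ.* a)) (ι (b ℕ.* b)))
        (sym (cong₂ ℚ._+_ (ι²u² a) (ι²u² b))))

    ι*u²-mono : ∀ {a b} → a ℕ.≤ b → ι a ℚ.* (u ℚ.* u) ℚ.≤ ι b ℚ.* (u ℚ.* u)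
    ι*u²-mono h = ℚ.*-monoʳ-≤-nonNeg (u ℚ.* u) {{nonNegative (0≤* 0≤u 0≤u)}} (ι-mono h)

    square-upper : ∀ {k} x y → k ℕ.≤ M → Apart k ℚ.∣ x ℚ.- y ∣ → let b = ι (L ℕ.* cyc M k ℕ.+ suc L) ℚ.* u in
      cdist x y ℚ.* cdist x y ℚ.≤ b ℚ.* b
    square-upper x y k≤M h = square≤ (proj₁ (cdist-upper x y k≤M h)) (proj₂ (cdist-upper x y k≤M h))

    square-lower : ∀ {k} x y → k ℕ.≤ M → Apart k ℚ.∣ x ℚ.- y ∣ → let a = ι (L ℕ.* cyc M k ∸ suc L) ℚ.* u in
      a ℚ.* a ℚ.≤ cdist x y ℚ.* cdist x y
    square-lower {k} x y k≤M h with ℕ.≤-total (suc L) (L ℕ.* cyc M k)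
    ... | inj₁ le = square-mono (0≤ι*u (L ℕ.* cyc M k ∸ suc L))
      (cancel (ι (L ℕ.* cyc M k ∸ suc L)) (ι (suc L)) u (cdist x y)
        (subst (λ z → z ℚ.* u ℚ.≤ cdist x y ℚ.+ ι (suc L) ℚ.* u)
          (trans (cong ι (sym (ℕ.m∸n+n≡m le))) (ι-+ (L ℕ.* cyc M k ∸ suc L) (suc L)))
          (cdist-lower x y k≤M h)))
      where
      cancel : ∀ a l u c → (a ℚ.+ l) ℚ.* u ℚ.≤ c ℚ.+ l ℚ.* u → a ℚ.* u ℚ.≤ c
      cancel a l u c h = by (≤⇒0≤ h)
        (solve 4 (λ a l u c → (c :+ l :* u) :+ :- ((a :+ l) :* u) := c :+ :- (a :* u)) refl a l u c)
    -- For such small offsets the truncated difference is 0, and nonnegativity of squares is all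
    -- that is claimed.
    ... | inj₂ le rewrite ℕ.m≤n⇒m∸n≡0 le = subst (λ z → z ℚ.* z ℚ.≤ cdist x y ℚ.* cdist x y)
      (sym (trans (cong (ℚ._* u) ι-0) (ℚ.*-zeroˡ u))) (0≤square (cdist x y))

    tdist² : ℚ × ℚ → ℚ × ℚ → ℚ
    tdist² (x₁ , x₂) (y₁ , y₂) = cdist x₁ y₁ ℚ.* cdist x₁ y₁ ℚ.+ cdist x₂ y₂ ℚ.* cdist x₂ y₂

    Near² : Cell → ℚ × ℚ → Set
    Near² (i , j) (x , y) = Near i x × Near j y

    InGrid : Cell → Set
    InGrid (i , j) = i ℕ.< M × j ℕ.< M

    ∣-∣≤M : ∀ {i j} → i ℕ.< M → j ℕ.< M → ∣ i - j ∣ ℕ.≤ M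
    ∣-∣≤M {i} {j} i<M j<M = ℕ.≤-trans (ℕ.∣m-n∣≤m⊔n i j) (ℕ.⊔-lub (ℕ.<⇒≤ i<M) (ℕ.<⇒≤ j<M))

    close-tdist² : ∀ a b {x y} → InGrid a → InGrid b → Near² a x → Near² b y →
      offset M (closeᵇ L ρ) a b ≡ true → tdist² x y ℚ.≤ ι ρ ℚ.* u ℚ.* (ι ρ ℚ.* u)
    close-tdist² (i , j) (k , l) {x₁ , x₂} {y₁ , y₂} (i< , j<) (k< , l<) (hx₁ , hx₂) (hy₁ , hy₂) h =
      ℚ.≤-trans (ℚ.+-mono-≤ (square-upper x₁ y₁ (∣-∣≤M i< k<) (apart i k hx₁ hy₁))
                            (square-upper x₂ y₂ (∣-∣≤M j< l<) (apart j l hx₂ hy₂)))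
        (subst₂ ℚ._≤_ (sum-squares (L ℕ.* cycDist M i k ℕ.+ suc L) (L ℕ.* cycDist M j l ℕ.+ suc L)) (sym (ι²u² ρ))
          (ι*u²-mono (ℕ.≤ᵇ⇒≤ _ (ρ ℕ.* ρ) (subst T (sym h) tt))))

    far-tdist² : ∀ a b {x y} → InGrid a → InGrid b → Near² a x → Near² b y →
      offset M (reachᵇ L ρ) a b ≡ false → ι (suc ρ) ℚ.* u ℚ.* (ι (suc ρ) ℚ.* u) ℚ.≤ tdist² x y
    far-tdist² (i , j) (k , l) {x₁ , x₂} {y₁ , y₂} (i< , j<) (k< , l<) (hx₁ , hx₂) (hy₁ , hy₂) h =
      ℚ.≤-trans
        (subst₂ ℚ._≤_ (sym (ι²u² (suc ρ)))
          (sum-squares (L ℕ.* cycDist M i k ∸ suc L) (L ℕ.* cycDist M j l ∸ suc L))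
          (ι*u²-mono {suc ρ ℕ.* suc ρ} (ℕ.≮⇒≥ λ lt → subst T h (ℕ.<⇒<ᵇ lt))))
        (ℚ.+-mono-≤ (square-lower x₁ y₁ (∣-∣≤M i< k<) (apart i k hx₁ hy₁))
                    (square-lower x₂ y₂ (∣-∣≤M j< l<) (apart j l hx₂ hy₂)))

-- From rational approximations to points of the torus

module RealDistance where

  open Sums using (closeᵇ; reachᵇ; offset; Cell)
  open Rationals
  open GridDistance
  open import Defs hiding (∣_∣)

  √-cong : ∀ s t r → (∀ n → seq s n ≡ seq t n) → √ s ≤ r → √ t ≤ r
  √-cong s t r eq h ε 0<ε = proj₁ (h ε 0<ε) , λ n n≥N →
    subst (λ z → sqrtℚ n z ℚ.≤ seq r n ℚ.+ ε) (eq n) (proj₂ (h ε 0<ε) n n≥N)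

  √≤ : ∀ s t → 0ℚ ℚ.≤ t → (∃ λ N → ∀ n → N ℕ.≤ n → seq s n ℚ.≤ t ℚ.* t) → √ s ≤ fromℚ t
  √≤ s t 0≤t (N , h) ε 0<ε = N , λ n n≥N → ℚ.≤-trans (sqrt-≤ n 0≤t (h n n≥N)) (≤+ t ε (ℚ.<⇒≤ 0<ε))
    where
    ≤+ : ∀ p e → 0ℚ ℚ.≤ e → p ℚ.≤ p ℚ.+ e
    ≤+ p e h = by h (solve 2 (λ p e → e := (p :+ e) :+ :- p) refl p e)

  -- The order on reals tolerates every positive error, so refuting it takes a gap. The gap `u`
  -- comes from `suc ρ` in `reachᵇ`; one half beats the tolerance, the other the rounding of
  -- `sqrtℚ`.
  √≰ : ∀ s t u → 0ℚ ℚ.< u → (∃ λ N → ∀ n → N ℕ.≤ n → (t ℚ.+ u) ℚ.* (t ℚ.+ u) ℚ.≤ seq s n) →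
    ¬ (√ s ≤ fromℚ t)
  √≰ s t u 0<u (N₁ , h₁) le = combine (le (½ ℚ.* u) (0<½* 0<u)) (archimedean (½ ℚ.* u) (0<½* 0<u))
    where
    absurd : ∀ r u w s → r ℚ.+ u ℚ.< w ℚ.+ s → s ℚ.≤ r ℚ.+ ½ ℚ.* u → w ℚ.< ½ ℚ.* u → ⊥
    absurd r u w s h₁ h₂ h₃ = ℚ.<-irrefl
      (solve 2 (λ r u → r :+ u := con ½ :* u :+ (r :+ con ½ :* u)) refl r u)
      (ℚ.<-trans h₁ (ℚ.+-mono-<-≤ h₃ h₂))
    combine : (∃ λ N → ∀ n → N ℕ.≤ n → sqrtℚ n (seq s n) ℚ.≤ t ℚ.+ ½ ℚ.* u) →
      (∃ λ N → ∀ n → N ℕ.≤ n → + 1 / suc n ℚ.< ½ ℚ.* u) → ⊥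
    combine (N₂ , h₂) (N₃ , h₃) = absurd t u (+ 1 / suc n) (sqrtℚ n (seq s n))
      (<-sqrt n (h₁ n (ℕ.m⊔n≤o⇒m≤o N₁ (N₂ ℕ.⊔ N₃) n≥)))
      (h₂ n (ℕ.m⊔n≤o⇒m≤o N₂ N₃ (ℕ.m⊔n≤o⇒n≤o N₁ (N₂ ℕ.⊔ N₃) n≥)))
      (h₃ n (ℕ.m⊔n≤o⇒n≤o N₂ N₃ (ℕ.m⊔n≤o⇒n≤o N₁ (N₂ ℕ.⊔ N₃) n≥)))
      where
      n : ℕ
      n = N₁ ℕ.⊔ (N₂ ℕ.⊔ N₃)
      n≥ : N₁ ℕ.⊔ (N₂ ℕ.⊔ N₃) ℕ.≤ n
      n≥ = ℕ.≤-refl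

  dist² : Torus → Torus → ℝ
  dist² (x₁ , x₂) (y₁ , y₂) = circleDist x₁ y₁ * circleDist x₁ y₁ + circleDist x₂ y₂ * circleDist x₂ y₂

  at : Torus → ℕ → ℚ × ℚ
  at (x , y) n = seq (rep x) n , seq (rep y) n

  torusDist-sym : ∀ p q {r} → torusDist p q ≤ r → torusDist q p ≤ r
  torusDist-sym p@(x₁ , x₂) q@(y₁ , y₂) {r} = √-cong (dist² p q) (dist² q p) r λ n →
    cong₂ (λ c d → c ℚ.* c ℚ.+ d ℚ.* d)
      (cdist-sym (seq (rep x₁) n) (seq (rep y₁) n)) (cdist-sym (seq (rep x₂) n) (seq (rep y₂) n))

  module Location (M L ρ : ℕ) (u : ℚ) (0<u : 0ℚ ℚ.< u) (LMu : ι (L ℕ.* M) ℚ.* u ≡ 1ℚ) where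

    open Grid M L ρ u 0<u LMu

    radius : ℝ
    radius = fromℚ (ι ρ ℚ.* u)

    EventuallyNear : Cell → Torus → Set
    EventuallyNear a p = ∃ λ N → ∀ n → N ℕ.≤ n → Near² a (at p n)

    close⇒≤ : ∀ {a b p q} → InGrid a → InGrid b → EventuallyNear a p → EventuallyNear b q →
      offset M (closeᵇ L ρ) a b ≡ true → torusDist p q ≤ radius
    close⇒≤ {a} {b} {p} {q} ha hb (N₁ , h₁) (N₂ , h₂) close =
      √≤ (dist² p q) (ι ρ ℚ.* u) (0≤ι*u ρ) (N₁ ℕ.⊔ N₂ , λ n n≥ →
        close-tdist² a b {at p n} {at q n} ha hb
          (h₁ n (ℕ.m⊔n≤o⇒m≤o N₁ N₂ n≥)) (h₂ n (ℕ.m⊔n≤o⇒n≤o N₁ N₂ n≥)) close)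

    far⇒≰ : ∀ {a b p q} → InGrid a → InGrid b → EventuallyNear a p → EventuallyNear b q →
      offset M (reachᵇ L ρ) a b ≡ false → ¬ (torusDist p q ≤ radius)
    far⇒≰ {a} {b} {p} {q} ha hb (N₁ , h₁) (N₂ , h₂) far =
      √≰ (dist² p q) (ι ρ ℚ.* u) u 0<u (N₁ ℕ.⊔ N₂ , λ n n≥ →
        subst (λ z → z ℚ.* z ℚ.≤ tdist² (at p n) (at q n)) ι-suc
          (far-tdist² a b {at p n} {at q n} ha hb
            (h₁ n (ℕ.m⊔n≤o⇒m≤o N₁ N₂ n≥)) (h₂ n (ℕ.m⊔n≤o⇒n≤o N₁ N₂ n≥)) far))
      where
      ι-suc : ι (suc ρ) ℚ.* u ≡ ι ρ ℚ.* u ℚ.+ u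
      ι-suc = trans (cong (ℚ._* u) (trans (ι-+ 1 ρ) (cong (ℚ._+ ι ρ) ι-1)))
        (solve 2 (λ r u → (con 1ℚ :+ r) :* u := r :* u :+ u) refl (ι ρ) u)

    module Inflated (η : ℚ) (0<η : 0ℚ ℚ.< η) (η≤¼ : η ℚ.≤ ¼) where

      0<ηu : 0ℚ ℚ.< η ℚ.* u
      0<ηu = 0<* 0<η 0<u

      0≤ηu : 0ℚ ℚ.≤ η ℚ.* u
      0≤ηu = ℚ.<⇒≤ 0<ηu

      -- Neighbouring intervals overlap, so that a sufficiently good rational approximation of a
      -- real determines an interval containing it.
      interval : ℕ → Interval
      interval i = record
        { lo = (ι (L ℕ.* i) ℚ.- η) ℚ.* u
        ; hi = (ι (L ℕ.* suc i) ℚ.+ η) ℚ.* u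
        ; lo≤hi = by (0≤+ (≤⇒0≤ (ι*u-mono (ℕ.*-monoʳ-≤ L (ℕ.n≤1+n i)))) (0≤+ 0≤ηu 0≤ηu))
            (eq (ι (L ℕ.* i)) (ι (L ℕ.* suc i)) η u)
        }
        where
        eq : ∀ a b η u → (b ℚ.* u ℚ.- a ℚ.* u) ℚ.+ (η ℚ.* u ℚ.+ η ℚ.* u) ≡ (b ℚ.+ η) ℚ.* u ℚ.- (a ℚ.- η) ℚ.* u
        eq = solve 4 (λ a b η u → (b :* u :+ :- (a :* u)) :+ (η :* u :+ η :* u)
          := (b :+ η) :* u :+ :- ((a :+ :- η) :* u)) refl

      length-interval : ∀ i → length (interval i) ≡ (ι L ℚ.+ (η ℚ.+ η)) ℚ.* u
      length-interval i = trans
        (cong (λ z → (z ℚ.+ η) ℚ.* u ℚ.- (ι (L ℕ.* i) ℚ.- η) ℚ.* u)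
          (trans (cong ι (ℕ.*-suc L i)) (ι-+ L (L ℕ.* i))))
        (eq (ι (L ℕ.* i)) (ι L) η u)
        where
        eq : ∀ a l η u → ((l ℚ.+ a) ℚ.+ η) ℚ.* u ℚ.- (a ℚ.- η) ℚ.* u ≡ (l ℚ.+ (η ℚ.+ η)) ℚ.* u
        eq = solve 4 (λ a l η u → ((l :+ a) :+ η) :* u :+ :- ((a :+ :- η) :* u) := (l :+ (η :+ η)) :* u) refl

      near-interval : ∀ {x} i → x ∈ᴵ interval i → ∃ λ N → ∀ n → N ℕ.≤ n → Near i (seq (rep x) n)
      -- A quarter unit of tolerance, plus an inflation of at most a quarter, stays within the half
      -- unit of `Near`.
      near-interval {x} i (h₁ , h₂) = combine (h₁ (¼ ℚ.* u) 0<¼u) (h₂ (¼ ℚ.* u) 0<¼u)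
        where
        0<¼u : 0ℚ ℚ.< ¼ ℚ.* u
        0<¼u = 0<* (0<* (0<1/suc 1) (0<1/suc 1)) 0<u
        slack : 0ℚ ℚ.≤ ¼ ℚ.* u ℚ.- η ℚ.* u
        slack = ≤⇒0≤ (ℚ.*-monoʳ-≤-nonNeg u {{nonNegative 0≤u}} η≤¼)
        below : ∀ a η u x → 0ℚ ℚ.≤ ¼ ℚ.* u ℚ.- η ℚ.* u → (a ℚ.- η) ℚ.* u ℚ.≤ x ℚ.+ ¼ ℚ.* u →
          a ℚ.* u ℚ.≤ x ℚ.+ ½ ℚ.* u
        below a η u x s h = by (0≤+ s (≤⇒0≤ h))
          (solve 4 (λ a η u x → (con ¼ :* u :+ :- (η :* u)) :+ ((x :+ con ¼ :* u) :+ :- ((a :+ :- η) :* u))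
            := (x :+ con ½ :* u) :+ :- (a :* u)) refl a η u x)
        above : ∀ b η u x → 0ℚ ℚ.≤ ¼ ℚ.* u ℚ.- η ℚ.* u → x ℚ.≤ (b ℚ.+ η) ℚ.* u ℚ.+ ¼ ℚ.* u →
          x ℚ.≤ b ℚ.* u ℚ.+ ½ ℚ.* u
        above b η u x s h = by (0≤+ s (≤⇒0≤ h))
          (solve 4 (λ b η u x → (con ¼ :* u :+ :- (η :* u)) :+ (((b :+ η) :* u :+ con ¼ :* u) :+ :- x)
            := (b :* u :+ con ½ :* u) :+ :- x) refl b η u x)
        combine : (∃ λ N → ∀ n → N ℕ.≤ n → (ι (L ℕ.* i) ℚ.- η) ℚ.* u ℚ.≤ seq (rep x) n ℚ.+ ¼ ℚ.* u) →
          (∃ λ N → ∀ n → N ℕ.≤ n → seq (rep x) n ℚ.≤ (ι (L ℕ.* suc i) ℚ.+ η) ℚ.* u ℚ.+ ¼ ℚ.* u) →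
          ∃ λ N → ∀ n → N ℕ.≤ n → Near i (seq (rep x) n)
        combine (N₁ , h₁) (N₂ , h₂) = N₁ ℕ.⊔ N₂ , λ n n≥ →
            below (ι (L ℕ.* i)) η u (seq (rep x) n) slack (h₁ n (ℕ.m⊔n≤o⇒m≤o N₁ N₂ n≥))
          , above (ι (L ℕ.* suc i)) η u (seq (rep x) n) slack (h₂ n (ℕ.m⊔n≤o⇒n≤o N₁ N₂ n≥))

      minus : ∀ {p q} → p ℚ.≤ q → p ℚ.- ½ ℚ.* (η ℚ.* u) ℚ.≤ q
      minus {p} h = ℚ.≤-trans
        (by (ℚ.<⇒≤ (0<½* 0<ηu)) (solve 2 (λ p e → e := p :+ :- (p :+ :- e)) refl p (½ ℚ.* (η ℚ.* u)))) h

      -- A downward search by decidable rational comparisons. The lower bound is loosened because an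
      -- approximation of a point near 0 may be negative.
      slot : ∀ k q → ℚ.- (½ ℚ.* (η ℚ.* u)) ℚ.≤ q → q ℚ.< ι (L ℕ.* suc k) ℚ.* u →
        ∃ λ i → i ℕ.< suc k × ι (L ℕ.* i) ℚ.* u ℚ.- ½ ℚ.* (η ℚ.* u) ℚ.≤ q × q ℚ.≤ ι (L ℕ.* suc i) ℚ.* u
      slot zero q lower upper = 0 , ℕ.≤-refl
        , subst (ℚ._≤ q) (sym (trans (cong (λ z → z ℚ.* u ℚ.- ½ ℚ.* (η ℚ.* u)) (trans (cong ι (ℕ.*-zeroʳ L)) ι-0))
            (zero-eq η u))) lower
        , ℚ.<⇒≤ upper
        where
        zero-eq : ∀ η u → 0ℚ ℚ.* u ℚ.- ½ ℚ.* (η ℚ.* u) ≡ ℚ.- (½ ℚ.* (η ℚ.* u))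
        zero-eq = solve 2 (λ η u → con 0ℚ :* u :+ :- (con ½ :* (η :* u)) := :- (con ½ :* (η :* u))) refl
      slot (suc k) q lower upper = choose (q ℚ.<? ι (L ℕ.* suc k) ℚ.* u)
        where
        Slot : Set
        Slot = ∃ λ i → i ℕ.< suc (suc k) × ι (L ℕ.* i) ℚ.* u ℚ.- ½ ℚ.* (η ℚ.* u) ℚ.≤ q × q ℚ.≤ ι (L ℕ.* suc i) ℚ.* u
        choose : Dec (q ℚ.< ι (L ℕ.* suc k) ℚ.* u) → Slot
        choose (yes q<) = let i , i<k , h = slot k q lower q< in i , ℕ.m<n⇒m<1+n i<k , h
        choose (no q≮)  = suc k , ℕ.≤-refl , minus (ℚ.≮⇒≥ q≮) , ℚ.<⇒≤ upper

      slot-M : 0 ℕ.< M → ∀ q → ℚ.- (½ ℚ.* (η ℚ.* u)) ℚ.≤ q → q ℚ.< 1ℚ →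
        ∃ λ i → i ℕ.< M × ι (L ℕ.* i) ℚ.* u ℚ.- ½ ℚ.* (η ℚ.* u) ℚ.≤ q × q ℚ.≤ ι (L ℕ.* suc i) ℚ.* u
      slot-M 0<M q lower upper = let i , i< , h = slot (ℕ.pred M) q lower (subst (q ℚ.<_) 1≡ upper)
        in i , subst (i ℕ.<_) M≡ i< , h
        where
        M≡ : suc (ℕ.pred M) ≡ M
        M≡ = ℕ.suc-pred M {{ℕ.>-nonZero 0<M}}
        1≡ : 1ℚ ≡ ι (L ℕ.* suc (ℕ.pred M)) ℚ.* u
        1≡ = trans (sym LMu) (cong (λ k → ι (L ℕ.* k) ℚ.* u) (sym M≡))

      -- Half of the inflation `η u` pays for replacing `x` by a fixed term of its sequence, the
      -- other half for the loose lower bound of `slot`.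
      locate : 0 ℕ.< M → ∀ x → ∃ λ i → i ℕ.< M × x ∈ᴵ interval i
      locate 0<M x = combine (cauchy (rep x) e 0<e) (0≤rep x e 0<e) (rep<1 x)
        where
        e : ℚ
        e = ½ ℚ.* (η ℚ.* u)
        0<e : 0ℚ ℚ.< e
        0<e = 0<½* 0<ηu
        X : ℕ → ℚ
        X = seq (rep x)
        combine : (∃ λ N → ∀ m n → N ℕ.≤ m → N ℕ.≤ n → ℚ.∣ X m ℚ.- X n ∣ ℚ.< e) →
          (∃ λ N → ∀ n → N ℕ.≤ n → 0ℚ ℚ.≤ X n ℚ.+ e) →
          (∃ λ δ → 0ℚ ℚ.< δ × ∃ λ N → ∀ n → N ℕ.≤ n → X n ℚ.+ δ ℚ.≤ 1ℚ) →
          ∃ λ i → i ℕ.< M × x ∈ᴵ interval i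
        combine (N₁ , close) (N₂ , nonneg) (δ , 0<δ , N₃ , below) =
          finish (slot-M 0<M (X N) q≥ q<1)
          where
          N : ℕ
          N = N₁ ℕ.⊔ (N₂ ℕ.⊔ N₃)
          N≥ : N₂ ℕ.⊔ N₃ ℕ.≤ N
          N≥ = ℕ.m≤n⊔m N₁ (N₂ ℕ.⊔ N₃)
          q≥ : ℚ.- e ℚ.≤ X N
          q≥ = by (nonneg N (ℕ.m⊔n≤o⇒m≤o N₂ N₃ N≥)) (solve 2 (λ x e → x :+ e := x :+ :- :- e) refl (X N) e)
          q<1 : X N ℚ.< 1ℚ
          q<1 = ℚ.<-≤-trans (subst (ℚ._< X N ℚ.+ δ) (ℚ.+-identityʳ (X N)) (ℚ.+-monoʳ-< (X N) 0<δ))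
            (below N (ℕ.m⊔n≤o⇒n≤o N₂ N₃ N≥))
          finish : (∃ λ i → i ℕ.< M × ι (L ℕ.* i) ℚ.* u ℚ.- e ℚ.≤ X N × X N ℚ.≤ ι (L ℕ.* suc i) ℚ.* u) →
            ∃ λ i → i ℕ.< M × x ∈ᴵ interval i
          finish (i , i<M , l , h) = i , i<M
            , (λ ε 0<ε → N₁ , λ n n≥ →
                lower (ι (L ℕ.* i)) η u (X N) (X n) ε (ℚ.<⇒≤ 0<ε) l
                  (ℚ.<⇒≤ (ℚ.≤-<-trans (p≤∣p∣ (X N ℚ.- X n)) (close N n (ℕ.m≤m⊔n N₁ (N₂ ℕ.⊔ N₃)) n≥))))
            , (λ ε 0<ε → N₁ , λ n n≥ →
                upper (ι (L ℕ.* suc i)) η u (X N) (X n) ε (ℚ.<⇒≤ 0<ε) 0≤ηu h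
                  (ℚ.<⇒≤ (ℚ.≤-<-trans (p≤∣p∣ (X n ℚ.- X N)) (close n N n≥ (ℕ.m≤m⊔n N₁ (N₂ ℕ.⊔ N₃))))))
            where
            lower : ∀ a η u p x ε → 0ℚ ℚ.≤ ε → a ℚ.* u ℚ.- ½ ℚ.* (η ℚ.* u) ℚ.≤ p →
              p ℚ.- x ℚ.≤ ½ ℚ.* (η ℚ.* u) → (a ℚ.- η) ℚ.* u ℚ.≤ x ℚ.+ ε
            lower a η u p x ε h₀ h₁ h₂ = by (0≤+ h₀ (0≤+ (≤⇒0≤ h₁) (≤⇒0≤ h₂)))
              (solve 6 (λ a η u p x ε → ε :+ ((p :+ :- (a :* u :+ :- (con ½ :* (η :* u)))) :+ (con ½ :* (η :* u) :+ :- (p :+ :- x)))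
                := (x :+ ε) :+ :- ((a :+ :- η) :* u)) refl a η u p x ε)
            upper : ∀ b η u p x ε → 0ℚ ℚ.≤ ε → 0ℚ ℚ.≤ η ℚ.* u → p ℚ.≤ b ℚ.* u →
              x ℚ.- p ℚ.≤ ½ ℚ.* (η ℚ.* u) → x ℚ.≤ (b ℚ.+ η) ℚ.* u ℚ.+ ε
            upper b η u p x ε h₀ h₃ h₁ h₂ = by
              (0≤+ (0≤+ h₀ (0≤* (ℚ.<⇒≤ (0<1/suc 1)) h₃)) (0≤+ (≤⇒0≤ h₁) (≤⇒0≤ h₂)))
              (solve 6 (λ b η u p x ε → (ε :+ con ½ :* (η :* u)) :+ ((b :* u :+ :- p) :+ (con ½ :* (η :* u) :+ :- (x :+ :- p)))
                := ((b :+ η) :* u :+ ε) :+ :- x) refl b η u p x ε)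

-- The cover of the exceptional outcomes and its volume

module Cover where

  open import Data.Fin as Fin using (Fin; zero; suc)
  open import Data.List as List using (List; []; _∷_; map)
  open import Data.List.Membership.Propositional using (_∈_)
  open import Data.List.Membership.Propositional.Properties using (∈-map⁺; ∈-map⁻; ∈-filter⁺; ∈-cartesianProduct⁺; ∈-cartesianProduct⁻; ∈-upTo⁺; ∈-upTo⁻)
  open import Data.List.Properties using (length-map)
  open import Data.List.Relation.Unary.Any using (here; there)
  open import Data.List.Relation.Unary.Unique.Propositional using (Unique)
  import Data.List.Relation.Unary.Unique.Propositional.Properties as Unique
  open import Data.Product.Properties using (≡-dec)
  open import Data.Vec as Vec using (Vec; lookup; tabulate)
  open import Data.Vec.Properties using (lookup∘tabulate)
  import Data.Vec.Relation.Unary.All as VecAll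
  import Data.Vec.Relation.Unary.All.Properties as VecAll
  open import Data.Vec.Functional using (foldr)
  open Sums using (Cell; Σ□; Σ<; Σ<-const)
  open WordCounts
  open Rationals
  open GridDistance
  open RealDistance
  open import Defs hiding (∣_∣)

  pow : ℚ → ℕ → ℚ
  pow z zero    = 1ℚ
  pow z (suc n) = z ℚ.* pow z n

  0≤1 : 0ℚ ℚ.≤ 1ℚ
  0≤1 = ℚ.<⇒≤ (0<1/suc 0)

  0≤pow : ∀ {z} → 0ℚ ℚ.≤ z → ∀ n → 0ℚ ℚ.≤ pow z n
  0≤pow h zero    = 0≤1
  0≤pow h (suc n) = 0≤* h (0≤pow h n)

  pow-* : ∀ y z n → pow (y ℚ.* z) n ≡ pow y n ℚ.* pow z n
  pow-* y z zero    = refl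
  pow-* y z (suc n) = trans (cong (y ℚ.* z ℚ.*_) (pow-* y z n))
    (solve 4 (λ y z p q → y :* z :* (p :* q) := y :* p :* (z :* q)) refl y z (pow y n) (pow z n))

  ι-^ : ∀ m n → ι (m ℕ.^ n) ≡ pow (ι m) n
  ι-^ m zero    = ι-1
  ι-^ m (suc n) = trans (ι-* m (m ℕ.^ n)) (cong (ι m ℚ.*_) (ι-^ m n))

  -- A reverse Bernoulli inequality: while the accumulated excess is at most 1, one more factor
  -- `1 + x` adds at most `x + x`.
  pow-≤ : ∀ {z x} n → 0ℚ ℚ.≤ z → 0ℚ ℚ.≤ x → z ℚ.≤ 1ℚ ℚ.+ x → ι (n ℕ.+ n) ℚ.* x ℚ.≤ 1ℚ →
    pow z n ℚ.≤ 1ℚ ℚ.+ ι (n ℕ.+ n) ℚ.* x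
  pow-≤ {z} {x} zero    0≤z 0≤x z≤ small = by (0≤* (0≤ι 0) 0≤x)
    (solve 2 (λ i x → i :* x := (con 1ℚ :+ i :* x) :+ :- con 1ℚ) refl (ι 0) x)
  pow-≤ {z} {x} (suc n) 0≤z 0≤x z≤ small = subst (λ i → pow z (suc n) ℚ.≤ 1ℚ ℚ.+ i ℚ.* x) (sym eq)
    (ℚ.≤-trans (*-mono 0≤z (0≤+ 0≤1 0≤kx) z≤ (pow-≤ n 0≤z 0≤x z≤ small′))
      (step k x 0≤x (≤⇒0≤ small′)))
    where
    k : ℚ
    k = ι (n ℕ.+ n)
    0≤kx : 0ℚ ℚ.≤ k ℚ.* x
    0≤kx = 0≤* (0≤ι (n ℕ.+ n)) 0≤x
    eq : ι (suc n ℕ.+ suc n) ≡ (1ℚ ℚ.+ 1ℚ) ℚ.+ k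
    eq = trans (cong ι (cong suc (ℕ.+-suc n n)))
      (trans (ι-+ 2 (n ℕ.+ n)) (cong (ℚ._+ k) (trans (ι-+ 1 1) (cong₂ ℚ._+_ ι-1 ι-1))))
    small′ : k ℚ.* x ℚ.≤ 1ℚ
    small′ = ℚ.≤-trans (ℚ.*-monoʳ-≤-nonNeg x {{nonNegative 0≤x}} (ι-mono (ℕ.+-mono-≤ (ℕ.n≤1+n n) (ℕ.n≤1+n n)))) small
    step : ∀ k x → 0ℚ ℚ.≤ x → 0ℚ ℚ.≤ 1ℚ ℚ.- k ℚ.* x →
      (1ℚ ℚ.+ x) ℚ.* (1ℚ ℚ.+ k ℚ.* x) ℚ.≤ 1ℚ ℚ.+ ((1ℚ ℚ.+ 1ℚ) ℚ.+ k) ℚ.* x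
    step k x h₁ h₂ = by (0≤* h₁ h₂)
      (solve 2 (λ k x → x :* (con 1ℚ :+ :- (k :* x))
        := (con 1ℚ :+ ((con 1ℚ :+ con 1ℚ) :+ k) :* x) :+ :- ((con 1ℚ :+ x) :* (con 1ℚ :+ k :* x))) refl k x)

  foldr-const : ∀ n (g : Fin n → ℚ) w → (∀ i → g i ≡ w) → foldr ℚ._*_ 1ℚ g ≡ pow w n
  foldr-const zero    g w h = refl
  foldr-const (suc n) g w h = cong₂ ℚ._*_ (h zero) (foldr-const n (λ i → g (suc i)) w λ i → h (suc i))

  foldr-zero : ∀ n → 0 ℕ.< n → (g : Fin n → ℚ) → (∀ i → g i ≡ 0ℚ) → foldr ℚ._*_ 1ℚ g ≡ 0ℚ
  foldr-zero (suc n) _ g h = trans (cong (ℚ._* foldr ℚ._*_ 1ℚ (λ i → g (suc i))) (h zero))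
    (ℚ.*-zeroˡ (foldr ℚ._*_ 1ℚ (λ i → g (suc i))))

  module _ {n : ℕ} where

    -- A cover is an infinite sequence, so a finite list is padded with `d`, which will be a single
    -- point, of volume 0.
    enumerate : Box n → List (Box n) → ℕ → Box n
    enumerate d []       _       = d
    enumerate d (x ∷ xs) zero    = x
    enumerate d (x ∷ xs) (suc k) = enumerate d xs k

    enumerate-∈ : ∀ {d x xs} → x ∈ xs → ∃ λ k → enumerate d xs k ≡ x
    enumerate-∈ (here refl) = 0 , refl
    enumerate-∈ (there x∈)  = let k , eq = enumerate-∈ x∈ in suc k , eq

    partialVolume-∷ : ∀ d x xs N → partialVolume (enumerate d (x ∷ xs)) (suc N) ≡
      volume x ℚ.+ partialVolume (enumerate d xs) N
    partialVolume-∷ d x xs zero    = ℚ.+-comm 0ℚ (volume x)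
    partialVolume-∷ d x xs (suc N) = trans
      (cong (ℚ._+ volume (enumerate d xs N)) (partialVolume-∷ d x xs N))
      (ℚ.+-assoc (volume x) (partialVolume (enumerate d xs) N) (volume (enumerate d xs N)))

    partialVolume-≤ : ∀ d w → volume d ≡ 0ℚ → 0ℚ ℚ.≤ w → ∀ xs → (∀ {x} → x ∈ xs → volume x ≡ w) →
      ∀ N → partialVolume (enumerate d xs) N ℚ.≤ ι (List.length xs) ℚ.* w
    partialVolume-≤ d w d≡0 0≤w xs       h zero    = 0≤* (0≤ι (List.length xs)) 0≤w
    partialVolume-≤ d w d≡0 0≤w []       h (suc N) = subst (λ z → partialVolume (enumerate d []) N ℚ.+ z ℚ.≤ ι 0 ℚ.* w)
      (sym d≡0) (ℚ.≤-trans (ℚ.≤-reflexive (ℚ.+-identityʳ _)) (partialVolume-≤ d w d≡0 0≤w [] h N))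
    partialVolume-≤ d w d≡0 0≤w (x ∷ xs) h (suc N) = ℚ.≤-trans
      (ℚ.≤-reflexive (trans (partialVolume-∷ d x xs N) (cong (ℚ._+ partialVolume (enumerate d xs) N) (h (here refl)))))
      (ℚ.≤-trans (ℚ.+-monoʳ-≤ w (partialVolume-≤ d w d≡0 0≤w xs (λ x∈ → h (there x∈)) N))
        (ℚ.≤-reflexive (trans
          (1+x·y (ι (List.length xs)) w)
          (cong (ℚ._* w) (sym (trans (ι-+ 1 (List.length xs)) (cong (ℚ._+ ι (List.length xs)) ι-1)))))))

  cells : ℕ → List Cell
  cells M = List.cartesianProduct (List.upTo M) (List.upTo M)

  cells-unique : ∀ M → Unique (cells M)
  cells-unique M = Unique.cartesianProduct⁺ (Unique.upTo⁺ M) (Unique.upTo⁺ M)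

  Σᴸ-upTo : ∀ n f → Σᴸ (List.upTo n) f ≡ Σ< n f
  Σᴸ-upTo n f = go n (λ i → i) f
    where
    go : ∀ n g f → Σᴸ (List.applyUpTo g n) f ≡ Σ< n (λ i → f (g i))
    go zero    g f = refl
    go (suc n) g f = cong (f (g 0) ℕ.+_) (go n (λ i → g (suc i)) f)

  Σᴸ-cells : ∀ M f → Σᴸ (cells M) f ≡ Σ□ M f
  Σᴸ-cells M f = trans (Σᴸ-product _,_ (List.upTo M) (List.upTo M) f)
    (trans (Σᴸ-cong (List.upTo M) λ {i} _ → Σᴸ-upTo M (λ j → f (i , j))) (Σᴸ-upTo M _))

  length-cells : ∀ M → List.length (cells M) ≡ M ℕ.* M
  length-cells M = trans (sym (trans (Σᴸ-const (cells M) 1) (ℕ.*-identityʳ _)))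
    (trans (Σᴸ-cells M (λ _ → 1)) (trans (Σ<-const M _)
      (cong (M ℕ.*_) (trans (Σ<-const M 1) (ℕ.*-identityʳ M)))))

  module CellWords (M : ℕ) = Words {Cell} (≡-dec ℕ._≟_ ℕ._≟_) (cells M) (cells-unique M)

  module Covering (M L ρ : ℕ) (u : ℚ) (0<u : 0ℚ ℚ.< u) (LMu : ι (L ℕ.* M) ℚ.* u ≡ 1ℚ)
    (0<M : 0 ℕ.< M) (0<L : 0 ℕ.< L) where

    open Grid M L ρ u 0<u LMu
    open Location M L ρ u 0<u LMu
    open CellWords M

    module _ (n : ℕ) (0<n : 0 ℕ.< n) where

      η : ℚ
      -- Chosen so that `2n · 6η ≤ 1`; then `pow-≤` bounds (1 + 6η)ⁿ, the total volume of the boxes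
      -- of all words, by 2.
      η = + 1 / suc (12 ℕ.* n)

      0<η : 0ℚ ℚ.< η
      0<η = 0<1/suc (12 ℕ.* n)

      η≤¼ : η ℚ.≤ ¼
      η≤¼ = fraction-≤ℕ 1 1 (12 ℕ.* n) 3 (ℕ.*-monoʳ-≤ 1 (ℕ.≤-trans (ℕ.≤ᵇ⇒≤ 4 12 _)
        (ℕ.≤-trans (ℕ.≤-reflexive (sym (ℕ.*-identityʳ 12))) (ℕ.≤-trans (ℕ.*-monoʳ-≤ 12 0<n) (ℕ.n≤1+n _)))))

      open Inflated η 0<η η≤¼

      box : Vec Cell n → Box n
      box v i = interval (proj₁ (lookup v i)) , interval (proj₂ (lookup v i))

      side w : ℚ
      side = (ι L ℚ.+ (η ℚ.+ η)) ℚ.* u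
      w    = side ℚ.* side

      volume-box : ∀ v → volume (box v) ≡ pow w n
      volume-box v = foldr-const n (λ i → length (proj₁ (box v i)) ℚ.* length (proj₂ (box v i))) w
        λ i → cong₂ ℚ._*_ (length-interval (proj₁ (lookup v i))) (length-interval (proj₂ (lookup v i)))

      0≤side : 0ℚ ℚ.≤ side
      0≤side = 0≤* (0≤+ (0≤ι L) (0≤+ (ℚ.<⇒≤ 0<η) (ℚ.<⇒≤ 0<η))) 0≤u

      0≤w : 0ℚ ℚ.≤ w
      0≤w = 0≤* 0≤side 0≤side

      point : Box n
      point i = pt , pt
        where
        pt : Interval
        pt = record { lo = 0ℚ ; hi = 0ℚ ; lo≤hi = ℚ.≤-refl }

      volume-point : volume point ≡ 0ℚ
      volume-point = foldr-zero n 0<n (λ i → length (proj₁ (point i)) ℚ.* length (proj₂ (point i)))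
        λ i → trans (cong (λ z → z ℚ.* z) (ℚ.+-inverseʳ 0ℚ)) (ℚ.*-zeroˡ 0ℚ)

      6η : ℚ
      6η = ι 6 ℚ.* η

      0≤6η : 0ℚ ℚ.≤ 6η
      0≤6η = 0≤* (0≤ι 6) (ℚ.<⇒≤ 0<η)

      small : ι (n ℕ.+ n) ℚ.* 6η ℚ.≤ 1ℚ
      small = ℚ.≤-trans (ℚ.≤-reflexive (trans (sym (ℚ.*-assoc (ι (n ℕ.+ n)) (ι 6) η))
          (cong (ℚ._* η) (trans (sym (ι-* (n ℕ.+ n) 6)) (cong ι (twelve n))))))
        (ℚ.≤-trans (ℚ.*-monoʳ-≤-nonNeg η {{nonNegative (ℚ.<⇒≤ 0<η)}} (ι-mono (ℕ.n≤1+n (12 ℕ.* n))))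
          (ℚ.≤-reflexive (ι-inverse (12 ℕ.* n))))
        where
        open import Data.Nat.Tactic.RingSolver using (solve-∀)
        twelve : ∀ n → (n ℕ.+ n) ℕ.* 6 ≡ 12 ℕ.* n
        twelve = solve-∀

      -- The inflated cells have total area (1 + 2ηMu)², which exceeds 1 only by O(η).
      area : ι (List.length (cells M)) ℚ.* w ℚ.≤ 1ℚ ℚ.+ 6η
      area = subst (λ z → ι (List.length (cells M)) ℚ.* w ℚ.≤ 1ℚ ℚ.+ z ℚ.* η) (sym (ι-def 6))
        (subst (λ z → z ℚ.* w ℚ.≤ 1ℚ ℚ.+ + 6 / 1 ℚ.* η)
          (sym (trans (cong ι (length-cells M)) (ι-* M M)))
          (bound (ι M) (ι L) u η 0≤Mside
            (trans (cong (ℚ._* u) (sym (ι-* L M))) LMu)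
            (ℚ.<⇒≤ 0<η) (≤⇒0≤ η≤¼) (≤⇒0≤ Mu≤1)))
        where
        0≤Mside : 0ℚ ℚ.≤ ι M ℚ.* side
        0≤Mside = 0≤* (0≤ι M) 0≤side
        Mu≤1 : ι M ℚ.* u ℚ.≤ 1ℚ
        Mu≤1 = ℚ.≤-trans (ι*u-mono (ℕ.≤-trans (ℕ.≤-reflexive (sym (ℕ.*-identityˡ M))) (ℕ.*-monoˡ-≤ M 0<L)))
          (ℚ.≤-reflexive LMu)
        bound : ∀ m l u η → 0ℚ ℚ.≤ m ℚ.* ((l ℚ.+ (η ℚ.+ η)) ℚ.* u) → l ℚ.* m ℚ.* u ≡ 1ℚ →
          0ℚ ℚ.≤ η → 0ℚ ℚ.≤ ¼ ℚ.- η → 0ℚ ℚ.≤ 1ℚ ℚ.- m ℚ.* u →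
          m ℚ.* m ℚ.* ((l ℚ.+ (η ℚ.+ η)) ℚ.* u ℚ.* ((l ℚ.+ (η ℚ.+ η)) ℚ.* u)) ℚ.≤ 1ℚ ℚ.+ + 6 / 1 ℚ.* η
        bound m l u η 0≤s eq 0≤η h₁ h₂ = ℚ.≤-trans
          (ℚ.≤-reflexive (solve 2 (λ m s → m :* m :* (s :* s) := m :* s :* (m :* s)) refl m ((l ℚ.+ (η ℚ.+ η)) ℚ.* u)))
          (ℚ.≤-trans (square-mono 0≤s s≤) (expand η 0≤η h₁))
          where
          s≤ : m ℚ.* ((l ℚ.+ (η ℚ.+ η)) ℚ.* u) ℚ.≤ 1ℚ ℚ.+ (η ℚ.+ η)
          s≤ = subst (λ o → m ℚ.* ((l ℚ.+ (η ℚ.+ η)) ℚ.* u) ℚ.≤ o ℚ.+ (η ℚ.+ η)) eq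
            (by (0≤* (0≤+ 0≤η 0≤η) h₂)
              (solve 4 (λ m l u η → (η :+ η) :* (con 1ℚ :+ :- (m :* u))
                := (l :* m :* u :+ (η :+ η)) :+ :- (m :* ((l :+ (η :+ η)) :* u))) refl m l u η))
          expand : ∀ η → 0ℚ ℚ.≤ η → 0ℚ ℚ.≤ ¼ ℚ.- η →
            (1ℚ ℚ.+ (η ℚ.+ η)) ℚ.* (1ℚ ℚ.+ (η ℚ.+ η)) ℚ.≤ 1ℚ ℚ.+ + 6 / 1 ℚ.* η
          expand η 0≤η h = by
            (0≤+ (0≤* (0≤* (0≤fraction 8 0) 0≤η) h) (0≤* (0≤* (0≤fraction 4 0) 0≤η) 0≤η))
            (solve 1 (λ η → (con (+ 8 / 1) :* η :* (con ¼ :+ :- η)) :+ (con (+ 4 / 1) :* η :* η)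
              := (con 1ℚ :+ con (+ 6 / 1) :* η) :+ :- ((con 1ℚ :+ (η :+ η)) :* (con 1ℚ :+ (η :+ η)))) refl η)

      boxes : ℕ → ℕ → Box n
      boxes h = enumerate point (map box (atypical n h))

      -- Four times the number of atypical words is at most mⁿ by `chebyshev`, and the inflated
      -- boxes of all mⁿ words have total volume at most 2.
      four : ∀ h → 4 ℕ.* (m ℕ.* m ℕ.* n) ℕ.≤ h ℕ.* h → 0 ℕ.< m ℕ.* m ℕ.* n →
        ι (List.length (atypical n h)) ℚ.* (+ 4 / 1) ℚ.* pow w n ℚ.≤ + 2 / 1
      four h large pos = ℚ.≤-trans
        (ℚ.*-monoʳ-≤-nonNeg (pow w n) {{nonNegative (0≤pow 0≤w n)}}
          (subst (ℚ._≤ ι (m ℕ.^ n)) (trans (ι-* (List.length (atypical n h)) 4) (cong (ι (List.length (atypical n h)) ℚ.*_) (ι-def 4)))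
            (ι-mono (chebyshev n h large pos))))
        (ℚ.≤-trans (ℚ.≤-reflexive (trans (cong (ℚ._* pow w n) (ι-^ m n)) (sym (pow-* (ι m) w n))))
          (ℚ.≤-trans (pow-≤ n (0≤* (0≤ι m) 0≤w) 0≤6η area small)
            (ℚ.+-monoʳ-≤ 1ℚ small)))

      quarter : ∀ a p → a ℚ.* (+ 4 / 1) ℚ.* p ℚ.≤ + 2 / 1 → a ℚ.* p ℚ.≤ ½
      quarter a p h = by (0≤* (0≤fraction 1 3) (≤⇒0≤ h))
        (solve 2 (λ a p → con (+ 1 / 4) :* (con (+ 2 / 1) :+ :- (a :* con (+ 4 / 1) :* p)) := con ½ :+ :- (a :* p)) refl a p)

      boxes-volume : ∀ h → 4 ℕ.* (m ℕ.* m ℕ.* n) ℕ.≤ h ℕ.* h → 0 ℕ.< m ℕ.* m ℕ.* n →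
        ∀ N → partialVolume (boxes h) N ℚ.≤ ½
      boxes-volume h large pos N = ℚ.≤-trans
        (partialVolume-≤ point (pow w n) volume-point (0≤pow 0≤w n) (map box (atypical n h)) volumes N)
        (subst (λ k → ι k ℚ.* pow w n ℚ.≤ ½) (sym (length-map box (atypical n h)))
          (quarter (ι (List.length (atypical n h))) (pow w n) (four h large pos)))
        where
        volumes : ∀ {b} → b ∈ map box (atypical n h) → volume b ≡ pow w n
        volumes b∈ = let v , _ , eq = ∈-map⁻ box b∈ in trans (cong volume eq) (volume-box v)

      record Located (ω : Sample n) : Set where
        field
          word   : Vec Cell n
          isWord : Word word
          inBox  : ω ∈ᴮ box word

      located : ∀ ω → Located ω
      located ω = record
        { word   = tabulate cell
        ; isWord = VecAll.tabulate⁺ λ i → ∈-cartesianProduct⁺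
            (∈-upTo⁺ (proj₁ (proj₂ (loc₁ i)))) (∈-upTo⁺ (proj₁ (proj₂ (loc₂ i))))
        ; inBox  = λ i →
              subst (λ c → proj₁ (ω i) ∈ᴵ interval (proj₁ c)) (sym (lookup∘tabulate cell i)) (proj₂ (proj₂ (loc₁ i)))
            , subst (λ c → proj₂ (ω i) ∈ᴵ interval (proj₂ c)) (sym (lookup∘tabulate cell i)) (proj₂ (proj₂ (loc₂ i)))
        }
        where
        loc₁ : ∀ i → ∃ λ k → k ℕ.< M × proj₁ (ω i) ∈ᴵ interval k
        loc₁ i = locate 0<M (proj₁ (ω i))
        loc₂ : ∀ i → ∃ λ k → k ℕ.< M × proj₂ (ω i) ∈ᴵ interval k
        loc₂ i = locate 0<M (proj₂ (ω i))
        cell : Fin n → Cell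
        cell i = proj₁ (loc₁ i) , proj₁ (loc₂ i)

      inGrid : ∀ {v : Vec Cell n} → Word v → ∀ i → InGrid (lookup v i)
      inGrid w i with ∈-cartesianProduct⁻ (List.upTo M) (List.upTo M) (VecAll.lookup⁺ w i)
      ... | k∈ , l∈ = ∈-upTo⁻ k∈ , ∈-upTo⁻ l∈

      eventuallyNear : ∀ {v : Vec Cell n} {ω} → ω ∈ᴮ box v → ∀ i → EventuallyNear (lookup v i) (ω i)
      eventuallyNear {v} {ω} ω∈ i =
        let N₁ , h₁ = near-interval {proj₁ (ω i)} (proj₁ (lookup v i)) (proj₁ (ω∈ i))
            N₂ , h₂ = near-interval {proj₂ (ω i)} (proj₂ (lookup v i)) (proj₂ (ω∈ i))
        in N₁ ℕ.⊔ N₂ , λ k k≥ → h₁ k (ℕ.m⊔n≤o⇒m≤o N₁ N₂ k≥) , h₂ k (ℕ.m⊔n≤o⇒n≤o N₁ N₂ k≥)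

      -- Probability is an outer measure, an infimum over covers. If `E` contains no typical
      -- outcome, the boxes of the atypical words cover it, and this one cover of volume at most ½
      -- refutes any larger bound.
      improbable : ∀ (E : Event n) h → 4 ℕ.* (m ℕ.* m ℕ.* n) ℕ.≤ h ℕ.* h → 0 ℕ.< m ℕ.* m ℕ.* n →
        (∀ ω v → Word v → (∀ i → InGrid (lookup v i)) → (∀ i → EventuallyNear (lookup v i) (ω i)) →
          Typical h v → E ω → ⊥) →
        ∀ {p} → ½ ℚ.< p → ¬ ProbAtLeast E p
      improbable E h large pos typical-⊥ {p} ½<p prob =
        ℚ.<-irrefl refl (ℚ.<-≤-trans ½<p (prob (boxes h) covers ½ (boxes-volume h large pos)))
        where
        covers : Covers (boxes h) E
        covers ω Eω = choose (h ℕ.* h ℕ.<? deviation word)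
          where
          open Located (located ω)
          choose : Dec (h ℕ.* h ℕ.< deviation word) → ∃ λ k → ω ∈ᴮ boxes h k
          choose (yes atyp) =
            let k , eq = enumerate-∈ (∈-map⁺ box (∈-filter⁺ (λ v → h ℕ.* h ℕ.<? deviation v) (∈-words isWord) atyp))
            in k , subst (ω ∈ᴮ_) (sym eq) inBox
          choose (no typ)   = ⊥-elim (typical-⊥ ω word isWord (inGrid isWord) (eventuallyNear {word} {ω} inBox) (ℕ.≮⇒≥ typ) Eω)

-- Hamilton cycles, independent sets and finite double negation

module Graphs where

  open import Data.Fin as Fin using (Fin; zero; suc; inject₁; fromℕ)
  import Data.Fin.Properties as Fin
  open import Data.Fin.Permutation using (_⟨$⟩ʳ_)
  open import Data.Fin.Subset using () renaming (∣_∣ to card)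
  import Data.Vec as Vec
  open import Algebra.Properties.CommutativeMonoid.Sum ℕ.+-0-commutativeMonoid using (sum; sum-permute; sum-init-last; ∑-distrib-+)
  open import Algebra.Properties.CommutativeSemigroup ℕ.+-commutativeSemigroup using (interchange)
  open Sums using (𝟙; 𝟙≤1)
  open import Defs using (Graph; Adj; IsHamiltonian; CyclicSuc)

  card-tabulate : ∀ n (f : Fin n → Bool) → card (Vec.tabulate f) ≡ sum (λ i → 𝟙 (f i))
  card-tabulate zero    f = refl
  card-tabulate (suc n) f with f zero
  ... | true  = cong suc (card-tabulate n (λ i → f (suc i)))
  ... | false = card-tabulate n (λ i → f (suc i))

  sum-mono : ∀ n {f g : Fin n → ℕ} → (∀ i → f i ℕ.≤ g i) → sum f ℕ.≤ sum g
  sum-mono zero    h = z≤n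
  sum-mono (suc n) h = ℕ.+-mono-≤ (h zero) (sum-mono n λ i → h (suc i))

  sum-≤ : ∀ n (f : Fin n → ℕ) → (∀ i → f i ℕ.≤ 1) → sum f ℕ.≤ n
  sum-≤ zero    f h = z≤n
  sum-≤ (suc n) f h = ℕ.+-mono-≤ (h zero) (sum-≤ n (λ i → f (suc i)) λ i → h (suc i))

  -- Adding the hypothesis over all `n` cyclic steps counts every entry twice; the step from the
  -- last index to 0 is split off.
  cyclic-sum : ∀ n (a : Fin n → ℕ) → (∀ i j → CyclicSuc i j → a i ℕ.+ a j ℕ.≤ 1) → sum a ℕ.+ sum a ℕ.≤ n
  cyclic-sum zero    a h = z≤n
  cyclic-sum (suc k) a h = begin
    sum a ℕ.+ sum a
      ≡⟨ cong (ℕ._+ sum a) (sum-init-last a) ⟩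
    sum (λ i → a (inject₁ i)) ℕ.+ a (fromℕ k) ℕ.+ (a zero ℕ.+ sum (λ i → a (suc i)))
      ≡⟨ trans (cong (sum (λ i → a (inject₁ i)) ℕ.+ a (fromℕ k) ℕ.+_) (ℕ.+-comm (a zero) _))
           (interchange (sum (λ i → a (inject₁ i))) (a (fromℕ k)) (sum (λ i → a (suc i))) (a zero)) ⟩
    sum (λ i → a (inject₁ i)) ℕ.+ sum (λ i → a (suc i)) ℕ.+ (a (fromℕ k) ℕ.+ a zero)
      ≡⟨ cong (ℕ._+ (a (fromℕ k) ℕ.+ a zero)) (sym (∑-distrib-+ (λ i → a (inject₁ i)) (λ i → a (suc i)))) ⟩
    sum (λ i → a (inject₁ i) ℕ.+ a (suc i)) ℕ.+ (a (fromℕ k) ℕ.+ a zero)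
      ≤⟨ ℕ.+-mono-≤
           (sum-≤ k _ λ i → h (inject₁ i) (suc i) (inj₁ (cong suc (sym (Fin.toℕ-inject₁ i)))))
           (h (fromℕ k) zero (inj₂ (cong suc (Fin.toℕ-fromℕ k) , refl))) ⟩
    k ℕ.+ 1
      ≡⟨ ℕ.+-comm k 1 ⟩
    suc k ∎
    where open ℕ.≤-Reasoning

  independent-≤half : ∀ {n} (H : Graph n) (s : Fin n → Bool) →
    (∀ u v → Adj H u v → s u ∧ s v ≡ false) → IsHamiltonian H →
    sum (λ v → 𝟙 (s v)) ℕ.+ sum (λ v → 𝟙 (s v)) ℕ.≤ n
  independent-≤half {n} H s independent hamiltonian =
    subst (λ z → z ℕ.+ z ℕ.≤ n) (sym (sum-permute (λ v → 𝟙 (s v)) order))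
      (cyclic-sum n (λ i → 𝟙 (s (order ⟨$⟩ʳ i))) λ i j next →
        at-most-one (s (order ⟨$⟩ʳ i)) (s (order ⟨$⟩ʳ j)) (independent _ _ (cycle i j next)))
    where
    open IsHamiltonian hamiltonian
    at-most-one : ∀ b c → b ∧ c ≡ false → 𝟙 b ℕ.+ 𝟙 c ℕ.≤ 1
    at-most-one true  false _ = s≤s z≤n
    at-most-one false c     _ = 𝟙≤1 c

  -- Lets the finitely many undecidable comparisons of distances with the radius be taken as decided
  -- on the way to a contradiction.
  ¬¬-∀ : ∀ n {Q : Fin n → Set} → (∀ i → ¬ ¬ Q i) → ¬ ¬ (∀ i → Q i)
  ¬¬-∀ zero    h k = k λ ()
  ¬¬-∀ (suc n) h k = h zero λ q → ¬¬-∀ n (λ i → h (suc i)) λ qs → k λ { zero → q ; (suc i) → qs i }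

-- The subgraph that is not Hamiltonian, for a typical word

module Resilience where

  open import Data.Fin as Fin using (Fin)
  import Data.Fin.Properties as Fin
  open import Data.Nat.Tactic.RingSolver using (solve-∀)
  open import Data.Vec as Vec using (Vec; []; _∷_; lookup)
  open import Algebra.Properties.CommutativeMonoid.Sum ℕ.+-0-commutativeMonoid using (sum; sum-cong-≗; ∑-distrib-+)
  open import Function.Bundles using (_⇔_; mk⇔)
  open import Relation.Nullary.Decidable.Core using (¬¬-excluded-middle)
  open Sums using (𝟙; 𝟙≤1; 𝟙-∧-not; Cell; Geometry; offset; closeᵇ; reachᵇ)
  open WordCounts
  open Rationals
  open GridDistance
  open RealDistance
  open Cover
  open Graphs
  open import Defs hiding (∣_∣)
  open Graph using (adj)

  -- (1 + x)/(2x) = 1/2 + 1/(2x), and `e` is the last term.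
  half+ε : ∀ x e g k → (x ℚ.+ x) ℚ.* e ≡ 1ℚ → 0ℚ ℚ.≤ e →
    (1ℚ ℚ.+ x) ℚ.* g ℚ.≤ (x ℚ.+ x) ℚ.* k → (½ ℚ.+ e) ℚ.* g ℚ.≤ k
  half+ε x e g k eq 0≤e h = subst₂ (λ o j → (½ ℚ.* o ℚ.+ e) ℚ.* g ℚ.≤ j) eq
    (trans (cong (ℚ._* k) eq) (ℚ.*-identityˡ k)) (by (0≤* (≤⇒0≤ h) 0≤e)
    (solve 4 (λ x e g k → ((x :+ x) :* k :+ :- ((con 1ℚ :+ x) :* g)) :* e
      := (x :+ x) :* e :* k :+ :- ((con ½ :* ((x :+ x) :* e) :+ e) :* g)) refl x e g k))

  module Refutation (geometry : Geometry) (u : ℚ) (0<u : 0ℚ ℚ.< u)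
    (LMu : ι (Geometry.L geometry ℕ.* Geometry.M geometry) ℚ.* u ≡ 1ℚ) where

    open Geometry geometry
    open Grid M L ρ u 0<u LMu
    open Location M L ρ u 0<u LMu
    open CellWords M

    close reach : Cell → Cell → Bool
    close = offset M (closeᵇ L ρ)
    reach = offset M (reachᵇ L ρ)

    weight-lookup : ∀ {n} (v : Vec Cell n) φ → weight φ v ≡ sum (λ i → φ (lookup v i))
    weight-lookup []      φ = refl
    weight-lookup (a ∷ v) φ = cong (φ a ℕ.+_) (weight-lookup v φ)

    Σᴸ≤m : ∀ (φ : Cell → Bool) → Σᴸ (cells M) (λ a → 𝟙 (φ a)) ℕ.≤ m
    Σᴸ≤m φ = ℕ.≤-trans (Σᴸ-mono (cells M) (λ {a} _ → 𝟙≤1 (φ a)))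
      (ℕ.≤-reflexive (trans (Σᴸ-const (cells M) 1) (ℕ.*-identityʳ m)))

    module _ (h : ℕ) (0<h : 0 ℕ.< h) where

      n : ℕ
      -- In a typical word each cell count then differs from its mean n/m by at most the fraction
      -- 1/(8m) of that mean.
      n = 8 ℕ.* (m ℕ.* h)

      0<m : 0 ℕ.< m
      0<m = subst (0 ℕ.<_) (sym (length-cells M)) (ℕ.*-mono-< {0} {M} {0} {M} 0<M 0<M)

      module _ {v : Vec Cell n} (word : Word v) (typical : Typical h v) where

        cell : Fin n → Cell
        cell = lookup v

        inS : Fin n → Bool
        inS i = not (blob (cell i))

        S-large : n ℕ.< sum (λ i → 𝟙 (inS i)) ℕ.+ sum (λ i → 𝟙 (inS i))
        S-large = subst (λ z → n ℕ.< z ℕ.+ z) (weight-lookup v φ)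
          (ℕ.*-cancelˡ-< m n (weight φ v ℕ.+ weight φ v) (arith m h t (weight φ v) 0<m 0<h
            (typical-lower word typical φ) (Σᴸ≤m (λ a → not (blob a))) t-large))
          where
          φ : Cell → ℕ
          φ a = 𝟙 (not (blob a))
          t : ℕ
          t = Σᴸ (cells M) φ
          t-large : m ℕ.+ 2 ℕ.≤ 2 ℕ.* t
          t-large = subst₂ (λ x y → x ℕ.+ 2 ℕ.≤ 2 ℕ.* y) (sym (length-cells M)) (sym (Σᴸ-cells M φ)) more-than-half
          -- The surplus of two cells is worth `2n = 16mh`, while the fluctuations cost at most
          -- `2mh`.
          arith : ∀ m h t w → 0 ℕ.< m → 0 ℕ.< h → t ℕ.* (8 ℕ.* (m ℕ.* h)) ℕ.≤ m ℕ.* w ℕ.+ t ℕ.* h → t ℕ.≤ m →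
            m ℕ.+ 2 ℕ.≤ 2 ℕ.* t → m ℕ.* (8 ℕ.* (m ℕ.* h)) ℕ.< m ℕ.* (w ℕ.+ w)
          arith m h t w 0<m 0<h h₁ h₂ h₃ = ℕ.+-cancelʳ-< (2 ℕ.* (m ℕ.* h)) _ _ (begin-strict
            m ℕ.* (8 ℕ.* (m ℕ.* h)) ℕ.+ 2 ℕ.* (m ℕ.* h)
              <⟨ ℕ.+-monoʳ-< (m ℕ.* (8 ℕ.* (m ℕ.* h))) (ℕ.*-monoˡ-< (m ℕ.* h) {{ℕ.>-nonZero (ℕ.*-mono-< {0} {m} {0} {h} 0<m 0<h)}} {2} {16} (ℕ.≤ᵇ⇒≤ 3 16 _)) ⟩
            m ℕ.* (8 ℕ.* (m ℕ.* h)) ℕ.+ 16 ℕ.* (m ℕ.* h)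
              ≡⟨ e₁ m h ⟩
            (m ℕ.+ 2) ℕ.* (8 ℕ.* (m ℕ.* h))
              ≤⟨ ℕ.*-monoˡ-≤ (8 ℕ.* (m ℕ.* h)) h₃ ⟩
            2 ℕ.* t ℕ.* (8 ℕ.* (m ℕ.* h))
              ≡⟨ ℕ.*-assoc 2 t _ ⟩
            2 ℕ.* (t ℕ.* (8 ℕ.* (m ℕ.* h)))
              ≤⟨ ℕ.*-monoʳ-≤ 2 (ℕ.≤-trans h₁ (ℕ.+-monoʳ-≤ (m ℕ.* w) (ℕ.*-monoˡ-≤ h h₂))) ⟩
            2 ℕ.* (m ℕ.* w ℕ.+ m ℕ.* h)
              ≡⟨ e₂ m w h ⟩
            m ℕ.* (w ℕ.+ w) ℕ.+ 2 ℕ.* (m ℕ.* h) ∎)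
            where
            open ℕ.≤-Reasoning
            e₁ : ∀ m h → m ℕ.* (8 ℕ.* (m ℕ.* h)) ℕ.+ 16 ℕ.* (m ℕ.* h) ≡ (m ℕ.+ 2) ℕ.* (8 ℕ.* (m ℕ.* h))
            e₁ = solve-∀
            e₂ : ∀ m w h → 2 ℕ.* (m ℕ.* w ℕ.+ m ℕ.* h) ≡ m ℕ.* (w ℕ.+ w) ℕ.+ 2 ℕ.* (m ℕ.* h)
            e₂ = solve-∀

        module _ (inGrid : ∀ i → InGrid (cell i)) where

          closeOutside reachInside : Fin n → Fin n → ℕ
          closeOutside i j = 𝟙 (close (cell i) (cell j) ∧ blob (cell j))
          reachInside i j  = 𝟙 (reach (cell i) (cell j) ∧ not (blob (cell j)))

          majority-sum : ∀ i → blob (cell i) ≡ false →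
            2 ℕ.* m ℕ.* sum (reachInside i) ℕ.+ n ℕ.≤ 2 ℕ.* m ℕ.* sum (closeOutside i)
          majority-sum i outside = subst₂ (λ x y → 2 ℕ.* m ℕ.* x ℕ.+ n ℕ.≤ 2 ℕ.* m ℕ.* y)
            (weight-lookup v φr) (weight-lookup v φc)
            (arith m h p d (weight φr v) (weight φc v)
              (typical-upper word typical φr) (typical-lower word typical φc)
              p<d (Σᴸ≤m (λ a → close (cell i) a ∧ blob a)))
            where
            φc φr : Cell → ℕ
            φc a = 𝟙 (close (cell i) a ∧ blob a)
            φr a = 𝟙 (reach (cell i) a ∧ not (blob a))
            p d : ℕ
            p = Σᴸ (cells M) φr
            d = Σᴸ (cells M) φc
            p<d : p ℕ.< d
            p<d = subst₂ ℕ._<_ (sym (Σᴸ-cells M φr)) (sym (Σᴸ-cells M φc))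
              (majority (proj₁ (cell i)) (proj₂ (cell i)) (proj₁ (inGrid i)) (proj₂ (inGrid i)) outside)
            -- The one cell by which `p` falls short of `d` is worth `n = 8mh`. Fluctuations cost at
            -- most `mh` on each side, so at least `n/2` remains.
            arith : ∀ m h p d x y → let n = 8 ℕ.* (m ℕ.* h) in
              m ℕ.* x ℕ.≤ p ℕ.* (n ℕ.+ h) → d ℕ.* n ℕ.≤ m ℕ.* y ℕ.+ d ℕ.* h → suc p ℕ.≤ d → d ℕ.≤ m →
              2 ℕ.* m ℕ.* x ℕ.+ n ℕ.≤ 2 ℕ.* m ℕ.* y
            arith m h p d x y h₁ h₂ h₃ h₄ = ℕ.+-cancelʳ-≤ (2 ℕ.* (d ℕ.* h)) _ _ (begin
              2 ℕ.* m ℕ.* x ℕ.+ N ℕ.+ 2 ℕ.* (d ℕ.* h)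
                ≡⟨ cong (λ z → z ℕ.+ N ℕ.+ 2 ℕ.* (d ℕ.* h)) (ℕ.*-assoc 2 m x) ⟩
              2 ℕ.* (m ℕ.* x) ℕ.+ N ℕ.+ 2 ℕ.* (d ℕ.* h)
                ≤⟨ ℕ.+-mono-≤ (ℕ.+-monoˡ-≤ N (ℕ.*-monoʳ-≤ 2 h₁)) (ℕ.*-monoʳ-≤ 2 (ℕ.*-monoˡ-≤ h h₄)) ⟩
              2 ℕ.* (p ℕ.* (N ℕ.+ h)) ℕ.+ N ℕ.+ 2 ℕ.* (m ℕ.* h)
                ≡⟨ cong (λ z → z ℕ.+ N ℕ.+ 2 ℕ.* (m ℕ.* h)) (e₁ p N h) ⟩
              2 ℕ.* (p ℕ.* N) ℕ.+ 2 ℕ.* (p ℕ.* h) ℕ.+ N ℕ.+ 2 ℕ.* (m ℕ.* h)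
                ≤⟨ ℕ.+-monoˡ-≤ (2 ℕ.* (m ℕ.* h)) (ℕ.+-monoˡ-≤ N (ℕ.+-monoʳ-≤ (2 ℕ.* (p ℕ.* N)) (ℕ.*-monoʳ-≤ 2 (ℕ.*-monoˡ-≤ h (ℕ.≤-trans (ℕ.<⇒≤ h₃) h₄))))) ⟩
              2 ℕ.* (p ℕ.* N) ℕ.+ 2 ℕ.* (m ℕ.* h) ℕ.+ N ℕ.+ 2 ℕ.* (m ℕ.* h)
                ≤⟨ ℕ.m≤m+n _ (4 ℕ.* (m ℕ.* h)) ⟩
              2 ℕ.* (p ℕ.* N) ℕ.+ 2 ℕ.* (m ℕ.* h) ℕ.+ N ℕ.+ 2 ℕ.* (m ℕ.* h) ℕ.+ 4 ℕ.* (m ℕ.* h)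
                ≡⟨ e₂ p m h ⟩
              2 ℕ.* (suc p ℕ.* N)
                ≤⟨ ℕ.*-monoʳ-≤ 2 (ℕ.≤-trans (ℕ.*-monoˡ-≤ N h₃) h₂) ⟩
              2 ℕ.* (m ℕ.* y ℕ.+ d ℕ.* h)
                ≡⟨ e₃ m y (d ℕ.* h) ⟩
              2 ℕ.* m ℕ.* y ℕ.+ 2 ℕ.* (d ℕ.* h) ∎)
              where
              open ℕ.≤-Reasoning
              N : ℕ
              N = 8 ℕ.* (m ℕ.* h)
              e₁ : ∀ p N h → 2 ℕ.* (p ℕ.* (N ℕ.+ h)) ≡ 2 ℕ.* (p ℕ.* N) ℕ.+ 2 ℕ.* (p ℕ.* h)
              e₁ = solve-∀
              e₂ : ∀ p m h → 2 ℕ.* (p ℕ.* (8 ℕ.* (m ℕ.* h))) ℕ.+ 2 ℕ.* (m ℕ.* h) ℕ.+ 8 ℕ.* (m ℕ.* h) ℕ.+ 2 ℕ.* (m ℕ.* h) ℕ.+ 4 ℕ.* (m ℕ.* h)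
                ≡ 2 ℕ.* (suc p ℕ.* (8 ℕ.* (m ℕ.* h)))
              e₂ = solve-∀
              e₃ : ∀ m y z → 2 ℕ.* (m ℕ.* y ℕ.+ z) ≡ 2 ℕ.* m ℕ.* y ℕ.+ 2 ℕ.* z
              e₃ = solve-∀

          -- Adjacency enters as any decidable symmetric relation between `close` and `reach`;
          -- `refute` instantiates it under a double negation.
          module _ (_~_ : Fin n → Fin n → Set) (~-sym : ∀ i j → i ~ j → j ~ i)
            (close⇒~ : ∀ i j → close (cell i) (cell j) ≡ true → i ~ j)
            (far⇒≁ : ∀ i j → reach (cell i) (cell j) ≡ false → ¬ (i ~ j))
            (_~?_ : ∀ i j → Dec (i ~ j)) where

            join : Fin n → Fin n → Bool
            join i j = not (does (i Fin.≟ j)) ∧ does (i ~? j)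

            join⇒ : ∀ i j → join i j ≡ true → i ≢ j × i ~ j
            join⇒ i j h with i Fin.≟ j | i ~? j
            join⇒ i j h | no i≢j | yes le = i≢j , le

            ⇒join : ∀ i j → i ≢ j → i ~ j → join i j ≡ true
            ⇒join i j i≢j le with i Fin.≟ j | i ~? j
            ... | yes i≡j | _      = ⊥-elim (i≢j i≡j)
            ... | no _    | yes _  = refl
            ... | no _    | no ¬le = ⊥-elim (¬le le)

            G : Graph n
            G = record
              { adj    = join
              ; symm   = λ i j h → let i≢j , le = join⇒ i j h in
                  ⇒join j i (λ j≡i → i≢j (sym j≡i)) (~-sym i j le)
              ; irrefl = irrefl′
              }
              where
              irrefl′ : ∀ i → join i i ≡ false
              irrefl′ i with i Fin.≟ i
              ... | yes _  = refl
              ... | no i≢i = ⊥-elim (i≢i refl)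

            G-adj : ∀ i j → Adj G i j ⇔ (i ≢ j × i ~ j)
            G-adj i j = mk⇔ (join⇒ i j) λ (i≢j , le) → ⇒join i j i≢j le

            H : Graph n
            H = record
              { adj    = λ i j → join i j ∧ not (inS i ∧ inS j)
              ; symm   = λ i j h → trans
                  (cong₂ (λ b c → b ∧ not c)
                    (trans (Graph.symm G i j (proj₁ (both h))) (sym (proj₁ (both h))))
                    (Bool.∧-comm (inS j) (inS i))) h
              ; irrefl = λ i → cong (_∧ not (inS i ∧ inS i)) (Graph.irrefl G i)
              }
              where
              both : ∀ {b c} → b ∧ c ≡ true → b ≡ true × c ≡ true
              both {true} {true} _ = refl , refl

            H-independent : ∀ i j → Adj H i j → inS i ∧ inS j ≡ false
            H-independent i j h with join i j | inS i ∧ inS j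
            ... | true | false = refl

            H-not-hamiltonian : ¬ IsHamiltonian H
            H-not-hamiltonian ham = ℕ.<⇒≱ S-large (independent-≤half H inS H-independent ham)

            degree-sum : ∀ (K : Graph n) i → degree K i ≡ sum (λ j → 𝟙 (adj K i j))
            degree-sum K i = card-tabulate n (adj K i)

            G-degree : ∀ i → sum (λ j → 𝟙 (join i j ∧ inS j)) ℕ.+ sum (λ j → 𝟙 (join i j ∧ not (inS j))) ≡ degree G i
            G-degree i = trans (sym (∑-distrib-+ (λ j → 𝟙 (join i j ∧ inS j)) (λ j → 𝟙 (join i j ∧ not (inS j)))))
              (trans (sum-cong-≗ (λ j → 𝟙-∧-not (join i j) (inS j))) (sym (degree-sum G i)))

            G-degree≤n : ∀ i → degree G i ℕ.≤ n
            G-degree≤n i = subst (ℕ._≤ n) (sym (degree-sum G i)) (sum-≤ n (λ j → 𝟙 (join i j)) λ j → 𝟙≤1 (join i j))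

            inside-≤ : ∀ i → sum (λ j → 𝟙 (join i j ∧ inS j)) ℕ.≤ sum (reachInside i)
            inside-≤ i = sum-mono n step
              where
              step : ∀ j → 𝟙 (join i j ∧ inS j) ℕ.≤ reachInside i j
              step j with join i j in eq | reach (cell i) (cell j) in far
              ... | false | _     = z≤n
              ... | true  | true  = ℕ.≤-refl
              ... | true  | false = ⊥-elim (far⇒≁ i j far (proj₂ (join⇒ i j eq)))

            outside-≥ : ∀ i → inS i ≡ true → sum (closeOutside i) ℕ.≤ sum (λ j → 𝟙 (join i j ∧ not (inS j)))
            outside-≥ i i∈S = sum-mono n step
              where
              step : ∀ j → closeOutside i j ℕ.≤ 𝟙 (join i j ∧ not (inS j))
              step j with close (cell i) (cell j) in eq | blob (cell j) in j∉S
              ... | false | _     = z≤n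
              ... | true  | false = z≤n
              ... | true  | true  = ℕ.≤-reflexive (sym (cong (λ b → 𝟙 (b ∧ true)) (⇒join i j i≢j (close⇒~ i j eq))))
                where
                i≢j : i ≢ j
                i≢j refl = true≢false (trans (sym i∈S) (cong not j∉S))
                  where
                  true≢false : true ≢ false
                  true≢false ()

            degree-ineq : ∀ i → (1 ℕ.+ 2 ℕ.* m) ℕ.* degree G i ℕ.≤ (2 ℕ.* m ℕ.+ 2 ℕ.* m) ℕ.* degree H i
            degree-ineq i = go (inS i) refl
              where
              Goal : Set
              Goal = (1 ℕ.+ 2 ℕ.* m) ℕ.* degree G i ℕ.≤ (2 ℕ.* m ℕ.+ 2 ℕ.* m) ℕ.* degree H i
              go : ∀ b → inS i ≡ b → Goal
              -- A vertex off S keeps all its edges.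
              go false i∉S = ℕ.≤-trans (ℕ.*-monoˡ-≤ (degree G i) (ℕ.+-monoˡ-≤ (2 ℕ.* m) 1≤2m))
                (ℕ.≤-reflexive (cong ((2 ℕ.* m ℕ.+ 2 ℕ.* m) ℕ.*_) (trans (degree-sum G i)
                  (trans (sum-cong-≗ λ j → cong 𝟙 (sym (trans (cong (λ b → join i j ∧ not (b ∧ inS j)) i∉S)
                    (Bool.∧-identityʳ (join i j))))) (sym (degree-sum H i))))))
                where
                1≤2m : 1 ℕ.≤ 2 ℕ.* m
                1≤2m = ℕ.≤-trans 0<m (ℕ.m≤m+n m _)
              go true i∈S = subst₂ (λ g k → (1 ℕ.+ 2 ℕ.* m) ℕ.* g ℕ.≤ (2 ℕ.* m ℕ.+ 2 ℕ.* m) ℕ.* k)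
                (G-degree i) (sym H-degree)
                (arith (2 ℕ.* m) n dS dO (subst (ℕ._≤ n) (sym (G-degree i)) (G-degree≤n i))
                  (ℕ.≤-trans (ℕ.+-monoˡ-≤ n (ℕ.*-monoʳ-≤ (2 ℕ.* m) (inside-≤ i)))
                    (ℕ.≤-trans (majority-sum i (blob-false (blob (cell i)) i∈S)) (ℕ.*-monoʳ-≤ (2 ℕ.* m) (outside-≥ i i∈S)))))
                where
                dS dO : ℕ
                dS = sum (λ j → 𝟙 (join i j ∧ inS j))
                dO = sum (λ j → 𝟙 (join i j ∧ not (inS j)))
                blob-false : ∀ b → not b ≡ true → b ≡ false
                blob-false false _ = refl
                H-degree : degree H i ≡ dO
                H-degree = trans (degree-sum H i) (sum-cong-≗ λ j → cong (λ b → 𝟙 (join i j ∧ not (b ∧ inS j))) i∈S)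
                -- The degree is at most `n`, so the additive gap `n` turns into a multiplicative
                -- one.
                arith : ∀ x n s o → s ℕ.+ o ℕ.≤ n → x ℕ.* s ℕ.+ n ℕ.≤ x ℕ.* o →
                  (1 ℕ.+ x) ℕ.* (s ℕ.+ o) ℕ.≤ (x ℕ.+ x) ℕ.* o
                arith x n s o h₁ h₂ = begin
                  (1 ℕ.+ x) ℕ.* (s ℕ.+ o)             ≡⟨ e₁ x s o ⟩
                  x ℕ.* s ℕ.+ (s ℕ.+ o) ℕ.+ x ℕ.* o   ≤⟨ ℕ.+-monoˡ-≤ (x ℕ.* o) (ℕ.≤-trans (ℕ.+-monoʳ-≤ (x ℕ.* s) h₁) h₂) ⟩
                  x ℕ.* o ℕ.+ x ℕ.* o                 ≡⟨ sym (ℕ.*-distribʳ-+ o x x) ⟩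
                  (x ℕ.+ x) ℕ.* o                     ∎
                  where
                  open ℕ.≤-Reasoning
                  e₁ : ∀ x s o → (1 ℕ.+ x) ℕ.* (s ℕ.+ o) ≡ x ℕ.* s ℕ.+ (s ℕ.+ o) ℕ.+ x ℕ.* o
                  e₁ = solve-∀

            isβSubgraph : ∀ e → 0ℚ ℚ.≤ e → (ι (2 ℕ.* m) ℚ.+ ι (2 ℕ.* m)) ℚ.* e ≡ 1ℚ →
              IsβSubgraph (½ℝ + fromℚ e) H G
            isβSubgraph e 0≤e eq = record
              { edges   = λ i j h → edge i j h
              ; degrees = λ i ε 0<ε → 0 , λ _ _ → ℚ.≤-trans (degrees′ i) (≤+ (+ degree H i / 1) ε (ℚ.<⇒≤ 0<ε))
              }
              where
              ≤+ : ∀ p e → 0ℚ ℚ.≤ e → p ℚ.≤ p ℚ.+ e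
              ≤+ p e h = by h (solve 2 (λ p e → e := (p :+ e) :+ :- p) refl p e)
              edge : ∀ i j → Adj H i j → Adj G i j
              edge i j h with join i j
              ... | true = refl
              x : ℚ
              x = ι (2 ℕ.* m)
              degree-ι : ∀ i → (1ℚ ℚ.+ x) ℚ.* ι (degree G i) ℚ.≤ (x ℚ.+ x) ℚ.* ι (degree H i)
              degree-ι i = subst₂ ℚ._≤_
                (trans (ι-* (1 ℕ.+ 2 ℕ.* m) (degree G i)) (cong (ℚ._* ι (degree G i))
                  (trans (ι-+ 1 (2 ℕ.* m)) (cong (ℚ._+ x) ι-1))))
                (trans (ι-* (2 ℕ.* m ℕ.+ 2 ℕ.* m) (degree H i)) (cong (ℚ._* ι (degree H i)) (ι-+ (2 ℕ.* m) (2 ℕ.* m))))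
                (ι-mono (degree-ineq i))
              degrees′ : ∀ i → (½ ℚ.+ e) ℚ.* (+ degree G i / 1) ℚ.≤ + degree H i / 1
              degrees′ i = subst₂ (λ g k → (½ ℚ.+ e) ℚ.* g ℚ.≤ k) (ι-def (degree G i)) (ι-def (degree H i))
                (half+ε x e (ι (degree G i)) (ι (degree H i)) eq 0≤e (degree-ι i))

      refute : ∀ e → 0ℚ ℚ.≤ e → (ι (2 ℕ.* m) ℚ.+ ι (2 ℕ.* m)) ℚ.* e ≡ 1ℚ →
        ∀ ω (v : Vec Cell n) → Word v → (∀ i → InGrid (lookup v i)) → (∀ i → EventuallyNear (lookup v i) (ω i)) →
        Typical h v → ¬ AllSubgraphsHamiltonian n (½ℝ + fromℚ e) radius ω
      refute e 0≤e eq ω v word inGrid near typical all =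
        ¬¬-∀ n (λ i → ¬¬-∀ n λ j → ¬¬-excluded-middle) λ _~?_ →
          H-not-hamiltonian word typical inGrid _~_ ~-sym close⇒~ far⇒≁ _~?_
            (all (G word typical inGrid _~_ ~-sym close⇒~ far⇒≁ _~?_) (G-adj word typical inGrid _~_ ~-sym close⇒~ far⇒≁ _~?_)
              (H word typical inGrid _~_ ~-sym close⇒~ far⇒≁ _~?_)
              (isβSubgraph word typical inGrid _~_ ~-sym close⇒~ far⇒≁ _~?_ e 0≤e eq))
        where
        _~_ : Fin n → Fin n → Set
        i ~ j = torusDist (ω i) (ω j) ≤ radius
        ~-sym : ∀ i j → i ~ j → j ~ i
        ~-sym i j = torusDist-sym (ω i) (ω j) {radius}
        close⇒~ : ∀ i j → close (lookup v i) (lookup v j) ≡ true → i ~ j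
        close⇒~ i j = close⇒≤ {lookup v i} {lookup v j} {ω i} {ω j} (inGrid i) (inGrid j) (near i) (near j)
        far⇒≁ : ∀ i j → reach (lookup v i) (lookup v j) ≡ false → ¬ (i ~ j)
        far⇒≁ i j = far⇒≰ {lookup v i} {lookup v j} {ω i} {ω j} (inGrid i) (inGrid j) (near i) (near j)

-- Growth of the logarithm, choice of the radius, and conclusion

module Assembly where

  open import Data.Nat.Tactic.RingSolver using (solve-∀)
  open import Relation.Nullary.Decidable using (from-yes)
  open Sums using (Geometry)
  open Rationals
  open GridDistance
  open RealDistance
  open Cover
  open Resilience
  open import Defs hiding (∣_∣)

  reciprocal : ℕ → ℚ
  reciprocal a = + 1 / suc (ℕ.pred a)

  0<reciprocal : ∀ a → 0ℚ ℚ.< reciprocal a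
  0<reciprocal a = 0<1/suc (ℕ.pred a)

  0≤reciprocal : ∀ a → 0ℚ ℚ.≤ reciprocal a
  0≤reciprocal a = ℚ.<⇒≤ (0<reciprocal a)

  ι-reciprocal : ∀ {a} → 0 ℕ.< a → ι a ℚ.* reciprocal a ≡ 1ℚ
  ι-reciprocal {suc k} _ = ι-inverse k

  -- The first `M` terms are at most 1, the others at most 1/(M + 1). This crude bound already makes
  -- the harmonic sums sublinear.
  harmonic-≤ : ∀ M j → harmonic (j ℕ.+ M) ℚ.≤ ι M ℚ.+ ι j ℚ.* reciprocal (suc M)
  harmonic-≤ M j = ℚ.≤-trans (harmonic-upper M M j ℕ.≤-refl)
    (ℚ.+-mono-≤ harmonic-M (ℚ.≤-reflexive (fraction-ι j M)))
    where
    harmonic-M : harmonic M ℚ.≤ ι M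
    harmonic-M = ℚ.≤-trans (ℚ.≤-reflexive (cong harmonic (sym (ℕ.+-identityʳ M))))
      (ℚ.≤-trans (harmonic-upper 0 0 M ℕ.≤-refl)
        (ℚ.≤-reflexive (trans (ℚ.+-identityˡ (+ M / 1)) (sym (ι-def M)))))

  -- The unit block of the Riemann sum starting at an integer `i` contributes at most 1/i, whatever
  -- the mesh.
  riemann-≤ : ∀ k b → riemann (suc k) (suc b) ℚ.≤ harmonic k
  riemann-≤ k b = p≤q+r⇒p-q≤r (go k)
    where
    go : ∀ k → harmonic (suc k ℕ.* suc b) ℚ.≤ harmonic (suc b) ℚ.+ harmonic k
    go zero    = ℚ.≤-reflexive (trans (cong harmonic (ℕ.*-identityˡ (suc b))) (sym (ℚ.+-identityʳ (harmonic (suc b)))))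
    go (suc k) = ℚ.≤-trans (block-upper k b)
      (ℚ.≤-trans (ℚ.+-monoˡ-≤ (+ 1 / suc k) (go k))
        (ℚ.≤-reflexive (ℚ.+-assoc (harmonic (suc b)) (harmonic k) (+ 1 / suc k))))

  -- As `M = 2w`, the head contributes at most M²/2 and the tail at most j/2 after multiplication by
  -- `w`; both M² and `j` are at most `k`.
  harmonic-small : ∀ w k → let M = w ℕ.+ w in M ℕ.+ M ℕ.* M ℕ.≤ k →
    ι w ℚ.* harmonic k ℚ.≤ ι (suc k)
  harmonic-small w k large = subst (λ k → ι w ℚ.* harmonic k ℚ.≤ ι (suc k)) (ℕ.m∸n+n≡m M≤k)
    (finish (ι w) (ι M) (ι j) s (harmonic (j ℕ.+ M)) (ι (suc (j ℕ.+ M)))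
      (0≤ι w) (0≤ι j) (harmonic-≤ M j) s-small (subst₂ ℚ._≤_ split-ι (ι-+ (suc (j ℕ.+ M)) (suc (j ℕ.+ M))) (ι-mono nat)))
    where
    M j : ℕ
    M = w ℕ.+ w
    j = k ℕ.∸ M
    s : ℚ
    s = reciprocal (suc M)
    M≤k : M ℕ.≤ k
    M≤k = ℕ.≤-trans (ℕ.m≤m+n M (M ℕ.* M)) large
    s-small : (ι w ℚ.+ ι w) ℚ.* s ℚ.≤ 1ℚ
    s-small = subst₂ ℚ._≤_ (cong (ℚ._* s) (ι-+ w w)) (ι-inverse M)
      (ℚ.*-monoʳ-≤-nonNeg s {{nonNegative (0≤reciprocal (suc M))}} (ι-mono (ℕ.n≤1+n M)))
    nat : M ℕ.* M ℕ.+ j ℕ.≤ suc (j ℕ.+ M) ℕ.+ suc (j ℕ.+ M)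
    nat = ℕ.+-mono-≤
      (ℕ.≤-trans (ℕ.m≤n+m (M ℕ.* M) M) (ℕ.≤-trans large (ℕ.≤-trans (ℕ.≤-reflexive (sym (ℕ.m∸n+n≡m M≤k))) (ℕ.n≤1+n _))))
      (ℕ.≤-trans (ℕ.m≤m+n j M) (ℕ.n≤1+n _))
    split-ι : ι (M ℕ.* M ℕ.+ j) ≡ (ι w ℚ.+ ι w) ℚ.* ι M ℚ.+ ι j
    split-ι = trans (ι-+ (M ℕ.* M) j) (cong (ℚ._+ ι j) (trans (ι-* M M) (cong (ℚ._* ι M) (ι-+ w w))))
    finish : ∀ w m j s h n → 0ℚ ℚ.≤ w → 0ℚ ℚ.≤ j → h ℚ.≤ m ℚ.+ j ℚ.* s → (w ℚ.+ w) ℚ.* s ℚ.≤ 1ℚ →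
      (w ℚ.+ w) ℚ.* m ℚ.+ j ℚ.≤ n ℚ.+ n → w ℚ.* h ℚ.≤ n
    finish w m j s h n 0≤w 0≤j h₁ h₂ h₃ = by
      (0≤+ (0≤* 0≤w (≤⇒0≤ h₁)) (0≤* (ℚ.<⇒≤ (0<1/suc 1)) (0≤+ (≤⇒0≤ h₃) (0≤* 0≤j (≤⇒0≤ h₂)))))
      (solve 6 (λ w m j s h n → w :* ((m :+ j :* s) :+ :- h) :+
          con ½ :* (((n :+ n) :+ :- ((w :+ w) :* m :+ j)) :+ j :* (con 1ℚ :+ :- ((w :+ w) :* s)))
        := n :+ :- (w :* h)) refl w m j s h n)

  ≤-refl-ℝ : ∀ x → x ≤ x
  ≤-refl-ℝ x ε 0<ε = 0 , λ n _ → by (ℚ.<⇒≤ 0<ε)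
    (solve 2 (λ p e → e := (p :+ e) :+ :- p) refl (seq x n) ε)

  *-√-≤ : ∀ C s K t r → 0ℚ ℚ.≤ K → 0ℚ ℚ.≤ t → (∃ λ N → ∀ n → N ℕ.≤ n → ℚ.∣ seq C n ∣ ℚ.≤ K) →
    (∀ n → seq s n ℚ.≤ t ℚ.* t) → K ℚ.* t ℚ.≤ r → C * √ s ≤ fromℚ r
  *-√-≤ C s K t r 0≤K 0≤t (N , bounded) small Kt≤r ε 0<ε = N , λ n n≥N →
    bound (seq C n) (sqrtℚ n (seq s n)) (ℚ.<⇒≤ 0<ε) (0≤fraction (maxRoot n (seq s n)) n)
      (bounded n n≥N) (sqrt-≤ n 0≤t (small n))
    where
    bound : ∀ c q {ε} → 0ℚ ℚ.≤ ε → 0ℚ ℚ.≤ q → ℚ.∣ c ∣ ℚ.≤ K → q ℚ.≤ t → c ℚ.* q ℚ.≤ r ℚ.+ ε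
    bound c q {ε} 0≤ε 0≤q hc hq = ℚ.≤-trans (*-mono-q (ℚ.≤-trans (p≤∣p∣ c) hc))
      (ℚ.≤-trans (ℚ.*-monoˡ-≤-nonNeg K {{nonNegative 0≤K}} hq)
        (ℚ.≤-trans Kt≤r (by 0≤ε (solve 2 (λ p e → e := (p :+ e) :+ :- p) refl r ε))))
      where
      *-mono-q : c ℚ.≤ K → c ℚ.* q ℚ.≤ K ℚ.* q
      *-mono-q = ℚ.*-monoʳ-≤-nonNeg q {{nonNegative 0≤q}}

  threshold : ∀ (C : ℝ) r → 0ℚ ℚ.< r → ∃ λ N → ∀ k → N ℕ.≤ k →
    C * √ (log (suc k) * fromℚ (+ 1 / suc k)) ≤ fromℚ r
  threshold C r 0<r = combine (eventually-bounded {seq C} (cauchy C))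
    where
    Goal : Set
    Goal = ∃ λ N → ∀ k → N ℕ.≤ k → C * √ (log (suc k) * fromℚ (+ 1 / suc k)) ≤ fromℚ r
    combine : (∃ λ K → 0ℚ ℚ.< K × ∃ λ N → ∀ n → N ℕ.≤ n → ℚ.∣ seq C n ∣ ℚ.≤ K) → Goal
    combine (K , 0<K , bounded) = choose (split K K r 0<K 0<K 0<r)
      where
      choose : (∃ λ δ → 0ℚ ℚ.< δ × K ℚ.* δ ℚ.+ K ℚ.* δ ≡ r) → Goal
      choose (δ , 0<δ , eq) = finish (archimedean δ 0<δ)
        where
        finish : (∃ λ N → ∀ m → N ℕ.≤ m → + 1 / suc m ℚ.< δ) → Goal
        finish (a , inv) = M ℕ.+ M ℕ.* M , λ k k≥ →
          *-√-≤ C (log (suc k) * fromℚ (+ 1 / suc k)) K t r (ℚ.<⇒≤ 0<K) 0≤t bounded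
            (λ n → scaled (ι b) t (riemann (suc k) (suc n)) (harmonic k) (ι (suc k)) (+ 1 / suc k)
              0≤t (ι-inverse a) (ℚ.<⇒≤ (0<1/suc k)) (ι-inverse k) (riemann-≤ k n) (0≤ι b)
              (subst (λ z → z ℚ.* harmonic k ℚ.≤ ι (suc k)) (ι-* b b) (harmonic-small w k k≥)))
            Kt≤r
          where
          b w M : ℕ
          -- `b` is 1/t, so with `w = b²` the bound `w * harmonic k ≤ k + 1` says that log n / n is
          -- at most t².
          b = suc a
          w = b ℕ.* b
          M = w ℕ.+ w
          t : ℚ
          t = + 1 / suc a
          0≤t : 0ℚ ℚ.≤ t
          0≤t = ℚ.<⇒≤ (0<1/suc a)
          Kt≤r : K ℚ.* t ℚ.≤ r
          Kt≤r = ℚ.≤-trans (ℚ.*-monoˡ-≤-nonNeg K {{nonNegative (ℚ.<⇒≤ 0<K)}} (ℚ.<⇒≤ (inv a ℕ.≤-refl)))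
            (ℚ.≤-trans (ℚ.≤-reflexive (sym (ℚ.+-identityʳ (K ℚ.* δ))))
              (ℚ.≤-trans (ℚ.+-monoʳ-≤ (K ℚ.* δ) (0≤* (ℚ.<⇒≤ 0<K) (ℚ.<⇒≤ 0<δ))) (ℚ.≤-reflexive eq)))
          scaled : ∀ T t ρ h n v → 0ℚ ℚ.≤ t → T ℚ.* t ≡ 1ℚ → 0ℚ ℚ.≤ v → n ℚ.* v ≡ 1ℚ → ρ ℚ.≤ h → 0ℚ ℚ.≤ T →
            T ℚ.* T ℚ.* h ℚ.≤ n → ρ ℚ.* v ℚ.≤ t ℚ.* t
          scaled T t ρ h n v 0≤t Tt≡1 0≤v nv≡1 ρ≤h 0≤T Th≤n = ℚ.≤-trans
            (ℚ.*-monoʳ-≤-nonNeg v {{nonNegative 0≤v}} ρ≤h)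
            (subst₂ ℚ._≤_ left right
              (ℚ.*-monoʳ-≤-nonNeg (v ℚ.* (t ℚ.* t)) {{nonNegative (0≤* 0≤v (0≤* 0≤t 0≤t))}} Th≤n))
            where
            left : T ℚ.* T ℚ.* h ℚ.* (v ℚ.* (t ℚ.* t)) ≡ h ℚ.* v
            left = trans (solve 4 (λ T h v t → T :* T :* h :* (v :* (t :* t)) := T :* t :* (T :* t) :* (h :* v)) refl T h v t)
              (trans (cong (λ z → z ℚ.* z ℚ.* (h ℚ.* v)) Tt≡1) (trans (cong (ℚ._* (h ℚ.* v)) (ℚ.*-identityˡ 1ℚ)) (ℚ.*-identityˡ (h ℚ.* v))))
            right : n ℚ.* (v ℚ.* (t ℚ.* t)) ≡ t ℚ.* t
            right = trans (sym (ℚ.*-assoc n v (t ℚ.* t))) (trans (cong (ℚ._* (t ℚ.* t)) nv≡1) (ℚ.*-identityˡ (t ℚ.* t)))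

  module Construction (geometry : Geometry) where

    open Geometry geometry

    U : ℕ
    U = L ℕ.* M

    0<U : 0 ℕ.< U
    0<U = ℕ.*-mono-< {0} {L} {0} {M} 0<L 0<M

    u : ℚ
    u = reciprocal U

    0<u : 0ℚ ℚ.< u
    0<u = 0<reciprocal U

    LMu : ι (L ℕ.* M) ℚ.* u ≡ 1ℚ
    LMu = ι-reciprocal 0<U

    open CellWords M
    open Refutation geometry u 0<u LMu
    open Location M L ρ u 0<u LMu using (radius)
    open Covering M L ρ u 0<u LMu 0<M 0<L

    0<m′ : 0 ℕ.< m
    0<m′ = subst (0 ℕ.<_) (sym (length-cells M)) (ℕ.*-mono-< {0} {M} {0} {M} 0<M 0<M)

    -- ε = 1/(4m), as `half+ε` gives for `x = 2m`.
    e : ℚ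
    e = reciprocal (2 ℕ.* m ℕ.+ 2 ℕ.* m)

    0<e : 0ℚ ℚ.< e
    0<e = 0<reciprocal (2 ℕ.* m ℕ.+ 2 ℕ.* m)

    0≤e : 0ℚ ℚ.≤ e
    0≤e = ℚ.<⇒≤ 0<e

    0<2m : 0 ℕ.< 2 ℕ.* m
    0<2m = ℕ.≤-trans 0<m′ (ℕ.m≤m+n m _)

    ιe : (ι (2 ℕ.* m) ℚ.+ ι (2 ℕ.* m)) ℚ.* e ≡ 1ℚ
    ιe = trans (cong (ℚ._* e) (sym (ι-+ (2 ℕ.* m) (2 ℕ.* m))))
      (ι-reciprocal (ℕ.≤-trans 0<2m (ℕ.m≤m+n (2 ℕ.* m) _)))

    e≤½ : e ℚ.≤ ½
    e≤½ = half (ι (2 ℕ.* m)) e ιe 0≤e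
      (≤⇒0≤ (subst (ℚ._≤ ι (2 ℕ.* m)) ι-1 (ι-mono 0<2m)))
      where
      half : ∀ x e → (x ℚ.+ x) ℚ.* e ≡ 1ℚ → 0ℚ ℚ.≤ e → 0ℚ ℚ.≤ x ℚ.- 1ℚ → e ℚ.≤ ½
      half x e eq 0≤e h = subst (λ o → e ℚ.≤ ½ ℚ.* o) eq (by (0≤* h 0≤e)
        (solve 2 (λ x e → (x :+ :- con 1ℚ) :* e := con ½ :* ((x :+ x) :* e) :+ :- e) refl x e))

    0<radius : 0ℚ ℚ.< ι ρ ℚ.* u
    0<radius = 0<* (ℚ.<-≤-trans (subst (0ℚ ℚ.<_) (sym ι-1) (0<1/suc 0)) (ι-mono 0<ρ)) 0<u

    module _ (C : ℝ) where

      N₀ : ℕ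
      N₀ = proj₁ (threshold C (ι ρ ℚ.* u) 0<radius)

      -- Up to `N₀` the prescribed lower bound itself is taken; the value at 0, where no bound is
      -- prescribed, is a default. The decision is an argument so that proofs can split on it.
      r-at : ∀ n → Dec (N₀ ℕ.< n) → ℝ
      r-at n       (yes _) = radius
      r-at zero    (no _)  = radius
      r-at (suc k) (no _)  = C * √ (log (suc k) * fromℚ (+ 1 / suc k))

      r : ℕ → ℝ
      r n = r-at n (N₀ ℕ.<? n)

      r-large : ∀ k (d : Dec (N₀ ℕ.< suc k)) → r-at (suc k) d ≥ C * √ (log (suc k) * fromℚ (+ 1 / suc k))
      r-large k (yes (ℕ.s≤s N₀≤k)) = proj₂ (threshold C (ι ρ ℚ.* u) 0<radius) k N₀≤k
      r-large k (no _)     = ≤-refl-ℝ (C * √ (log (suc k) * fromℚ (+ 1 / suc k)))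

      r-radius : ∀ n → N₀ ℕ.< n → (d : Dec (N₀ ℕ.< n)) → r-at n d ≡ radius
      r-radius n       lt (yes _)  = refl
      r-radius n       lt (no ¬lt) = ⊥-elim (¬lt lt)

      r≥ : (n : ℕ) → .{{_ : NonZero n}} → r n ≥ C * √ (log n * fromℚ (+ 1 / n))
      r≥ zero {{z}} = ⊥-elim (ℕ.≢-nonZero⁻¹ 0 {{z}} refl)
      r≥ (suc k)    = r-large k (N₀ ℕ.<? suc k)

      not-whp : ¬ WithHighProbability (λ n → AllSubgraphsHamiltonian n (½ℝ + fromℚ e) (r n))
      not-whp whp = combine (whp ¼ (0<* (0<1/suc 1) (0<1/suc 1)))
        where
        combine : (∃ λ N → ∀ n → N ℕ.≤ n →
          ProbAtLeast (AllSubgraphsHamiltonian n (½ℝ + fromℚ e) (r n)) (1ℚ ℚ.- ¼)) → ⊥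
        combine (N , prob) = improbable n′ 0<n (AllSubgraphsHamiltonian n′ (½ℝ + fromℚ e) radius) h large positive
          (λ ω v word inGrid near typical all → refute h 0<h e 0≤e ιe ω v word inGrid near typical all)
          (from-yes (½ ℚ.<? 1ℚ ℚ.- ¼))
          (subst (λ r → ProbAtLeast (AllSubgraphsHamiltonian n′ (½ℝ + fromℚ e) r) (1ℚ ℚ.- ¼))
            (r-radius n′ (ℕ.≤-trans (ℕ.s≤s (ℕ.≤-trans (ℕ.m≤n+m N₀ N) (ℕ.m≤m+n (N ℕ.+ N₀) _))) h≤n) (N₀ ℕ.<? n′))
            (prob n′ (ℕ.≤-trans (ℕ.≤-trans (ℕ.m≤m+n N N₀) (ℕ.≤-trans (ℕ.m≤m+n (N ℕ.+ N₀) _) (ℕ.n≤1+n _))) h≤n)))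
          where
          h n′ : ℕ
          -- `N` and `N₀` make `n′` large enough for the assumed limit and for the constant radius;
          -- `32 m³ ≤ h` is what Chebyshev's condition `4 m² n′ ≤ h²` amounts to.
          h = suc (N ℕ.+ N₀ ℕ.+ 32 ℕ.* (m ℕ.* m ℕ.* m))
          n′ = 8 ℕ.* (m ℕ.* h)
          0<h : 0 ℕ.< h
          0<h = ℕ.z<s
          h≤n : h ℕ.≤ n′
          h≤n = ℕ.≤-trans (ℕ.≤-trans (ℕ.≤-reflexive (sym (ℕ.*-identityˡ h))) (ℕ.*-monoˡ-≤ h 0<m′)) (ℕ.m≤m+n (m ℕ.* h) _)
          0<n : 0 ℕ.< n′
          0<n = ℕ.≤-trans 0<h h≤n
          large : 4 ℕ.* (m ℕ.* m ℕ.* n′) ℕ.≤ h ℕ.* h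
          large = ℕ.≤-trans (ℕ.≤-reflexive (rearrange m h))
            (ℕ.*-monoˡ-≤ h (ℕ.≤-trans (ℕ.m≤n+m _ (N ℕ.+ N₀)) (ℕ.n≤1+n _)))
            where
            rearrange : ∀ m h → 4 ℕ.* (m ℕ.* m ℕ.* (8 ℕ.* (m ℕ.* h))) ≡ 32 ℕ.* (m ℕ.* m ℕ.* m) ℕ.* h
            rearrange = solve-∀
          positive : 0 ℕ.< m ℕ.* m ℕ.* n′
          positive = ℕ.*-mono-< {0} {m ℕ.* m} {0} {n′} (ℕ.*-mono-< {0} {m} {0} {m} 0<m′ 0<m′) 0<n

    theorem : ∃ λ (ε : ℝ) → 0ℝ < ε × ε ≤ ½ℝ ×
      ((C : ℝ) → 0ℝ < C →
        Σ (ℕ → ℝ) λ r →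
          ((n : ℕ) → .{{_ : NonZero n}} →
            r n ≥ C * √ (log n * fromℚ (+ 1 / n))) ×
          ¬ WithHighProbability
              (λ n → AllSubgraphsHamiltonian n (½ℝ + ε) (r n)))
    theorem = fromℚ e
      , (e , 0<e , 0 , λ _ _ → ℚ.≤-reflexive (ℚ.+-identityˡ e))
      , (λ ε 0<ε → 0 , λ _ _ → ℚ.≤-trans e≤½ (by (ℚ.<⇒≤ 0<ε) (solve 2 (λ p e → e := (p :+ e) :+ :- p) refl ½ ε)))
      , λ C _ → r C , r≥ C , not-whp C

open import Defs

mainTheorem5 : ∃ λ (ε : ℝ) → 0ℝ < ε × ε ≤ ½ℝ ×
    ((C : ℝ) → 0ℝ < C →
    Σ (ℕ → ℝ) λ r →
    ((n : ℕ) → .{{_ : NonZero n}} →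
    r n ≥ C * √ (log n * fromℚ (+ 1 / n))) ×
    ¬ WithHighProbability
    (λ n → AllSubgraphsHamiltonian n (½ℝ + ε) (r n)))
mainTheorem5 = Assembly.Construction.theorem BlobPattern.geometry
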